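{- Let $k,x,b$ be positive integers and let $a$ be a nonnegative integer such that $k=a+b$. Then \[\binom{2k}{k}=\binom{2a}{a}\binom{x+2b}{b}\] if and only if $x=a=1$. -}

module Defs where

{-# OPTIONS --safe #-}
-- Dividing by the central binomial coefficients turns the equation into R (a , b) = F (x , b), where
-- R (a , b) = C (2 (a + b) , a + b) / (C (2 a , a) C (2 b , b)) is symmetric, increasing and less than 2 √a and 2 √b, and
-- F (x , b) = C (x + 2 b , b) / C (2 b , b) = ∏_{i ≤ x} (2 b + i) / (b + i) is increasing in x. Since F (0 , b) = R (0 , b)
-- and F (1 , b) = R (1 , b), only min (a , b) ≥ 2 remains, or b = 1. Put m = min (a , b) and M = max (a , b).
--
-- If m is large, the equation is refuted by its primes. A prime p > 2 m dividing one of 2 M + 1, …, 2 M + 2 m divides exactly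
-- one of numerator ∏ (2 M + 2 i - 1) and denominator ∏ (M + i) of R, so it has to occur among the few factors of F. It follows
-- that C (2 (a + b) , K) has no prime factor above K + 2 x, for K = 2 b if b = m and for K = 2 a - 2 x if a = m, while
-- 2 ^ x ≤ 4 m. This contradicts Erdős' argument for the theorem of Sylvester and Schur: a prime power dividing C (n , K) is at
-- most n, and the product of the primes up to s is at most 4 ^ s.
-- The estimates are explicit and work from m = 650 on.
--
-- For each smaller m, monotonicity in M leaves finitely many comparisons of R with values of F; they are computed.
module Submission where

open import Defs
open import Data.Nat
open import Data.Nat.Properties
open import Data.Nat.Combinatorics using (_C_; nCk≡n!/k![n-k]!; k![n∸k]!∣n!)
open import Data.Nat.Divisibility
open import Data.Nat.DivMod using (m/n*n≡m; m/n*n≤m; m≡m%n+[m/n]*n; m%n<n; /-monoˡ-≤)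
open import Data.Nat.GCD using (gcd; gcd[m,n]∣m; gcd[m,n]∣n)
open import Data.Nat.Induction using (<-rec)
open import Data.Nat.ListAction using (product)
open import Data.Nat.Primality
open import Data.Nat.Primality.Factorisation using (factorise)
open import Data.Nat.Tactic.RingSolver using (solve-∀)
open import Algebra.Properties.CommutativeSemigroup *-commutativeSemigroup using (x∙yz≈y∙xz)
open import Data.Bool using (Bool; true; _∧_; T)
open import Data.Empty using (⊥; ⊥-elim)
open import Data.List using (List; []; _∷_)
open import Data.List.Relation.Unary.All using (_∷_)
open import Data.Product using (_×_; _,_; proj₁; proj₂; ∃-syntax)
open import Data.Sum using (_⊎_; inj₁; inj₂)
open import Data.Unit using (tt)
open import Function using (case_of_)
open import Function.Bundles using (_⇔_; mk⇔)
open import Relation.Binary.Definitions using (tri<; tri≈; tri>)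
open import Relation.Binary.PropositionalEquality
open import Relation.Nullary using (¬_; yes; no)
open import Relation.Nullary.Decidable using (toWitness)

-- Products and binomial coefficients

-- The two sides cannot be told apart by size alone: R tends to about √(pi m) as M grows, F (x , b)
-- tends to 2 ^ x as b grows, and no gap between them is uniform in m. Hence computation for small m
-- and divisibility for large m. In the window 2 M + 1, ..., 2 M + 2 m the odd members stand in the
-- numerator of R and the even ones, halved, in its denominator, so a prime above 2 m dividing a
-- member cannot cancel within R. If b = m, the factors of F are at most 2 m + x. If b = M, they are
-- as large as the window itself; doubled where necessary, they lie among its first 2 x members, and
-- leaving these out costs the 2 x in K. Erdős' argument thus has to admit primes slightly above K.
-- The margin is logarithmic, but it is felt when n < 3 K, where the primes above K are bounded
-- separately. This range dictates the threshold: its estimates yield K ≤ 1235, rounded to K < 1250.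
-- With K = 2 m this asks for m ≥ 625, and the remaining 25 up to 650 make room for m - x.

even-or-odd : ∀ n → (∃[ q ] n ≡ 2 * q) ⊎ (∃[ q ] n ≡ suc (2 * q))
even-or-odd zero = inj₁ (0 , refl)
even-or-odd (suc n) with even-or-odd n
... | inj₁ (q , n≡) = inj₂ (q , cong suc n≡)
... | inj₂ (q , n≡) = inj₁ (suc q , trans (cong suc n≡) (sym (*-suc 2 q)))

^-distribʳ-* : ∀ e m n → (m * n) ^ e ≡ m ^ e * n ^ e
^-distribʳ-* zero    m n = refl
^-distribʳ-* (suc e) m n = trans (cong (m * n *_) (^-distribʳ-* e m n)) ([m*n]*[o*p]≡[m*o]*[n*p] m n (m ^ e) (n ^ e))

∏ : ℕ → (ℕ → ℕ) → ℕ
∏ zero    f = 1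
∏ (suc d) f = f d * ∏ d f

rising : ℕ → ℕ → ℕ
rising n d = ∏ d (λ i → n + suc i)

-- `odds 0 n` is the double factorial (2 n - 1)!!. Splitting (2 n)! as 2 ^ n * n ! * (2 n - 1)!!
-- separates odd from even factors, which is the form the prime argument needs.
odds : ℕ → ℕ → ℕ
odds n d = ∏ d (λ i → 2 * n + suc (2 * i))

∏-mono : ∀ d {f g : ℕ → ℕ} → (∀ i → i < d → f i ≤ g i) → ∏ d f ≤ ∏ d g
∏-mono zero    f≤g = ≤-refl
∏-mono (suc d) f≤g = *-mono-≤ (f≤g d ≤-refl) (∏-mono d (λ i i<d → f≤g i (m<n⇒m<1+n i<d)))

∏-cong : ∀ d {f g : ℕ → ℕ} → (∀ i → f i ≡ g i) → ∏ d f ≡ ∏ d g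
∏-cong zero    f≡g = refl
∏-cong (suc d) f≡g = cong₂ _*_ (f≡g d) (∏-cong d f≡g)

∏-* : ∀ d (f g : ℕ → ℕ) → ∏ d (λ i → f i * g i) ≡ ∏ d f * ∏ d g
∏-* zero    f g = refl
∏-* (suc d) f g rewrite ∏-* d f g = [m*n]*[o*p]≡[m*o]*[n*p] (f d) (g d) (∏ d f) (∏ d g)

∏-const : ∀ d c → ∏ d (λ _ → c) ≡ c ^ d
∏-const zero    c = refl
∏-const (suc d) c = cong (c *_) (∏-const d c)

∏-+ : ∀ c d (f : ℕ → ℕ) → ∏ (c + d) f ≡ ∏ c f * ∏ d (λ i → f (c + i))
∏-+ c zero f rewrite +-identityʳ c = sym (*-identityʳ _)
∏-+ c (suc d) f rewrite +-suc c d | ∏-+ c d f =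
  x∙yz≈y∙xz (f (c + d)) (∏ c f) (∏ d (λ i → f (c + i)))

∏-pos : ∀ d {f : ℕ → ℕ} → (∀ i → i < d → 0 < f i) → 0 < ∏ d f
∏-pos zero    0<f = z<s
∏-pos (suc d) 0<f = *-mono-≤ (0<f d ≤-refl) (∏-pos d (λ i i<d → 0<f i (m<n⇒m<1+n i<d)))

∣-∏ : ∀ {d i} (f : ℕ → ℕ) → i < d → f i ∣ ∏ d f
∣-∏ {suc d} {i} f i<1+d with i ≟ d
... | yes refl = m∣m*n (∏ d f)
... | no  i≢d  = ∣n⇒∣m*n (f d) (∣-∏ f (≤∧≢⇒< (s≤s⁻¹ i<1+d) i≢d))

-- The hypothesis is f / g ≤ f′ / g′ factor by factor, cleared of denominators.
∏-cross : ∀ d {f g f′ g′ : ℕ → ℕ} → (∀ i → i < d → f i * g′ i ≤ f′ i * g i) →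
          ∏ d f * ∏ d g′ ≤ ∏ d f′ * ∏ d g
∏-cross d {f} {g} {f′} {g′} h =
  subst₂ _≤_ (∏-* d f g′) (∏-* d f′ g) (∏-mono d h)

prime∣∏ : ∀ {p} → Prime p → ∀ d {f : ℕ → ℕ} → p ∣ ∏ d f → ∃[ i ] i < d × p ∣ f i
prime∣∏ pr zero p∣1 with ∣1⇒≡1 p∣1
... | refl = ⊥-elim (¬prime[1] pr)
prime∣∏ pr (suc d) {f} p∣ with euclidsLemma (f d) (∏ d f) pr p∣
... | inj₁ p∣fd = d , ≤-refl , p∣fd
... | inj₂ p∣∏ with prime∣∏ pr d p∣∏
...   | i , i<d , p∣fi = i , m<n⇒m<1+n i<d , p∣fi

rising-pos : ∀ n d → 0 < rising n d
rising-pos n d = ∏-pos d (λ i _ → ≤-trans z<s (m≤n+m (suc i) n))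

odds-pos : ∀ n d → 0 < odds n d
odds-pos n d = ∏-pos d (λ i _ → ≤-trans z<s (m≤n+m (suc (2 * i)) (2 * n)))

!-rising : ∀ n d → (n + d) ! ≡ n ! * rising n d
!-rising n zero rewrite +-identityʳ n = sym (*-identityʳ _)
!-rising n (suc d) = begin
  (n + suc d) !                         ≡⟨ cong _! (+-suc n d) ⟩
  suc (n + d) * (n + d) !               ≡⟨ cong₂ _*_ (sym (+-suc n d)) (!-rising n d) ⟩
  (n + suc d) * (n ! * rising n d)      ≡⟨ x∙yz≈y∙xz (n + suc d) (n !) (rising n d) ⟩
  n ! * rising n (suc d)                ∎
  where open ≡-Reasoning

C-! : ∀ n d → ((n + d) C d) * (d ! * n !) ≡ (n + d) !
C-! n d = begin
  ((n + d) C d) * (d ! * n !)                    ≡⟨ cong (λ z → ((n + d) C d) * (d ! * z !)) (m+n∸n≡m n d) ⟨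
  ((n + d) C d) * (d ! * (n + d ∸ d) !)          ≡⟨ cong (_* (d ! * (n + d ∸ d) !)) (nCk≡n!/k![n-k]! d≤) ⟩
  _                                              ≡⟨ m/n*n≡m {{d !* (n + d ∸ d) !≢0}} (k![n∸k]!∣n! d≤) ⟩
  (n + d) !                                      ∎
  where
  open ≡-Reasoning
  d≤ : d ≤ n + d
  d≤ = m≤n+m d n

C-rising : ∀ n d → ((n + d) C d) * d ! ≡ rising n d
C-rising n d = *-cancelʳ-≡ _ _ (n !) {{n !≢0}} (begin
  ((n + d) C d) * d ! * n !     ≡⟨ *-assoc ((n + d) C d) (d !) (n !) ⟩
  ((n + d) C d) * (d ! * n !)   ≡⟨ C-! n d ⟩
  (n + d) !                     ≡⟨ !-rising n d ⟩
  n ! * rising n d              ≡⟨ *-comm (n !) (rising n d) ⟩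
  rising n d * n !              ∎)
  where open ≡-Reasoning

C-pos : ∀ n d → 0 < (n + d) C d
C-pos n d with (n + d) C d | C-rising n d
... | zero  | eq = ⊥-elim (<-irrefl eq (rising-pos n d))
... | suc _ | _  = z<s

strip : ∀ {p} → Prime p → ∀ n → 0 < n → ∃[ f ] ∃[ u ] n ≡ p ^ f * u × ¬ p ∣ u
strip {p} pr n 0<n = go n n ≤-refl 0<n
  where
  go : ∀ fuel n → n ≤ fuel → 0 < n → ∃[ f ] ∃[ u ] n ≡ p ^ f * u × ¬ p ∣ u
  go zero n n≤ 0<n = ⊥-elim (<⇒≱ 0<n n≤)
  go (suc fuel) n n≤ 0<n with p ∣? n
  ... | no p∤n = 0 , n , sym (*-identityˡ n) , p∤n
  ... | yes (divides zero refl) = ⊥-elim (<-irrefl refl 0<n)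
  ... | yes (divides q@(suc q-1) refl)
    with go fuel q (s≤s⁻¹ (≤-trans (m<m*n q p (nonTrivial⇒n>1 p {{prime⇒nonTrivial pr}})) n≤)) z<s
  ...   | f , u , q≡ , p∤u = suc f , u , trans (cong (_* p) q≡) (trans (*-comm (p ^ f * u) p) (sym (*-assoc p (p ^ f) u))) , p∤u

-- Prime powers in binomial coefficients and products over primes

-- Equal to (n + 1) ⋯ (n + d + 1) / d !. It divides every common multiple of n + 1, ..., n + d + 1
-- and has the binomial coefficient as a factor, so prime powers in the latter are bounded without
-- Legendre's formula.
leibniz : ℕ → ℕ → ℕ
leibniz n d = suc d * ((n + suc d) C suc d)

leibniz-! : ∀ n d → leibniz n d * d ! ≡ rising n (suc d)
leibniz-! n d = trans (lem d ((n + suc d) C suc d) (d !)) (C-rising n (suc d))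
  where
  lem : ∀ d c f → suc d * c * f ≡ c * (suc d * f)
  lem = solve-∀

leibniz-sucʳ : ∀ n d → leibniz n (suc d) * suc d ≡ (n + suc (suc d)) * leibniz n d
leibniz-sucʳ n d = *-cancelʳ-≡ _ _ (d !) {{d !≢0}} (begin
  leibniz n (suc d) * suc d * d !                ≡⟨ *-assoc (leibniz n (suc d)) (suc d) (d !) ⟩
  leibniz n (suc d) * (suc d) !                  ≡⟨ leibniz-! n (suc d) ⟩
  (n + suc (suc d)) * rising n (suc d)           ≡⟨ cong ((n + suc (suc d)) *_) (leibniz-! n d) ⟨
  (n + suc (suc d)) * (leibniz n d * d !)        ≡⟨ *-assoc (n + suc (suc d)) (leibniz n d) (d !) ⟨
  (n + suc (suc d)) * leibniz n d * d !          ∎)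
  where open ≡-Reasoning

rising-sucˡ : ∀ n d → rising n (suc d) ≡ suc n * rising (suc n) d
rising-sucˡ n d = *-cancelˡ-≡ _ _ (n !) {{n !≢0}} (begin
  n ! * rising n (suc d)          ≡⟨ !-rising n (suc d) ⟨
  (n + suc d) !                   ≡⟨ cong _! (+-suc n d) ⟩
  (suc n + d) !                   ≡⟨ !-rising (suc n) d ⟩
  suc n * n ! * rising (suc n) d  ≡⟨ cong (_* rising (suc n) d) (*-comm (suc n) (n !)) ⟩
  n ! * suc n * rising (suc n) d  ≡⟨ *-assoc (n !) (suc n) (rising (suc n) d) ⟩
  n ! * (suc n * rising (suc n) d) ∎)
  where open ≡-Reasoning

leibniz-sucˡ : ∀ n d → leibniz n (suc d) * suc d ≡ suc n * leibniz (suc n) d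
leibniz-sucˡ n d = *-cancelʳ-≡ _ _ (d !) {{d !≢0}} (begin
  leibniz n (suc d) * suc d * d !        ≡⟨ *-assoc (leibniz n (suc d)) (suc d) (d !) ⟩
  leibniz n (suc d) * (suc d) !          ≡⟨ leibniz-! n (suc d) ⟩
  rising n (suc (suc d))                 ≡⟨ rising-sucˡ n (suc d) ⟩
  suc n * rising (suc n) (suc d)         ≡⟨ cong (suc n *_) (leibniz-! (suc n) d) ⟨
  suc n * (leibniz (suc n) d * d !)      ≡⟨ *-assoc (suc n) (leibniz (suc n) d) (d !) ⟨
  suc n * leibniz (suc n) d * d !        ∎)
  where open ≡-Reasoning

-- The entries of Leibniz's harmonic triangle satisfy
-- 1 / leibniz n (d + 1) = 1 / leibniz n d - 1 / leibniz (n + 1) d.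
leibniz-∣ : ∀ d n {L} → (∀ i → i ≤ d → n + suc i ∣ L) → leibniz n d ∣ L
leibniz-∣ zero n {L} h = subst (_∣ L) eq (h 0 z≤n)
  where
  eq : n + 1 ≡ leibniz n 0
  eq = trans (sym (trans (leibniz-! n 0) (*-identityʳ (n + 1)))) (*-identityʳ (leibniz n 0))
leibniz-∣ (suc d) n {L} h
  with leibniz-∣ d n (λ i i≤d → h i (m≤n⇒m≤1+n i≤d))
     | leibniz-∣ d (suc n) (λ i i≤d → subst (_∣ L) (+-suc n (suc i)) (h (suc i) (s≤s i≤d)))
-- Multiplied by `L`, the recurrence reads L / W = α - β. To avoid subtraction, `W` is shown to
-- divide β W + L = α W and its first summand.
... | divides α L≡α | divides β L≡β = ∣m+n∣m⇒∣n (divides α eq) (n∣m*n β)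
  where
  W = leibniz n (suc d)
  open ≡-Reasoning
  hα : (n + suc (suc d)) * L ≡ α * W * suc d
  hα = begin
    (n + suc (suc d)) * L                    ≡⟨ cong ((n + suc (suc d)) *_) L≡α ⟩
    (n + suc (suc d)) * (α * leibniz n d)    ≡⟨ x∙yz≈y∙xz (n + suc (suc d)) α (leibniz n d) ⟩
    α * ((n + suc (suc d)) * leibniz n d)    ≡⟨ cong (α *_) (leibniz-sucʳ n d) ⟨
    α * (W * suc d)                          ≡⟨ *-assoc α W (suc d) ⟨
    α * W * suc d                            ∎
  hβ : suc n * L ≡ β * W * suc d
  hβ = begin
    suc n * L                          ≡⟨ cong (suc n *_) L≡β ⟩
    suc n * (β * leibniz (suc n) d)    ≡⟨ x∙yz≈y∙xz (suc n) β (leibniz (suc n) d) ⟩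
    β * (suc n * leibniz (suc n) d)    ≡⟨ cong (β *_) (leibniz-sucˡ n d) ⟨
    β * (W * suc d)                    ≡⟨ *-assoc β W (suc d) ⟨
    β * W * suc d                      ∎
  lem : ∀ b n d L → (b + L) * suc d + suc n * L ≡ b * suc d + (n + suc (suc d)) * L
  lem = solve-∀
  eq : β * W + L ≡ α * W
  eq = *-cancelʳ-≡ _ _ (suc d) (+-cancelʳ-≡ (suc n * L) _ _ (begin
    (β * W + L) * suc d + suc n * L              ≡⟨ lem (β * W) n d L ⟩
    β * W * suc d + (n + suc (suc d)) * L        ≡⟨ cong₂ _+_ (sym hβ) hα ⟩
    suc n * L + α * W * suc d                    ≡⟨ +-comm (suc n * L) (α * W * suc d) ⟩
    α * W * suc d + suc n * L                    ∎))

prime>1 : ∀ {p} → Prime p → 1 < p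
prime>1 {p} pr = nonTrivial⇒n>1 p {{prime⇒nonTrivial pr}}

prime∣prime^ : ∀ {p q} e → Prime p → Prime q → p ∣ q ^ e → p ≡ q
prime∣prime^ zero pr _ p∣1 with ∣1⇒≡1 p∣1
... | refl = ⊥-elim (¬prime[1] pr)
prime∣prime^ {p} {q} (suc e) pr qr p∣ with euclidsLemma q (q ^ e) pr p∣
... | inj₂ p∣q^e = prime∣prime^ e pr qr p∣q^e
... | inj₁ p∣q with prime⇒irreducible qr p∣q
...   | inj₂ p≡q = p≡q
...   | inj₁ refl = ⊥-elim (¬prime[1] pr)

^-∣ : ∀ p {e f} → e ≤ f → p ^ e ∣ p ^ f
^-∣ p {e} {f} e≤f = subst (p ^ e ∣_) (trans (sym (^-distribˡ-+-* p e (f ∸ e))) (cong (p ^_) (m+[n∸m]≡n e≤f)))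
                      (m∣m*n (p ^ (f ∸ e)))

^-cancel-< : ∀ {p} → Prime p → ∀ {e f} → p ^ e < p ^ f → e < f
^-cancel-< {p} pr {e} {f} lt = ≰⇒> (λ f≤e → <⇒≱ lt (^-monoʳ-≤ p {{prime⇒nonZero pr}} f≤e))

-- If p ^ (e + 1) exceeds N = n + d + 1, then p ^ e times the product of the prime-to-p parts of 1,
-- ..., N is a common multiple of 1, ..., N. The binomial coefficient divides it by `leibniz-∣`, but
-- p ^ (e + 1) does not.
primePower∣C : ∀ {p} → Prime p → ∀ e n d → p ^ e ∣ (n + suc d) C suc d → p ^ e ≤ n + suc d
primePower∣C {p} pr zero n d _ = m≤n⇒m≤o+n n (s≤s z≤n)
primePower∣C {p} pr (suc e) n d p^∣C with p ^ suc e ≤? n + suc d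
... | yes le = le
... | no ≰ = ⊥-elim contra
  where
  N = n + suc d
  dec : ∀ i → ∃[ f ] ∃[ u ] suc i ≡ p ^ f * u × ¬ p ∣ u
  dec i = strip pr (suc i) z<s
  u : ℕ → ℕ
  u i = proj₁ (proj₂ (dec i))
  L = p ^ e * ∏ N u
  i∣L : ∀ i → i < N → suc i ∣ L
  i∣L i i<N with dec i in eq
  ... | f , v , 1+i≡ , p∤v =
    subst (_∣ L) (sym 1+i≡) (*-pres-∣ (^-∣ p f≤e) (subst (_∣ ∏ N u) (cong (λ z → proj₁ (proj₂ z)) eq) (∣-∏ u i<N)))
    where
    0<v : 0 < v
    0<v = n≢0⇒n>0 (λ { refl → p∤v (p ∣0) })
    f≤e : f ≤ e
    f≤e = s≤s⁻¹ (^-cancel-< pr (≤-<-trans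
      (≤-trans (m≤m*n (p ^ f) v {{>-nonZero 0<v}}) (≤-reflexive (sym 1+i≡)))
      (≤-<-trans i<N (≰⇒> ≰))))
  C∣L : (n + suc d) C suc d ∣ L
  C∣L = ∣-trans (n∣m*n (suc d)) (leibniz-∣ d n (λ i i≤d → subst (_∣ L) (sym (+-suc n i))
          (i∣L (n + i) (≤-trans (≤-reflexive (sym (+-suc n i))) (+-monoʳ-≤ n (s≤s i≤d))))))
  p∣∏ : p ∣ ∏ N u
  p∣∏ = *-cancelˡ-∣ (p ^ e) {{m^n≢0 p e {{prime⇒nonZero pr}}}}
          (subst (_∣ L) (*-comm p (p ^ e)) (∣-trans p^∣C C∣L))
  contra : ⊥
  contra with prime∣∏ pr N p∣∏
  ... | i , _ , p∣ui = proj₂ (proj₂ (proj₂ (dec i))) p∣ui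

onPrime : (ℕ → ℕ) → ℕ → ℕ
onPrime g j with prime? j
... | yes _ = g j
... | no  _ = 1

∏ₚ : ℕ → (ℕ → ℕ) → ℕ
∏ₚ s g = ∏ s (λ i → onPrime g (suc i))

primeDivisor : ∀ n → 1 < n → ∃[ p ] Prime p × p ∣ n
primeDivisor n 1<n with factorise n {{>-nonZero (<⇒≤ 1<n)}}
... | record { factors = [] ; isFactorisation = n≡1 } = ⊥-elim (<-irrefl (sym n≡1) 1<n)
... | record { factors = p ∷ ps ; isFactorisation = n≡ ; factorsPrime = pr ∷ _ } =
  p , pr , subst (p ∣_) (sym n≡) (m∣m*n (product ps))

∣-pos : ∀ {m n} → m ∣ n → 0 < n → 0 < m
∣-pos {zero}  0∣n 0<n = ⊥-elim (<-irrefl (sym (0∣⇒≡0 0∣n)) 0<n)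
∣-pos {suc _} _   _   = z<s

-- Recursion on `s` splits off the full power of `s` whenever `s` is prime. Exponent 0 is included
-- in the last hypothesis, so that g p ≥ 1 also at primes not dividing `N`.
≤-∏ₚ : ∀ s {N g} → 0 < N →
       (∀ {p} → Prime p → p ∣ N → p ≤ s) →
       (∀ {p} → Prime p → ∀ e → p ^ e ∣ N → p ^ e ≤ g p) →
       N ≤ ∏ₚ s g
≤-∏ₚ zero {N} 0<N smooth _ = ≮⇒≥ λ 1<N → case primeDivisor N 1<N of λ
  { (p , pr , p∣N) → <⇒≱ (<⇒≤ (prime>1 pr)) (smooth pr p∣N) }
≤-∏ₚ (suc s) {N} {g} 0<N smooth powers with prime? (suc s)
... | no ¬pr = ≤-trans (≤-∏ₚ s 0<N smooth′ powers) (≤-reflexive (sym (*-identityˡ _)))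
  where
  smooth′ : ∀ {p} → Prime p → p ∣ N → p ≤ s
  smooth′ pr p∣N = s≤s⁻¹ (≤∧≢⇒< (smooth pr p∣N) λ { refl → ¬pr pr })
... | yes sp with strip sp N 0<N
...   | f , u , refl , ∤u = *-mono-≤ (powers sp f (m∣m*n u)) (≤-∏ₚ s 0<u smooth′ powers′)
  where
  u∣N : u ∣ suc s ^ f * u
  u∣N = n∣m*n (suc s ^ f)
  0<u : 0 < u
  0<u = ∣-pos u∣N 0<N
  smooth′ : ∀ {p} → Prime p → p ∣ u → p ≤ s
  smooth′ pr p∣u = s≤s⁻¹ (≤∧≢⇒< (smooth pr (∣-trans p∣u u∣N)) λ { refl → ∤u p∣u })
  powers′ : ∀ {p} → Prime p → ∀ e → p ^ e ∣ u → p ^ e ≤ g p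
  powers′ pr e p^e∣u = powers pr e (∣-trans p^e∣u u∣N)

∏ₚ-mono : ∀ s {f g : ℕ → ℕ} → (∀ p → f p ≤ g p) → ∏ₚ s f ≤ ∏ₚ s g
∏ₚ-mono s {f} {g} f≤g = ∏-mono s (λ i _ → le (suc i))
  where
  le : ∀ j → onPrime f j ≤ onPrime g j
  le j with prime? j
  ... | yes _ = f≤g j
  ... | no  _ = ≤-refl

∏ₚ-* : ∀ s (f g : ℕ → ℕ) → ∏ₚ s (λ p → f p * g p) ≡ ∏ₚ s f * ∏ₚ s g
∏ₚ-* s f g = trans (∏-cong s (λ i → eq (suc i))) (∏-* s _ _)
  where
  eq : ∀ j → onPrime (λ p → f p * g p) j ≡ onPrime f j * onPrime g j
  eq j with prime? j
  ... | yes _ = refl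
  ... | no  _ = refl

-- Truncation to 1 outside a range lets a bound that depends on the size of p be written as a
-- product of weights, whose products over primes are then estimated one by one.
upTo : ℕ → (ℕ → ℕ) → ℕ → ℕ
upTo t f p with p ≤? t
... | yes _ = f p
... | no  _ = 1

above : ℕ → (ℕ → ℕ) → ℕ → ℕ
above t f p with p ≤? t
... | yes _ = 1
... | no  _ = f p

onPrime≤ : ∀ {f : ℕ → ℕ} {j c} → 1 ≤ c → f j ≤ c → onPrime f j ≤ c
onPrime≤ {j = j} 1≤c fj≤c with prime? j
... | yes _ = fj≤c
... | no  _ = 1≤c

onPrime-pos : ∀ {f : ℕ → ℕ} j → 1 ≤ f j → 1 ≤ onPrime f j
onPrime-pos j 1≤f with prime? j
... | yes _ = 1≤f
... | no  _ = ≤-refl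

∏ₚ-upTo : ∀ s t {f : ℕ → ℕ} → (∀ p → 1 ≤ f p) → ∏ₚ s (upTo t f) ≤ ∏ₚ t f
∏ₚ-upTo s t {f} 1≤f with ≤-total s t
... | inj₁ s≤t = begin
  ∏ₚ s (upTo t f)                                             ≤⟨ ∏ₚ-mono s le ⟩
  ∏ₚ s f                                                      ≤⟨ m≤m*n _ _ {{>-nonZero (∏-pos (t ∸ s) (λ i _ → onPrime-pos (suc (s + i)) (1≤f (suc (s + i)))))}} ⟩
  ∏ₚ s f * ∏ (t ∸ s) (λ i → onPrime f (suc (s + i)))          ≡⟨ ∏-+ s (t ∸ s) (λ i → onPrime f (suc i)) ⟨
  ∏ₚ (s + (t ∸ s)) f                                          ≡⟨ cong (λ z → ∏ₚ z f) (m+[n∸m]≡n s≤t) ⟩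
  ∏ₚ t f                                                      ∎
  where
  open ≤-Reasoning
  le : ∀ p → upTo t f p ≤ f p
  le p with p ≤? t
  ... | yes _ = ≤-refl
  ... | no  _ = 1≤f p
... | inj₂ t≤s = begin
  ∏ₚ s (upTo t f)                                                 ≡⟨ cong (λ z → ∏ₚ z (upTo t f)) (m+[n∸m]≡n t≤s) ⟨
  ∏ₚ (t + (s ∸ t)) (upTo t f)                                     ≡⟨ ∏-+ t (s ∸ t) _ ⟩
  ∏ₚ t (upTo t f) * ∏ (s ∸ t) (λ i → onPrime (upTo t f) (suc (t + i)))
    ≤⟨ *-mono-≤ (∏ₚ-mono t le) (≤-trans (∏-mono (s ∸ t) (λ i _ → ≤1 i)) (≤-reflexive (trans (∏-const (s ∸ t) 1) (^-zeroˡ (s ∸ t))))) ⟩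
  ∏ₚ t f * 1                                                      ≡⟨ *-identityʳ _ ⟩
  ∏ₚ t f                                                          ∎
  where
  open ≤-Reasoning
  le : ∀ p → upTo t f p ≤ f p
  le p with p ≤? t
  ... | yes _ = ≤-refl
  ... | no  _ = 1≤f p
  ≤1 : ∀ i → onPrime (upTo t f) (suc (t + i)) ≤ 1
  ≤1 i = onPrime≤ {upTo t f} {suc (t + i)} ≤-refl up
    where
    up : upTo t f (suc (t + i)) ≤ 1
    up with suc (t + i) ≤? t
    ... | yes le = ⊥-elim (<⇒≱ (s≤s (m≤m+n t i)) le)
    ... | no  _  = ≤-refl

∏ₚ-above : ∀ t l c → 1 ≤ c → ∏ₚ (t + l) (above t (λ _ → c)) ≤ c ^ l
∏ₚ-above t l c 1≤c = begin
  ∏ₚ (t + l) g                                      ≡⟨ ∏-+ t l _ ⟩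
  ∏ₚ t g * ∏ l (λ i → onPrime g (suc (t + i)))      ≤⟨ *-mono-≤ low (≤-trans (∏-mono l (λ i _ → onPrime≤ {g} {suc (t + i)} 1≤c (g≤c (suc (t + i))))) (≤-reflexive (∏-const l c))) ⟩
  1 * c ^ l                                         ≡⟨ *-identityˡ _ ⟩
  c ^ l                                             ∎
  where
  open ≤-Reasoning
  g = above t (λ _ → c)
  g≤c : ∀ p → g p ≤ c
  g≤c p with p ≤? t
  ... | yes _ = 1≤c
  ... | no  _ = ≤-refl
  g≤1 : ∀ i → i < t → g (suc i) ≤ 1
  g≤1 i i<t with suc i ≤? t
  ... | yes _ = ≤-refl
  ... | no ≰t = ⊥-elim (≰t i<t)
  low : ∏ₚ t g ≤ 1
  low = ≤-trans (∏-mono t (λ i i<t → onPrime≤ {g} {suc i} ≤-refl (g≤1 i i<t))) (≤-reflexive (trans (∏-const t 1) (^-zeroˡ t)))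

-- Counting primes with a sieve modulo 30

π : ℕ → ℕ
π zero = 0
π (suc n) with prime? (suc n)
... | yes _ = suc (π n)
... | no  _ = π n

∏ₚ-const : ∀ s c → ∏ₚ s (λ _ → c) ≡ c ^ π s
∏ₚ-const zero c = refl
∏ₚ-const (suc s) c with prime? (suc s)
... | yes _ = cong (c *_) (∏ₚ-const s c)
... | no  _ = trans (*-identityˡ _) (∏ₚ-const s c)

π-mono : ∀ m d → π m ≤ π (m + d)
π-mono m zero rewrite +-identityʳ m = ≤-refl
π-mono m (suc d) rewrite +-suc m d with prime? (suc (m + d))
... | yes _ = m≤n⇒m≤1+n (π-mono m d)
... | no  _ = π-mono m d

coprimes : ℕ → ℕ → ℕ
coprimes w zero = 0
coprimes w (suc i) with gcd (suc i) w ≟ 1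
... | yes _ = suc (coprimes w i)
... | no  _ = coprimes w i

-- As w divides n, gcd (i , w) divides n + i. A prime n + i > w can share no factor with w, so only
-- the residues coprime to w are counted.
π-sieve : ∀ w n → .{{NonZero w}} → w ∣ n → w ≤ n → ∀ i → π (n + i) ≤ π n + coprimes w i
π-sieve w n w∣n w≤n zero = ≤-reflexive (trans (cong π (+-identityʳ n)) (sym (+-identityʳ _)))
π-sieve w n w∣n w≤n (suc i) rewrite +-suc n i
  with prime? (suc (n + i)) | gcd (suc i) w ≟ 1
... | yes _  | yes _ = ≤-trans (s≤s (π-sieve w n w∣n w≤n i)) (≤-reflexive (sym (+-suc (π n) (coprimes w i))))
... | no  _  | yes _ = ≤-trans (π-sieve w n w∣n w≤n i) (+-monoʳ-≤ (π n) (n≤1+n _))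
... | no  _  | no  _ = π-sieve w n w∣n w≤n i
... | yes pr | no g≢1 = ⊥-elim (contra (prime⇒irreducible pr g∣))
  where
  g∣ : gcd (suc i) w ∣ suc (n + i)
  g∣ = subst (gcd (suc i) w ∣_) (+-suc n i)
         (∣m∣n⇒∣m+n (∣-trans (gcd[m,n]∣n (suc i) w) w∣n) (gcd[m,n]∣m (suc i) w))
  contra : ¬ (gcd (suc i) w ≡ 1 ⊎ gcd (suc i) w ≡ suc (n + i))
  contra (inj₁ g≡1) = g≢1 g≡1
  contra (inj₂ g≡)  = <⇒≱ (s≤s (≤-trans w≤n (m≤m+n n i)))
                          (subst (_≤ w) g≡ (∣⇒≤ (gcd[m,n]∣n (suc i) w)))

-- There are 10 primes up to 30, and 8 residues modulo 30 are coprime to 30.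
π-mult30 : ∀ q → π (30 * suc q) ≤ 10 + 8 * q
π-mult30 zero = ≤-refl
π-mult30 (suc q) = begin
  π (30 * suc (suc q))      ≡⟨ cong π (trans (*-suc 30 (suc q)) (+-comm 30 (30 * suc q))) ⟩
  π (30 * suc q + 30)       ≤⟨ π-sieve 30 (30 * suc q) (m∣m*n (suc q)) (m≤m*n 30 (suc q)) 30 ⟩
  π (30 * suc q) + 8        ≤⟨ +-monoˡ-≤ 8 (π-mult30 q) ⟩
  10 + 8 * q + 8            ≡⟨ lem q ⟩
  10 + 8 * suc q            ∎
  where
  open ≤-Reasoning
  lem : ∀ q → 10 + 8 * q + 8 ≡ 10 + 8 * suc q
  lem = solve-∀

-- The density 8 / 30 = 4 / 15 has to be below 1 / 3 for the range K ^ 3 ≤ n ^ 2 of the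
-- Sylvester-Schur argument; the modulus 6 would give exactly 1 / 3.
π-bound : ∀ n → 15 * π n ≤ 4 * n + 150
π-bound n = begin
  15 * π n                        ≤⟨ *-monoʳ-≤ 15 (≤-trans (π-mono n (30 * suc q ∸ n)) (≤-trans (≤-reflexive (cong π (m+[n∸m]≡n n≤))) (π-mult30 q))) ⟩
  15 * (10 + 8 * q)               ≡⟨ lem q ⟩
  4 * (q * 30) + 150              ≤⟨ +-monoˡ-≤ 150 (*-monoʳ-≤ 4 (m/n*n≤m n 30)) ⟩
  4 * n + 150                     ∎
  where
  open ≤-Reasoning
  q = n / 30
  lem : ∀ q → 15 * (10 + 8 * q) ≡ 4 * (q * 30) + 150
  lem = solve-∀
  n≤ : n ≤ 30 * suc q
  n≤ = begin
    n                    ≡⟨ m≡m%n+[m/n]*n n 30 ⟩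
    n % 30 + q * 30      ≤⟨ +-monoˡ-≤ (q * 30) (<⇒≤ (m%n<n n 30)) ⟩
    30 + q * 30          ≡⟨ *-comm (suc q) 30 ⟩
    30 * suc q           ∎

-- Bounds for binomial coefficients

-- The newly added prime is larger than every factor already collected, so it must divide the
-- cofactor.
∏-primes-∣ : ∀ t l {N} → 0 < N → (∀ {p} → Prime p → t < p → p ≤ t + l → p ∣ N) →
             ∏ l (λ i → onPrime (λ p → p) (suc (t + i))) ∣ N
∏-primes-∣ t zero 0<N h = 1∣ _
∏-primes-∣ t (suc l) {N} 0<N h
  with ∏-primes-∣ t l 0<N (λ pr t<p p≤ → h pr t<p (≤-trans p≤ (+-monoʳ-≤ t (n≤1+n l))))
     | prime? (suc (t + l))
... | Q∣N | no _ = subst (_∣ N) (sym (*-identityˡ _)) Q∣N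
... | divides c refl | yes pr with euclidsLemma c _ pr (h pr (s≤s (m≤m+n t l)) (≤-reflexive (sym (+-suc t l))))
...   | inj₁ p∣c = *-monoˡ-∣ _ p∣c
...   | inj₂ p∣Q with prime∣∏ pr l p∣Q
...     | i , i<l , p∣i = ⊥-elim (<⇒≱ (s≤s (+-monoʳ-< t i<l)) (≤-trans (∣⇒≤ {{>-nonZero (onPrime-pos (suc (t + i)) (s≤s z≤n))}} p∣i)
                            (onPrime≤ {λ p → p} {suc (t + i)} (s≤s z≤n) ≤-refl)))

-- The quotient (2 q + 1)! / (q ! (q + 1)!) grows by the factor (2 q + 3)(2 q + 2) / ((q + 1)(q +
-- 2)) = 4 - 2 / (q + 2); the summand added below is this defect.
!≤4^ : ∀ q → (suc q + q) ! ≤ 4 ^ q * (q ! * suc q !)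
!≤4^ zero = ≤-refl
!≤4^ (suc q) = begin
  (suc (suc q) + suc q) !                                         ≡⟨ cong _! (cong suc (+-suc (suc q) q)) ⟩
  suc (suc (suc q + q)) * (suc (suc q + q) * (suc q + q) !)       ≤⟨ *-monoʳ-≤ (suc (suc (suc q + q))) (*-monoʳ-≤ (suc (suc q + q)) (!≤4^ q)) ⟩
  suc (suc (suc q + q)) * (suc (suc q + q) * (4 ^ q * (q ! * suc q !)))  ≤⟨ m≤m+n _ (2 * suc q * (4 ^ q * (q ! * suc q !))) ⟩
  suc (suc (suc q + q)) * (suc (suc q + q) * (4 ^ q * (q ! * suc q !))) + 2 * suc q * (4 ^ q * (q ! * suc q !))
    ≡⟨ lem q (4 ^ q) (q !) (suc q !) ⟩
  4 * 4 ^ q * (suc q * q ! * (suc (suc q) * suc q !))             ∎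
  where
  open ≤-Reasoning
  lem : ∀ q a b c → suc (suc (suc q + q)) * (suc (suc q + q) * (a * (b * c))) + 2 * suc q * (a * (b * c))
        ≡ 4 * a * (suc q * b * (suc (suc q) * c))
  lem = solve-∀

C≤4^ : ∀ q → (suc q + q) C q ≤ 4 ^ q
C≤4^ q = *-cancelʳ-≤ _ _ (q ! * suc q !) {{q !* suc q !≢0}} (≤-trans (≤-reflexive (C-! (suc q) q)) (!≤4^ q))

prime∤! : ∀ {p} → Prime p → ∀ {n} → n < p → ¬ p ∣ n !
prime∤! pr {zero} _ p∣1 with ∣1⇒≡1 p∣1
... | refl = ¬prime[1] pr
prime∤! {p} pr {suc n} 1+n<p p∣ with euclidsLemma (suc n) (n !) pr p∣
... | inj₁ p∣1+n = >⇒∤ 1+n<p p∣1+n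
... | inj₂ p∣n! = prime∤! pr (<-trans (n<1+n n) 1+n<p) p∣n!

prime∤* : ∀ {p} → Prime p → ∀ {m n} → ¬ p ∣ m → ¬ p ∣ n → ¬ p ∣ m * n
prime∤* pr {m} {n} p∤m p∤n p∣mn with euclidsLemma m n pr p∣mn
... | inj₁ p∣m = p∤m p∣m
... | inj₂ p∣n = p∤n p∣n

-- Erdős' induction. An even n > 2 adds no prime. For n = 2 q + 1 the primes above q + 1 all divide
-- C (2 q + 1 , q) ≤ 4 ^ q, and the others are covered by the hypothesis at q + 1.
primorial≤4^ : ∀ n → ∏ₚ n (λ p → p) ≤ 4 ^ n
primorial≤4^ = <-rec _ step
  where
  step : ∀ n → (∀ {m} → m < n → ∏ₚ m (λ p → p) ≤ 4 ^ m) → ∏ₚ n (λ p → p) ≤ 4 ^ n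
  step n rec with even-or-odd n
  ... | inj₁ (zero , refl) = ≤-refl
  ... | inj₁ (suc zero , refl) = s≤s (s≤s z≤n)
  ... | inj₁ (suc (suc q) , refl) with prime? (2 * suc (suc q))
  ...   | no _ = ≤-trans (≤-reflexive (*-identityˡ _)) (≤-trans (rec ≤-refl) (^-monoʳ-≤ 4 (n≤1+n (suc q + suc (suc (q + 0))))))
  ...   | yes pr with prime⇒irreducible pr (m∣m*n {2} (suc (suc q)))
  ...     | inj₂ eq = ⊥-elim (<-irrefl eq (m<m*n 2 (suc (suc q)) (s≤s (s≤s z≤n))))
  step n rec | inj₂ (zero , refl) = s≤s z≤n
  step n rec | inj₂ (q@(suc _) , refl) = subst (λ n → ∏ₚ n (λ p → p) ≤ 4 ^ n) (cong (suc q +_) (sym (+-identityʳ q))) (begin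
    ∏ₚ (suc q + q) id                                                ≡⟨ ∏-+ (suc q) q (λ i → onPrime id (suc i)) ⟩
    ∏ₚ (suc q) id * ∏ q (λ i → onPrime id (suc (suc q + i)))         ≤⟨ *-mono-≤ (rec (s≤s (m<m+n q z<s))) upper ⟩
    4 ^ suc q * 4 ^ q                                                ≡⟨ ^-distribˡ-+-* 4 (suc q) q ⟨
    4 ^ (suc q + q)                                                  ∎)
    where
    open ≤-Reasoning
    id : ℕ → ℕ
    id p = p
    c = (suc q + q) C q
    p∣c : ∀ {p} → Prime p → suc q < p → p ≤ suc q + q → p ∣ c
    p∣c {suc p-1} pr q<p p≤ with euclidsLemma c (q ! * suc q !) pr (subst (suc p-1 ∣_) (sym (C-! (suc q) q))
                          (∣-trans (m∣m*n (p-1 !)) (m≤n⇒m!∣n! p≤)))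
    ... | inj₁ p∣c = p∣c
    ... | inj₂ p∣ = ⊥-elim (prime∤* pr (prime∤! pr (<-trans (n<1+n q) q<p)) (prime∤! pr q<p) p∣)
    upper : ∏ q (λ i → onPrime id (suc (suc q + i))) ≤ 4 ^ q
    upper = ≤-trans (∣⇒≤ {{>-nonZero (C-pos (suc q) q)}} (∏-primes-∣ (suc q) q (C-pos (suc q) q) p∣c)) (C≤4^ q)

residue-unique : ∀ {p x a b} → a < p → b < p → p ∣ x + a → p ∣ x + b → a ≡ b
residue-unique {p} {x} {a} {b} a<p b<p p∣a p∣b =
  case <-cmp a b of λ where
    (tri< a<b _ _) → ⊥-elim (distinct a<b b<p p∣a p∣b)
    (tri≈ _ a≡b _) → a≡b
    (tri> _ _ b<a) → ⊥-elim (distinct b<a a<p p∣b p∣a)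
  where
  distinct : ∀ {a b} → a < b → b < p → p ∣ x + a → ¬ p ∣ x + b
  distinct {a} {b} a<b b<p p∣a p∣b = >⇒∤ {{>-nonZero (m<n⇒0<n∸m a<b)}} (≤-<-trans (m∸n≤m b a) b<p)
    (∣m+n∣m⇒∣n (subst (p ∣_) (sym (trans (+-assoc x a (b ∸ a)) (cong (x +_) (m+[n∸m]≡n (<⇒≤ a<b))))) p∣b) p∣a)

prime∤rising : ∀ {p} → Prime p → ∀ x {d} → d < p → p ∣ x → ¬ p ∣ rising x d
prime∤rising {p} pr x d<p p∣x p∣ with prime∣∏ pr _ p∣
... | i , i<d , p∣x+1+i = >⇒∤ (≤-<-trans i<d d<p) (∣m+n∣m⇒∣n p∣x+1+i p∣x)

-- The factorial of the top entry 2 p + i + j < 3 p contains p just twice, as do the two factorials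
-- below together. Formally the coefficient is compared with C (2 p , p): passing from one to the
-- other involves only 2 p + 1, ..., 2 p + i + j on the side of C (2 p , p), and `eq₂` reduces C (2
-- p , p) to 2 and factors p + 1, ..., 2 p - 1.
prime∤C : ∀ {p} → Prime p → 2 < p → ∀ i j → i + j < p → ¬ p ∣ ((p + j) + (p + i)) C (p + i)
prime∤C {p@(suc p-1)} pr 2<p i j i+j<p p∣c =
  prime∤* pr p∤C[2p,p] (prime∤rising pr (p + p) i+j<p (∣m∣n⇒∣m+n ∣-refl ∣-refl))
    (subst (p ∣_) eq (∣m⇒∣m*n (rising p i * rising p j) p∣c))
  where
  c = ((p + j) + (p + i)) C (p + i)
  c₂ = (p + p) C p
  open ≡-Reasoning
  lem₁ : ∀ c f u v → c * (u * v) * (f * f) ≡ c * ((f * u) * (f * v))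
  lem₁ = solve-∀
  lem₂ : ∀ c f u → c * (f * f) * u ≡ c * u * (f * f)
  lem₂ = solve-∀
  lem₃ : ∀ p i j → (p + j) + (p + i) ≡ (p + p) + (i + j)
  lem₃ = solve-∀
  eq : c * (rising p i * rising p j) ≡ c₂ * rising (p + p) (i + j)
  eq = *-cancelʳ-≡ _ _ (p ! * p !) {{p !* p !≢0}} (begin
    c * (rising p i * rising p j) * (p ! * p !)          ≡⟨ lem₁ c (p !) (rising p i) (rising p j) ⟩
    c * ((p ! * rising p i) * (p ! * rising p j))        ≡⟨ cong (c *_) (cong₂ _*_ (!-rising p i) (!-rising p j)) ⟨
    c * ((p + i) ! * (p + j) !)                          ≡⟨ C-! (p + j) (p + i) ⟩
    ((p + j) + (p + i)) !                                ≡⟨ cong _! (lem₃ p i j) ⟩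
    ((p + p) + (i + j)) !                                ≡⟨ !-rising (p + p) (i + j) ⟩
    (p + p) ! * rising (p + p) (i + j)                   ≡⟨ cong (_* rising (p + p) (i + j)) (C-! p p) ⟨
    c₂ * (p ! * p !) * rising (p + p) (i + j)            ≡⟨ lem₂ c₂ (p !) (rising (p + p) (i + j)) ⟩
    c₂ * rising (p + p) (i + j) * (p ! * p !)            ∎)
  lem₄ : ∀ c f p → p * (c * f) ≡ c * (p * f)
  lem₄ = solve-∀
  lem₅ : ∀ p r → (p + p) * r ≡ p * (2 * r)
  lem₅ = solve-∀
  eq₂ : c₂ * p-1 ! ≡ 2 * rising p p-1
  eq₂ = *-cancelˡ-≡ _ _ p (begin
    p * (c₂ * p-1 !)          ≡⟨ lem₄ c₂ (p-1 !) p ⟩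
    c₂ * p !                  ≡⟨ C-rising p p ⟩
    (p + p) * rising p p-1    ≡⟨ lem₅ p (rising p p-1) ⟩
    p * (2 * rising p p-1)    ∎)
  p∤C[2p,p] : ¬ p ∣ c₂
  p∤C[2p,p] p∣c₂ = prime∤* pr (>⇒∤ 2<p) (prime∤rising pr p ≤-refl ∣-refl) (subst (p ∣_) eq₂ (∣m⇒∣m*n (p-1 !) p∣c₂))

module _ (N d-1 s : ℕ) (smooth : ∀ {p} → Prime p → p ∣ (N + suc d-1) C suc d-1 → p ≤ s) where
  private
    d = suc d-1
    n = N + d
    c = n C d
    1≤n : 1 ≤ n
    1≤n = ≤-trans (s≤s z≤n) (m≤n+m d N)

  C≤n^π : c ≤ n ^ π s
  C≤n^π = ≤-trans (≤-∏ₚ s (C-pos N d) smooth (λ pr e → primePower∣C pr e N d-1)) (≤-reflexive (∏ₚ-const s n))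

  private
    ∏ₚ-upTo-n : ∀ r → ∏ₚ s (upTo r (λ _ → n)) ≤ n ^ π r
    ∏ₚ-upTo-n r = ≤-trans (∏ₚ-upTo s r (λ _ → 1≤n)) (≤-reflexive (∏ₚ-const r n))

    large-power : ∀ {p r} → Prime p → n < suc r * suc r → r < p → ∀ e → ¬ p ^ suc (suc e) ∣ c
    large-power {p} {r} pr n<r² r<p e p^∣c = <⇒≱ n<r² (begin
      suc r * suc r      ≤⟨ *-mono-≤ r<p r<p ⟩
      p * p              ≤⟨ *-monoʳ-≤ p (m≤m*n p (p ^ e) {{m^n≢0 p e {{prime⇒nonZero pr}}}}) ⟩
      p ^ suc (suc e)    ≤⟨ primePower∣C pr (suc (suc e)) N d-1 p^∣c ⟩
      n                  ∎)
      where open ≤-Reasoning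

    upTo-pos : ∀ t {f : ℕ → ℕ} → (∀ p → 1 ≤ f p) → ∀ p → 1 ≤ upTo t f p
    upTo-pos t 1≤f p with p ≤? t
    ... | yes _ = 1≤f p
    ... | no  _ = ≤-refl

    above-pos : ∀ t {f : ℕ → ℕ} → (∀ p → 1 ≤ f p) → ∀ p → 1 ≤ above t f p
    above-pos t 1≤f p with p ≤? t
    ... | yes _ = ≤-refl
    ... | no  _ = 1≤f p

  -- A prime above √n divides to the first power at most, so the large primes together contribute no
  -- more than the primorial of `s`; only those up to `r` are charged a full n.
  C≤-√ : ∀ r → n < suc r * suc r → c ≤ n ^ π r * 4 ^ s
  C≤-√ r n<r² = begin
    c                                             ≤⟨ ≤-∏ₚ s (C-pos N d) smooth powers ⟩
    ∏ₚ s (λ p → upTo r (λ _ → n) p * p)           ≡⟨ ∏ₚ-* s _ _ ⟩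
    ∏ₚ s (upTo r (λ _ → n)) * ∏ₚ s (λ p → p)      ≤⟨ *-mono-≤ (∏ₚ-upTo-n r) (primorial≤4^ s) ⟩
    n ^ π r * 4 ^ s                               ∎
    where
    open ≤-Reasoning
    powers : ∀ {p} → Prime p → ∀ e → p ^ e ∣ c → p ^ e ≤ upTo r (λ _ → n) p * p
    powers {p} pr e p^∣c with p ≤? r
    ... | yes _ = ≤-trans (primePower∣C pr e N d-1 p^∣c) (m≤m*n n p {{prime⇒nonZero pr}})
    powers {p} pr zero p^∣c | no _ = ≤-trans (<⇒≤ (prime>1 pr)) (≤-reflexive (sym (*-identityˡ p)))
    powers {p} pr (suc zero) p^∣c | no _ = ≤-reflexive (trans (*-identityʳ p) (sym (*-identityˡ p)))
    powers {p} pr (suc (suc e)) p^∣c | no r≱p = ⊥-elim (large-power pr n<r² (≰⇒> r≱p) e p^∣c)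

  -- By prime∤C the primes between n / 3 and d do not divide c.
  C≤-√-third : ∀ r t l → n < suc r * suc r → n < 3 * suc t → 2 ≤ t → d ≤ N → s ≡ d + l →
               c ≤ n ^ π r * 4 ^ t * s ^ l
  C≤-√-third r t l n<r² n<3t 2≤t d≤N s≡ = begin
    c                                                    ≤⟨ ≤-∏ₚ s (C-pos N d) smooth powers ⟩
    ∏ₚ s (λ p → (g₁ p * g₂ p) * g₃ p)                    ≡⟨ ∏ₚ-* s _ _ ⟩
    ∏ₚ s (λ p → g₁ p * g₂ p) * ∏ₚ s g₃                   ≡⟨ cong (_* ∏ₚ s g₃) (∏ₚ-* s _ _) ⟩
    ∏ₚ s g₁ * ∏ₚ s g₂ * ∏ₚ s g₃                          ≤⟨ *-mono-≤ (*-mono-≤ (∏ₚ-upTo-n r)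
                                                              (≤-trans (∏ₚ-upTo s t {λ p → p ⊔ 1} (λ p → m≤n⊔m p 1)) (≤-trans (∏ₚ-mono-⊔ t) (primorial≤4^ t))))
                                                              (≤-trans (≤-reflexive (cong (λ z → ∏ₚ z g₃) s≡)) (∏ₚ-above d l s 1≤s)) ⟩
    n ^ π r * 4 ^ t * s ^ l                              ∎
    where
    open ≤-Reasoning
    -- One weight for each kind of prime: up to √n, up to n / 3, and above `d`. Only `l` integers
    -- lie in the last range, so charging `s` for each is affordable. The maximum with 1 keeps `g₂`
    -- positive at 0.
    g₁ = upTo r (λ _ → n)
    g₂ = upTo t (λ p → p ⊔ 1)
    g₃ = above d (λ _ → s)
    1≤s : 1 ≤ s
    1≤s = ≤-trans (s≤s z≤n) (≤-reflexive (sym s≡))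
    ∏ₚ-mono-⊔ : ∀ t → ∏ₚ t (λ p → p ⊔ 1) ≤ ∏ₚ t (λ p → p)
    ∏ₚ-mono-⊔ t = ∏-mono t (λ i _ → le (suc i) z<s)
      where
      le : ∀ j → 0 < j → onPrime (λ p → p ⊔ 1) j ≤ onPrime (λ p → p) j
      le j 0<j with prime? j
      ... | yes _ = ⊔-lub ≤-refl 0<j
      ... | no  _ = ≤-refl
    1≤g₁ = upTo-pos r {λ _ → n} (λ _ → 1≤n)
    1≤g₂ = upTo-pos t {λ p → p ⊔ 1} (λ p → m≤n⊔m p 1)
    1≤g₃ = above-pos d {λ _ → s} (λ _ → 1≤s)
    ≤₁ : ∀ p → g₁ p ≤ g₁ p * g₂ p * g₃ p
    ≤₁ p = ≤-trans (m≤m*n (g₁ p) (g₂ p) {{>-nonZero (1≤g₂ p)}}) (m≤m*n _ (g₃ p) {{>-nonZero (1≤g₃ p)}})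
    ≤₂ : ∀ p → g₂ p ≤ g₁ p * g₂ p * g₃ p
    ≤₂ p = ≤-trans (m≤n*m (g₂ p) (g₁ p) {{>-nonZero (1≤g₁ p)}}) (m≤m*n _ (g₃ p) {{>-nonZero (1≤g₃ p)}})
    ≤₃ : ∀ p → g₃ p ≤ g₁ p * g₂ p * g₃ p
    ≤₃ p = m≤n*m (g₃ p) (g₁ p * g₂ p) {{>-nonZero (*-mono-≤ (1≤g₁ p) (1≤g₂ p))}}
    n≤g₁ : ∀ {p} → p ≤ r → n ≤ g₁ p
    n≤g₁ {p} p≤r with p ≤? r
    ... | yes _ = ≤-refl
    ... | no ≰  = ⊥-elim (≰ p≤r)
    p≤g₂ : ∀ {p} → p ≤ t → p ≤ g₂ p
    p≤g₂ {p} p≤t with p ≤? t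
    ... | yes _ = m≤m⊔n p 1
    ... | no ≰  = ⊥-elim (≰ p≤t)
    s≤g₃ : ∀ {p} → d < p → s ≤ g₃ p
    s≤g₃ {p} d<p with p ≤? d
    ... | yes ≤d = ⊥-elim (<⇒≱ d<p ≤d)
    ... | no _   = ≤-refl
    middle : ∀ {p} → Prime p → t < p → p ≤ d → ¬ p ∣ c
    middle {p} pr t<p p≤d p∣c =
      prime∤C pr (≤-<-trans 2≤t t<p) (d ∸ p) (N ∸ p)
        (+-cancelˡ-< (p + p) _ _ (begin-strict
          (p + p) + ((d ∸ p) + (N ∸ p))      ≡⟨ lem p (d ∸ p) (N ∸ p) ⟩
          (p + (N ∸ p)) + (p + (d ∸ p))      ≡⟨ cong₂ _+_ (m+[n∸m]≡n (≤-trans p≤d d≤N)) (m+[n∸m]≡n p≤d) ⟩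
          N + d                              <⟨ n<3t ⟩
          3 * suc t                          ≤⟨ *-monoʳ-≤ 3 t<p ⟩
          3 * p                              ≡⟨ lem₂ p ⟩
          (p + p) + p                        ∎))
        (subst (p ∣_) (cong₂ (λ x y → (x + y) C y) (sym (m+[n∸m]≡n (≤-trans p≤d d≤N))) (sym (m+[n∸m]≡n p≤d))) p∣c)
      where
      lem : ∀ p i j → (p + p) + (i + j) ≡ (p + j) + (p + i)
      lem = solve-∀
      lem₂ : ∀ p → 3 * p ≡ (p + p) + p
      lem₂ = solve-∀
    powers : ∀ {p} → Prime p → ∀ e → p ^ e ∣ c → p ^ e ≤ g₁ p * g₂ p * g₃ p
    powers {p} pr e p^∣c with ≤-<-connex p r
    ... | inj₁ p≤r = ≤-trans (primePower∣C pr e N d-1 p^∣c) (≤-trans (n≤g₁ p≤r) (≤₁ p))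
    powers {p} pr zero p^∣c | inj₂ _ = *-mono-≤ (*-mono-≤ (1≤g₁ p) (1≤g₂ p)) (1≤g₃ p)
    powers {p} pr (suc (suc e)) p^∣c | inj₂ r<p = ⊥-elim (large-power pr n<r² r<p e p^∣c)
    powers {p} pr (suc zero) p^∣c | inj₂ _ = ≤-trans (≤-reflexive (*-identityʳ p)) cases
      where
      p∣c : p ∣ c
      p∣c = subst (_∣ c) (*-identityʳ p) p^∣c
      cases : p ≤ g₁ p * g₂ p * g₃ p
      cases with ≤-<-connex p t | ≤-<-connex p d
      ... | inj₁ p≤t | _        = ≤-trans (p≤g₂ p≤t) (≤₂ p)
      ... | inj₂ t<p | inj₁ p≤d = ⊥-elim (middle pr t<p p≤d p∣c)
      ... | inj₂ t<p | inj₂ d<p = ≤-trans (smooth pr p∣c) (≤-trans (s≤g₃ d<p) (≤₃ p))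

-- The binomial coefficient is the product of (N + i) / i for i = 1, ..., d, and each factor is at
-- least (N + d) / d.
^≤C : ∀ N d → (N + d) ^ d ≤ ((N + d) C d) * d ^ d
^≤C N d = *-cancelʳ-≤ _ _ (d !) {{d !≢0}} (begin
  (N + d) ^ d * d !                                ≡⟨ cong₂ _*_ (∏-const d (N + d)) (∏-suc d) ⟨
  ∏ d (λ _ → N + d) * ∏ d suc                      ≤⟨ ∏-cross d {g = λ _ → d} (λ i i<d → termwise i i<d) ⟩
  rising N d * ∏ d (λ _ → d)                       ≡⟨ cong₂ _*_ (sym (C-rising N d)) (∏-const d d) ⟩
  ((N + d) C d) * d ! * d ^ d                      ≡⟨ lem ((N + d) C d) (d !) (d ^ d) ⟩
  ((N + d) C d) * d ^ d * d !                      ∎)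
  where
  open ≤-Reasoning
  lem : ∀ a b c → a * b * c ≡ a * c * b
  lem = solve-∀
  ∏-suc : ∀ d → ∏ d suc ≡ d !
  ∏-suc zero = refl
  ∏-suc (suc d) = cong (suc d *_) (∏-suc d)
  termwise : ∀ i → i < d → (N + d) * suc i ≤ (N + suc i) * d
  termwise i i<d = begin
    (N + d) * suc i          ≡⟨ *-distribʳ-+ (suc i) N d ⟩
    N * suc i + d * suc i    ≤⟨ +-mono-≤ (*-monoʳ-≤ N i<d) (≤-reflexive (*-comm d (suc i))) ⟩
    N * d + suc i * d        ≡⟨ *-distribʳ-+ d N (suc i) ⟨
    (N + suc i) * d          ∎

c^≤C : ∀ c N d → .{{NonZero d}} → c * d ≤ N + d → c ^ d ≤ (N + d) C d
c^≤C c N d cd≤n = *-cancelʳ-≤ _ _ (d ^ d) {{m^n≢0 d d}} (begin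
  c ^ d * d ^ d              ≡⟨ ^-distribʳ-* d c d ⟨
  (c * d) ^ d                ≤⟨ ^-monoˡ-≤ d cd≤n ⟩
  (N + d) ^ d                ≤⟨ ^≤C N d ⟩
  ((N + d) C d) * d ^ d      ∎)
  where
  open ≤-Reasoning

C-mono : ∀ {N N′} d → N ≤ N′ → (N + d) C d ≤ (N′ + d) C d
C-mono {N} {N′} d N≤N′ = *-cancelʳ-≤ _ _ (d !) {{d !≢0}} (begin
  ((N + d) C d) * d !      ≡⟨ C-rising N d ⟩
  rising N d               ≤⟨ ∏-mono d (λ i _ → +-monoˡ-≤ (suc i) N≤N′) ⟩
  rising N′ d              ≡⟨ C-rising N′ d ⟨
  ((N′ + d) C d) * d !     ∎)
  where open ≤-Reasoning

C-sucˡ : ∀ N d → suc N * ((suc N + d) C d) ≡ (N + suc d) * ((N + d) C d)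
C-sucˡ N d = *-cancelʳ-≡ _ _ (d !) {{d !≢0}} (begin
  suc N * ((suc N + d) C d) * d !       ≡⟨ *-assoc (suc N) ((suc N + d) C d) (d !) ⟩
  suc N * (((suc N + d) C d) * d !)     ≡⟨ cong (suc N *_) (C-rising (suc N) d) ⟩
  suc N * rising (suc N) d              ≡⟨ rising-sucˡ N d ⟨
  (N + suc d) * rising N d              ≡⟨ cong ((N + suc d) *_) (C-rising N d) ⟨
  (N + suc d) * (((N + d) C d) * d !)   ≡⟨ *-assoc (N + suc d) ((N + d) C d) (d !) ⟨
  (N + suc d) * ((N + d) C d) * d !     ∎)
  where open ≡-Reasoning

-- With k = d + 1, the quantity 2 k C (2 k , k) grows by the factor 2 (2 k + 1) / k = 4 + 2 / k.
central : ∀ d → 4 ^ suc d * (suc d ! * suc d !) ≤ 2 * suc d * (suc d + suc d) !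
central zero = ≤-refl
central (suc d) = begin
  4 ^ suc (suc d) * (suc (suc d) ! * suc (suc d) !)       ≡⟨ lem d (4 ^ suc d) (suc d !) ⟩
  4 * (suc (suc d) * suc (suc d)) * (4 ^ suc d * (suc d ! * suc d !))   ≤⟨ *-monoʳ-≤ (4 * (suc (suc d) * suc (suc d))) (central d) ⟩
  4 * (suc (suc d) * suc (suc d)) * (2 * suc d * (suc d + suc d) !)     ≤⟨ m≤m+n _ (4 * (suc (suc d) * suc (suc d)) * (suc d + suc d) !) ⟩
  4 * (suc (suc d) * suc (suc d)) * (2 * suc d * (suc d + suc d) !) + 4 * (suc (suc d) * suc (suc d)) * (suc d + suc d) !
    ≡⟨ lem₂ d ((suc d + suc d) !) ⟩
  2 * suc (suc d) * (suc (suc (suc d + suc d)) * (suc (suc d + suc d) * (suc d + suc d) !))  ≡⟨ cong (λ z → 2 * suc (suc d) * z !) (cong suc (+-suc (suc d) (suc d))) ⟨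
  2 * suc (suc d) * (suc (suc d) + suc (suc d)) !         ∎
  where
  open ≤-Reasoning
  lem : ∀ d a f → 4 * a * (suc (suc d) * f * (suc (suc d) * f)) ≡ 4 * (suc (suc d) * suc (suc d)) * (a * (f * f))
  lem = solve-∀
  lem₂ : ∀ d f → 4 * (suc (suc d) * suc (suc d)) * (2 * suc d * f) + 4 * (suc (suc d) * suc (suc d)) * f
               ≡ 2 * suc (suc d) * (suc (suc (suc d + suc d)) * (suc (suc d + suc d) * f))
  lem₂ = solve-∀

4^≤C : ∀ d → 4 ^ suc d ≤ 2 * suc d * ((suc d + suc d) C suc d)
4^≤C d = *-cancelʳ-≤ _ _ (suc d ! * suc d !) {{suc d !* suc d !≢0}}
  (≤-trans (central d) (≤-reflexive (trans (cong (2 * suc d *_) (sym (C-! (suc d) (suc d)))) (sym (*-assoc (2 * suc d) ((suc d + suc d) C suc d) (suc d ! * suc d !))))))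

-- Raising N by one multiplies C (N + K , K) by (N + 1 + K) / (N + 1), which is at least 3 / 2 while
-- N + 1 ≤ 2 K. The start N = K is the central coefficient.
C-range23 : ∀ d e → e ≤ suc d → 4 ^ suc d * 3 ^ e ≤ 2 * suc d * ((suc d + e + suc d) C suc d) * 2 ^ e
C-range23 d zero _ = begin
  4 ^ suc d * 1                                     ≡⟨ *-identityʳ _ ⟩
  4 ^ suc d                                         ≤⟨ 4^≤C d ⟩
  2 * suc d * ((suc d + suc d) C suc d)             ≡⟨ cong (λ z → 2 * suc d * ((z + suc d) C suc d)) (+-identityʳ (suc d)) ⟨
  2 * suc d * ((suc d + 0 + suc d) C suc d)         ≡⟨ *-identityʳ _ ⟨
  2 * suc d * ((suc d + 0 + suc d) C suc d) * 1     ∎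
  where open ≤-Reasoning
C-range23 d (suc e) e<k = *-cancelˡ-≤ (suc N) (begin
  suc N * (4 ^ k * (3 * 3 ^ e))                      ≡⟨ lem₁ N (4 ^ k) (3 ^ e) ⟩
  3 * suc N * (4 ^ k * 3 ^ e)                        ≤⟨ *-mono-≤ ratio (C-range23 d e (<⇒≤ e<k)) ⟩
  2 * (N + suc k) * (2 * k * ((N + k) C k) * 2 ^ e)  ≡⟨ lem₂ k ((N + k) C k) (N + suc k) (2 ^ e) ⟩
  (N + suc k) * ((N + k) C k) * (2 * k) * (2 * 2 ^ e)  ≡⟨ cong (λ z → z * (2 * k) * (2 * 2 ^ e)) (C-sucˡ N k) ⟨
  suc N * ((suc N + k) C k) * (2 * k) * (2 * 2 ^ e)  ≡⟨ cong (λ z → suc N * ((z + k) C k) * (2 * k) * (2 * 2 ^ e)) (+-suc k e) ⟨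
  suc N * ((k + suc e + k) C k) * (2 * k) * (2 * 2 ^ e)  ≡⟨ lem₃ (suc N) k ((k + suc e + k) C k) (2 * 2 ^ e) ⟩
  suc N * (2 * k * ((k + suc e + k) C k) * (2 * 2 ^ e)) ∎)
  where
  open ≤-Reasoning
  k = suc d
  N = k + e
  lem₁ : ∀ N a b → suc N * (a * (3 * b)) ≡ 3 * suc N * (a * b)
  lem₁ = solve-∀
  lem₂ : ∀ k c w b → 2 * w * (2 * k * c * b) ≡ w * c * (2 * k) * (2 * b)
  lem₂ = solve-∀
  lem₃ : ∀ N k c b → N * c * (2 * k) * b ≡ N * (2 * k * c * b)
  lem₃ = solve-∀
  ratio : 3 * suc N ≤ 2 * (N + suc k)
  ratio = begin
    3 * suc (k + e)               ≡⟨ lem₄ k e ⟩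
    2 * k + 2 * suc e + (k + suc e)     ≤⟨ +-monoʳ-≤ (2 * k + 2 * suc e) (+-monoʳ-≤ k e<k) ⟩
    2 * k + 2 * suc e + (k + k)   ≡⟨ lem₅ k e ⟩
    2 * (k + e + suc k)           ∎
    where
    lem₄ : ∀ k e → 3 * suc (k + e) ≡ 2 * k + 2 * suc e + (k + suc e)
    lem₄ = solve-∀
    lem₅ : ∀ k e → 2 * k + 2 * suc e + (k + k) ≡ 2 * (k + e + suc k)
    lem₅ = solve-∀

-- At the end e = K of the previous range the base is 4 * 3 / 2 = 6; beyond it the coefficient only
-- increases.
6^≤C : ∀ d N → 2 * suc d ≤ N → 6 ^ suc d ≤ 2 * suc d * ((N + suc d) C suc d)
6^≤C d N 2k≤N = ≤-trans (*-cancelʳ-≤ _ _ (2 ^ suc d) {{m^n≢0 2 (suc d)}} (begin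
  6 ^ suc d * 2 ^ suc d        ≡⟨ trans (sym (^-distribʳ-* (suc d) 6 2)) (^-distribʳ-* (suc d) 4 3) ⟩
  4 ^ suc d * 3 ^ suc d        ≤⟨ C-range23 d (suc d) ≤-refl ⟩
  2 * suc d * ((suc d + suc d + suc d) C suc d) * 2 ^ suc d ∎))
  (*-monoʳ-≤ (2 * suc d) (C-mono (suc d) (≤-trans (≤-reflexive (cong (suc d +_) (sym (+-identityʳ (suc d))))) 2k≤N)))
  where
  open ≤-Reasoning

-- Binomial coefficients with a large prime factor

infixl 5 _⊞_
_⊞_ : ∀ {a b c d} → a ≤ b → c ≤ d → a + c ≤ b + d
_⊞_ = +-mono-≤

-- The shape of all linear arithmetic below: u ≤ v is a positive combination of the hypotheses, `c`
-- collects what is common to both sides, and the ring solver verifies the two splittings.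
cancel-≤ : ∀ c {a b u v} → u ≤ v → u ≡ c + a → v ≡ c + b → a ≤ b
cancel-≤ c u≤v refl refl = +-cancelˡ-≤ c _ _ u≤v

2ab≤a²+b² : ∀ a b → 2 * (a * b) ≤ a * a + b * b
2ab≤a²+b² a b with ≤-total a b
... | inj₁ a≤b = subst (λ b → 2 * (a * b) ≤ a * a + b * b) (m+[n∸m]≡n a≤b) (le a (b ∸ a))
  where
  lem : ∀ a c → 2 * (a * (a + c)) + c * c ≡ a * a + (a + c) * (a + c)
  lem = solve-∀
  le : ∀ a c → 2 * (a * (a + c)) ≤ a * a + (a + c) * (a + c)
  le a c = ≤-trans (m≤m+n _ (c * c)) (≤-reflexive (lem a c))
... | inj₂ b≤a = subst (λ a → 2 * (a * b) ≤ a * a + b * b) (m+[n∸m]≡n b≤a) (le b (a ∸ b))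
  where
  lem : ∀ b c → 2 * ((b + c) * b) + c * c ≡ (b + c) * (b + c) + b * b
  lem = solve-∀
  le : ∀ b c → 2 * ((b + c) * b) ≤ (b + c) * (b + c) + b * b
  le b c = ≤-trans (m≤m+n _ (c * c)) (≤-reflexive (lem b c))

^-cancelˡ-≤ : ∀ b {m n} → 1 < b → b ^ m ≤ b ^ n → m ≤ n
^-cancelˡ-≤ b {m} {n} 1<b le = ≮⇒≥ (λ n<m → <⇒≱ (^-monoʳ-< b 1<b n<m) le)

isqrt : ∀ n → ∃[ r ] r * r ≤ n × n < suc r * suc r
isqrt zero = 0 , z≤n , s≤s z≤n
isqrt (suc n) with isqrt n
... | r , r²≤n , n<r² with m≤n⇒m<n∨m≡n n<r²
...   | inj₁ 1+n<r² = r , m≤n⇒m≤1+n r²≤n , 1+n<r²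
...   | inj₂ 1+n≡r² = suc r , ≤-reflexive (sym 1+n≡r²) , ≤-<-trans (≤-reflexive 1+n≡r²) (*-mono-< (n<1+n (suc r)) (n<1+n (suc r)))

log₂ : ∀ r → 1 ≤ r → ∃[ h ] r < 2 ^ h × 2 ^ h ≤ 2 * r
log₂ (suc zero) _ = 1 , s≤s (s≤s z≤n) , ≤-refl
log₂ (suc (suc r)) _ with log₂ (suc r) (s≤s z≤n)
... | h , r<2^h , 2^h≤2r with m≤n⇒m<n∨m≡n r<2^h
...   | inj₁ lt = h , lt , ≤-trans 2^h≤2r (*-monoʳ-≤ 2 (n≤1+n (suc r)))
...   | inj₂ eq = suc h , subst (_< 2 ^ suc h) (sym eq) (^-monoʳ-< 2 ≤-refl (n<1+n h)) , ≤-reflexive (cong (2 *_) (sym eq))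

-- Explicit logarithmic estimates and the bounds on K

eventually : ∀ {P : ℕ → Set} k → (∀ {i} → i < k → P i) → P k → (∀ {i} → k ≤ i → P i → P (suc i)) → ∀ i → P i
eventually {P} k below at step i with <-≤-connex i k
... | inj₁ i<k = below i<k
... | inj₂ k≤i = subst P (m+[n∸m]≡n k≤i) (go (i ∸ k))
  where
  go : ∀ j → P (k + j)
  go zero = subst P (sym (+-identityʳ k)) at
  go (suc j) = subst P (sym (+-suc k j)) (step (m≤m+n k j) (go j))

-- The chord of 2 ^ h through h = 6 and h = 7. It is applied with 2 ^ h ≤ 2 r and r about √n, which
-- for n < 8 K and K near 1250 is of that size.
2^-linear : ∀ h → 64 * h ≤ 2 ^ h + 320
2^-linear = eventually 6 (λ i<6 → toWitness {a? = allUpTo? (λ h → 64 * h ≤? 2 ^ h + 320) 6} tt i<6)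
  (toWitness {a? = 64 * 6 ≤? 2 ^ 6 + 320} tt) step
  where
  lem₁ : ∀ h → 64 * suc h ≡ 64 * h + 64
  lem₁ = solve-∀
  lem₂ : ∀ a → a + 320 + a ≡ 2 * a + 320
  lem₂ = solve-∀
  step : ∀ {h} → 6 ≤ h → 64 * h ≤ 2 ^ h + 320 → 64 * suc h ≤ 2 ^ suc h + 320
  step {h} 6≤h ih = ≤-trans (≤-reflexive (lem₁ h)) (≤-trans (ih ⊞ ^-monoʳ-≤ 2 6≤h) (≤-reflexive (lem₂ (2 ^ h))))

-- The chord through x = 11 and x = 12. In the application 2 ^ x is at most 4 K, and K = 1250 gives
-- 5000, so little is lost at the threshold.
2^-linear′ : ∀ x → 2048 * x ≤ 2 ^ x + 20480
2^-linear′ = eventually 11 (λ i<11 → toWitness {a? = allUpTo? (λ h → 2048 * h ≤? 2 ^ h + 20480) 11} tt i<11)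
  (toWitness {a? = 2048 * 11 ≤? 2 ^ 11 + 20480} tt) step
  where
  lem₁ : ∀ h → 2048 * suc h ≡ 2048 * h + 2048
  lem₁ = solve-∀
  lem₂ : ∀ a → a + 20480 + a ≡ 2 * a + 20480
  lem₂ = solve-∀
  step : ∀ {h} → 11 ≤ h → 2048 * h ≤ 2 ^ h + 20480 → 2048 * suc h ≤ 2 ^ suc h + 20480
  step {h} 11≤h ih = ≤-trans (≤-reflexive (lem₁ h)) (≤-trans (ih ⊞ ^-monoʳ-≤ 2 11≤h) (≤-reflexive (lem₂ (2 ^ h))))

-- The constant 5696 gives equality at x = 11, again close to the threshold. The induction step
-- needs the increment 64 (2 h + 1) to stay below 2 ^ h, which the chord above supplies.
2^-quadratic : ∀ x → 64 * (x * x) ≤ 2 ^ x + 5696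
2^-quadratic = eventually 11 (λ i<11 → toWitness {a? = allUpTo? (λ h → 64 * (h * h) ≤? 2 ^ h + 5696) 11} tt i<11)
  (toWitness {a? = 64 * (11 * 11) ≤? 2 ^ 11 + 5696} tt) step
  where
  lem₁ : ∀ h → 64 * (suc h * suc h) ≡ 64 * (h * h) + 64 * (suc h + h)
  lem₁ = solve-∀
  lem₂ : ∀ a → a + 5696 + a ≡ 2 * a + 5696
  lem₂ = solve-∀
  lem₃ : ∀ h → 2048 * h + 1920 * 11 ≡ (1920 * h + 20480) + (64 * (suc h + h) + 576)
  lem₃ = solve-∀
  lem₄ : ∀ h a → (a + 20480) + 1920 * h ≡ (1920 * h + 20480) + a
  lem₄ = solve-∀
  step : ∀ {h} → 11 ≤ h → 64 * (h * h) ≤ 2 ^ h + 5696 → 64 * (suc h * suc h) ≤ 2 ^ suc h + 5696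
  step {h} 11≤h ih = ≤-trans (≤-reflexive (lem₁ h)) (≤-trans (ih ⊞ linear) (≤-reflexive (lem₂ (2 ^ h))))
    where
    linear : 64 * (suc h + h) ≤ 2 ^ h
    linear = ≤-trans (m≤m+n _ 576)
      (cancel-≤ (1920 * h + 20480) (2^-linear′ h ⊞ *-monoʳ-≤ 1920 11≤h) (lem₃ h) (lem₄ h (2 ^ h)))

-- Nine is the right start: at 8 the inequality would read 1024 ≤ 768. The polynomial added below is
-- the slack in doubling.
2^-cubic : ∀ j → 2 * ((9 + j) * (9 + j) * (9 + j)) ≤ 3 * 2 ^ (9 + j)
2^-cubic zero = toWitness {a? = 2 * (9 * 9 * 9) ≤? 3 * 2 ^ 9} tt
2^-cubic (suc j) = begin
  2 * ((9 + suc j) * (9 + suc j) * (9 + suc j))       ≤⟨ m≤m+n _ (2 * (j * j * j) + 48 * (j * j) + 372 * j + 916) ⟩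
  2 * ((9 + suc j) * (9 + suc j) * (9 + suc j)) + (2 * (j * j * j) + 48 * (j * j) + 372 * j + 916)  ≡⟨ lem j ⟩
  2 * (2 * ((9 + j) * (9 + j) * (9 + j)))             ≤⟨ *-monoʳ-≤ 2 (2^-cubic j) ⟩
  2 * (3 * 2 ^ (9 + j))                               ≡⟨ lem₂ (2 ^ (9 + j)) ⟩
  3 * 2 ^ suc (9 + j)                                 ≡⟨ cong (λ z → 3 * 2 ^ z) (+-suc 9 j) ⟨
  3 * 2 ^ (9 + suc j)                                 ∎
  where
  open ≤-Reasoning
  lem : ∀ j → 2 * ((9 + suc j) * (9 + suc j) * (9 + suc j)) + (2 * (j * j * j) + 48 * (j * j) + 372 * j + 916)
        ≡ 2 * (2 * ((9 + j) * (9 + j) * (9 + j)))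
  lem = solve-∀
  lem₂ : ∀ a → 2 * (3 * a) ≡ 3 * (2 * a)
  lem₂ = solve-∀

bits-linear : ∀ {K X} → 2 ^ X ≤ 4 * K → 512 * X ≤ K + 5120
bits-linear {K} {X} 2^X≤ = *-cancelˡ-≤ 4 (begin
  4 * (512 * X)     ≡⟨ *-assoc 4 512 X ⟨
  2048 * X          ≤⟨ 2^-linear′ X ⟩
  2 ^ X + 20480     ≤⟨ +-monoˡ-≤ 20480 2^X≤ ⟩
  4 * K + 20480     ≡⟨ *-distribˡ-+ 4 K 5120 ⟨
  4 * (K + 5120)    ∎)
  where open ≤-Reasoning

bits-quadratic : ∀ {K X} → 2 ^ X ≤ 4 * K → 16 * (X * X) ≤ K + 1424
bits-quadratic {K} {X} 2^X≤ = *-cancelˡ-≤ 4 (begin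
  4 * (16 * (X * X))    ≡⟨ *-assoc 4 16 (X * X) ⟨
  64 * (X * X)          ≤⟨ 2^-quadratic X ⟩
  2 ^ X + 5696          ≤⟨ +-monoˡ-≤ 5696 2^X≤ ⟩
  4 * K + 5696          ≡⟨ *-distribˡ-+ 4 K 1424 ⟨
  4 * (K + 1424)        ∎)
  where open ≤-Reasoning

root-bits-linear : ∀ {r h} → 2 ^ h ≤ 2 * r → 32 * h ≤ r + 160
root-bits-linear {r} {h} 2^h≤ = *-cancelˡ-≤ 2 (begin
  2 * (32 * h)      ≡⟨ *-assoc 2 32 h ⟨
  64 * h            ≤⟨ 2^-linear h ⟩
  2 ^ h + 320       ≤⟨ +-monoˡ-≤ 320 2^h≤ ⟩
  2 * r + 320       ≡⟨ *-distribˡ-+ 2 r 160 ⟨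
  2 * (r + 160)     ∎)
  where open ≤-Reasoning

prime-bits : ∀ {E h r} → 15 * E ≤ h * (8 * r + 300) → 32 * h ≤ r + 160 → 480 * E ≤ 8 * (r * r) + 1580 * r + 48000
prime-bits {E} {h} {r} hE hh = begin
  480 * E                            ≡⟨ *-assoc 32 15 E ⟩
  32 * (15 * E)                      ≤⟨ *-monoʳ-≤ 32 hE ⟩
  32 * (h * (8 * r + 300))           ≡⟨ *-assoc 32 h (8 * r + 300) ⟨
  32 * h * (8 * r + 300)             ≤⟨ *-monoˡ-≤ (8 * r + 300) hh ⟩
  (r + 160) * (8 * r + 300)          ≡⟨ lem r ⟩
  8 * (r * r) + 1580 * r + 48000     ∎
  where
  open ≤-Reasoning
  lem : ∀ r → (r + 160) * (8 * r + 300) ≡ 8 * (r * r) + 1580 * r + 48000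
  lem = solve-∀

-- Inserting the second bound into K ≤ 3 P leaves 15 K ≤ 12 K up to lower terms. The multipliers
-- 320, 64, 1 eliminate `P` and `X` and leave 63 K ≤ 14720.
too-small₁ : ∀ {K X P} → K ≤ 3 * P → 15 * P ≤ 4 * (K + 2 * X) + 150 → 512 * X ≤ K + 5120 → K < 1250
too-small₁ {K} {X} {P} k≤ p≤ x≤ = ≰⇒> λ 1250≤K → <⇒≱ (toWitness {a? = 14720 <? 63 * 1250} tt)
  (≤-trans (*-monoʳ-≤ 63 1250≤K) (cancel-≤ (960 * P + 257 * K + 512 * X)
    (*-monoʳ-≤ 320 k≤ ⊞ *-monoʳ-≤ 64 p≤ ⊞ x≤)
    (lem₁ K X P) (lem₂ K X P)))
  where
  lem₁ : ∀ K X P → 320 * K + 64 * (15 * P) + 512 * X ≡ (960 * P + 257 * K + 512 * X) + 63 * K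
  lem₁ = solve-∀
  lem₂ : ∀ K X P → 320 * (3 * P) + 64 * (4 * (K + 2 * X) + 150) + (K + 5120) ≡ (960 * P + 257 * K + 512 * X) + 14720
  lem₂ = solve-∀

-- The multipliers eliminate `E`. The linear term in r is absorbed by 2 * 100 * r ≤ r ^ 2 + 100 ^ 2,
-- with 100 ^ 2 = 8 * 1250, where r ^ 2 ≤ 8 K is sharpest. What remains is 147 K ≤ 153600.
too-small₃ : ∀ {K E X r} → 7 * K ≤ 12 * E + 60 * X → 512 * X ≤ K + 5120 →
             480 * E ≤ 8 * (r * r) + 1580 * r + 48000 → r * r ≤ 8 * K → K < 1250
too-small₃ {K} {E} {X} {r} k≤ x≤ e≤ r≤ = ≰⇒> λ 1250≤K → <⇒≱ (toWitness {a? = 153600 <? 147 * 1250} tt)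
  (≤-trans (*-monoʳ-≤ 147 1250≤K) (≤-trans (m≤m+n _ (160 * X + 20 * r)) (cancel-≤ (480 * E + 2400 * X + 1580 * r + 16 * (r * r) + 133 * K)
    (*-monoʳ-≤ 40 k≤ ⊞ *-monoʳ-≤ 5 x≤ ⊞ e≤ ⊞ *-monoʳ-≤ 8 (2ab≤a²+b² r 100) ⊞ *-monoʳ-≤ 16 r≤)
    (lem₁ K E X r) (lem₂ K E X r))))
  where
  lem₁ : ∀ K E X r → 40 * (7 * K) + 5 * (512 * X) + 480 * E + 8 * (2 * (r * 100)) + 16 * (r * r)
       ≡ (480 * E + 2400 * X + 1580 * r + 16 * (r * r) + 133 * K) + (147 * K + (160 * X + 20 * r))
  lem₁ = solve-∀
  lem₂ : ∀ K E X r → 40 * (12 * E + 60 * X) + 5 * (K + 5120) + (8 * (r * r) + 1580 * r + 48000)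
                   + 8 * (r * r + 10000) + 16 * (8 * K)
       ≡ (480 * E + 2400 * X + 1580 * r + 16 * (r * r) + 133 * K) + 153600
  lem₂ = solve-∀

-- The same elimination with 60 near √(3 * 1250). It ends in 153 K ≤ 188960, that is K ≤ 1235, which
-- dictates the threshold 1250.
too-small₄ : ∀ {K E X r} → 7 * K ≤ 12 * (X + E + 2 * (X * X)) → 512 * X ≤ K + 5120 → 16 * (X * X) ≤ K + 1424 →
             480 * E ≤ 8 * (r * r) + 1580 * r + 48000 → r * r ≤ 3 * K → K < 1250
too-small₄ {K} {E} {X} {r} k≤ x≤ xx≤ e≤ r≤ = ≰⇒> λ 1250≤K → <⇒≱ (toWitness {a? = 188960 <? 153 * 1250} tt)
  (≤-trans (*-monoʳ-≤ 153 1250≤K) (≤-trans (m≤m+n _ (32 * X + 100 * r)) (cancel-≤ (480 * E + 480 * X + 960 * (X * X) + 1580 * r + 22 * (r * r) + 127 * K)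
    (*-monoʳ-≤ 40 k≤ ⊞ x≤ ⊞ *-monoʳ-≤ 60 xx≤ ⊞ e≤ ⊞ *-monoʳ-≤ 14 (2ab≤a²+b² r 60) ⊞ *-monoʳ-≤ 22 r≤)
    (lem₁ K E X r) (lem₂ K E X r))))
  where
  lem₁ : ∀ K E X r → 40 * (7 * K) + 512 * X + 60 * (16 * (X * X)) + 480 * E + 14 * (2 * (r * 60)) + 22 * (r * r)
       ≡ (480 * E + 480 * X + 960 * (X * X) + 1580 * r + 22 * (r * r) + 127 * K) + (153 * K + (32 * X + 100 * r))
  lem₁ = solve-∀
  lem₂ : ∀ K E X r → 40 * (12 * (X + E + 2 * (X * X))) + (K + 5120) + 60 * (K + 1424)
                   + (8 * (r * r) + 1580 * r + 48000) + 14 * (r * r + 3600) + 22 * (3 * K)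
       ≡ (480 * E + 480 * X + 960 * (X * X) + 1580 * r + 22 * (r * r) + 127 * K) + 188960
  lem₂ = solve-∀

-- For h ≤ 8 the bound 8 ^ 3 = 512 ≤ 600 suffices; from 9 on `2^-cubic` applies.
h³≤3r : ∀ {r h} → 200 ≤ r → 2 ^ h ≤ 2 * r → h * h * h ≤ 3 * r
h³≤3r {r} {h} 200≤r 2^h≤ with ≤-<-connex h 8
... | inj₁ h≤8 = ≤-trans (*-mono-≤ (*-mono-≤ h≤8 h≤8) h≤8) (≤-trans (toWitness {a? = 512 ≤? 600} tt) (*-monoʳ-≤ 3 200≤r))
... | inj₂ 8<h = *-cancelˡ-≤ 2 (begin
  2 * (h * h * h)      ≤⟨ subst (λ h → 2 * (h * h * h) ≤ 3 * 2 ^ h) (m+[n∸m]≡n 8<h) (2^-cubic (h ∸ 9)) ⟩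
  3 * 2 ^ h            ≤⟨ *-monoʳ-≤ 3 2^h≤ ⟩
  3 * (2 * r)          ≡⟨ *-assoc 3 2 r ⟨
  6 * r                ≡⟨ *-assoc 2 3 r ⟩
  2 * (3 * r)          ∎)
  where open ≤-Reasoning

-- `E` is of order h r with h logarithmic, while r ^ 4 < K ^ 3, so K ≤ E + 4 X fails for large K. To
-- avoid fractional exponents, 3 K ≤ 2 h r is cubed and h ^ 3 ≤ 3 r is inserted, giving K ^ 3 ≤ r ^
-- 4.
too-small₂ : ∀ {K E X r h} → K ≤ E + 4 * X → 512 * X ≤ K + 5120 → 15 * E ≤ h * (8 * r + 300) →
             2 ^ h ≤ 2 * r → r * r * (r * r) < K * K * K → K < 1250
too-small₂ {K} {E} {X} {r} {h} k≤ x≤ e≤ 2^h≤ r<K = ≰⇒> contra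
  where
  contra : ¬ 1250 ≤ K
  contra 1250≤K = <⇒≱ (*-monoʳ-< 27 r<K) 27K³≤27r⁴
    where
    open ≤-Reasoning
    lem₁ : ∀ K E X → 120 * K + 512 * X + 8 * (15 * E) + 5120 ≡ (120 * E + 480 * X + 5120 + 6 * K) + (114 * K + 32 * X)
    lem₁ = solve-∀
    lem₂ : ∀ K E X H → 120 * (E + 4 * X) + (K + 5120) + 8 * H + 5 * K ≡ (120 * E + 480 * X + 5120 + 6 * K) + 8 * H
    lem₂ = solve-∀
    114K≤ : 114 * K ≤ 8 * (h * (8 * r + 300))
    114K≤ = ≤-trans (m≤m+n _ (32 * X)) (cancel-≤ (120 * E + 480 * X + 5120 + 6 * K)
      (*-monoʳ-≤ 120 k≤ ⊞ x≤ ⊞ *-monoʳ-≤ 8 e≤ ⊞ 5120≤) (lem₁ K E X) (lem₂ K E X (h * (8 * r + 300))))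
      where
      5120≤ : 5120 ≤ 5 * K
      5120≤ = ≤-trans (toWitness {a? = 5120 ≤? 5 * 1250} tt) (*-monoʳ-≤ 5 1250≤K)
    -- Otherwise h ≤ 8 and 114 K ≤ 8 * 8 * 1900 = 121600, which is less than 114 * 1250.
    200≤r : 200 ≤ r
    200≤r = ≮⇒≥ λ r<200 →
      let h≤8 = ≮⇒≥ λ 8<h → <⇒≱ (toWitness {a? = 2 * 200 <? 2 ^ 9} tt) (≤-trans (^-monoʳ-≤ 2 {9} {h} 8<h) (≤-trans 2^h≤ (*-monoʳ-≤ 2 (<⇒≤ r<200)))) in
      <⇒≱ (toWitness {a? = 8 * (8 * (8 * 200 + 300)) <? 114 * 1250} tt)
          (≤-trans (*-monoʳ-≤ 114 1250≤K) (≤-trans 114K≤ (*-monoʳ-≤ 8 (*-mono-≤ h≤8 (+-monoˡ-≤ 300 (*-monoʳ-≤ 8 (<⇒≤ r<200)))))))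
    -- Since r ≥ 200, the constant in 8 r + 300 is at most 3 r / 2.
    3K≤2hr : 3 * K ≤ 2 * (h * r)
    3K≤2hr = *-cancelˡ-≤ 76 (begin
      76 * (3 * K)                                  ≡⟨ lem₃ K ⟩
      2 * (114 * K)                                 ≤⟨ *-monoʳ-≤ 2 114K≤ ⟩
      2 * (8 * (h * (8 * r + 300)))                 ≡⟨ lem₄ h r ⟩
      8 * h * (16 * r + 3 * 200)                    ≤⟨ *-monoʳ-≤ (8 * h) (+-monoʳ-≤ (16 * r) (*-monoʳ-≤ 3 200≤r)) ⟩
      8 * h * (16 * r + 3 * r)                      ≡⟨ lem₅ h r ⟩
      76 * (2 * (h * r))                            ∎)
      where
      lem₃ : ∀ K → 76 * (3 * K) ≡ 2 * (114 * K)
      lem₃ = solve-∀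
      lem₄ : ∀ h r → 2 * (8 * (h * (8 * r + 300))) ≡ 8 * h * (16 * r + 3 * 200)
      lem₄ = solve-∀
      lem₅ : ∀ h r → 8 * h * (16 * r + 3 * r) ≡ 76 * (2 * (h * r))
      lem₅ = solve-∀
    lem₆ : ∀ K → 27 * (K * K * K) ≡ 3 * K * (3 * K) * (3 * K)
    lem₆ = solve-∀
    lem₇ : ∀ h r → 2 * (h * r) * (2 * (h * r)) * (2 * (h * r)) ≡ 8 * (r * r * r) * (h * h * h)
    lem₇ = solve-∀
    lem₈ : ∀ r → 8 * (r * r * r) * (3 * r) ≡ 24 * (r * r * (r * r))
    lem₈ = solve-∀
    27K³≤27r⁴ : 27 * (K * K * K) ≤ 27 * (r * r * (r * r))
    27K³≤27r⁴ = begin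
      27 * (K * K * K)                                 ≡⟨ lem₆ K ⟩
      3 * K * (3 * K) * (3 * K)                        ≤⟨ *-mono-≤ (*-mono-≤ 3K≤2hr 3K≤2hr) 3K≤2hr ⟩
      2 * (h * r) * (2 * (h * r)) * (2 * (h * r))      ≡⟨ lem₇ h r ⟩
      8 * (r * r * r) * (h * h * h)                    ≤⟨ *-monoʳ-≤ (8 * (r * r * r)) (h³≤3r {r} {h} 200≤r 2^h≤) ⟩
      8 * (r * r * r) * (3 * r)                        ≡⟨ lem₈ r ⟩
      24 * (r * r * (r * r))                           ≤⟨ *-monoˡ-≤ (r * r * (r * r)) (m≤m+n 24 3) ⟩
      27 * (r * r * (r * r))                           ∎

^-≤-2^ : ∀ {n b} → n ≤ 2 ^ b → ∀ e → n ^ e ≤ 2 ^ (b * e)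
^-≤-2^ {n} {b} n≤ e = ≤-trans (^-monoˡ-≤ e n≤) (≤-reflexive (^-*-assoc 2 b e))

4^≡2^ : ∀ e → 4 ^ e ≡ 2 ^ (2 * e)
4^≡2^ e = ^-*-assoc 2 2 e

-- 31 / 12 and 19 / 4 are rational lower bounds of log₂ 6 and log₂ 27.
6^-≤-2^ : ∀ {K b} → 6 ^ K ≤ 2 ^ b → 31 * K ≤ 12 * b
6^-≤-2^ {K} {b} le = ^-cancelˡ-≤ 2 ≤-refl (begin
  2 ^ (31 * K)     ≡⟨ ^-*-assoc 2 31 K ⟨
  (2 ^ 31) ^ K     ≤⟨ ^-monoˡ-≤ K (toWitness {a? = 2 ^ 31 ≤? 6 ^ 12} tt) ⟩
  (6 ^ 12) ^ K     ≡⟨ ^-*-assoc 6 12 K ⟩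
  6 ^ (12 * K)     ≡⟨ cong (6 ^_) (*-comm 12 K) ⟩
  6 ^ (K * 12)     ≡⟨ ^-*-assoc 6 K 12 ⟨
  (6 ^ K) ^ 12     ≤⟨ ^-monoˡ-≤ 12 le ⟩
  (2 ^ b) ^ 12     ≡⟨ ^-*-assoc 2 b 12 ⟩
  2 ^ (b * 12)     ≡⟨ cong (2 ^_) (*-comm b 12) ⟩
  2 ^ (12 * b)     ∎)
  where open ≤-Reasoning

27^-≤-2^ : ∀ {K b} → 27 ^ K ≤ 2 ^ b → 19 * K ≤ 4 * b
27^-≤-2^ {K} {b} le = ^-cancelˡ-≤ 2 ≤-refl (begin
  2 ^ (19 * K)     ≡⟨ ^-*-assoc 2 19 K ⟨
  (2 ^ 19) ^ K     ≤⟨ ^-monoˡ-≤ K (toWitness {a? = 2 ^ 19 ≤? 27 ^ 4} tt) ⟩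
  (27 ^ 4) ^ K     ≡⟨ ^-*-assoc 27 4 K ⟩
  27 ^ (4 * K)     ≡⟨ cong (27 ^_) (*-comm 4 K) ⟩
  27 ^ (K * 4)     ≡⟨ ^-*-assoc 27 K 4 ⟨
  (27 ^ K) ^ 4     ≤⟨ ^-monoˡ-≤ 4 le ⟩
  (2 ^ b) ^ 4      ≡⟨ ^-*-assoc 2 b 4 ⟩
  2 ^ (b * 4)      ≡⟨ cong (2 ^_) (*-comm b 4) ⟩
  2 ^ (4 * b)      ∎)
  where open ≤-Reasoning

2^-+₃ : ∀ a b c → 2 ^ a * 2 ^ b * 2 ^ c ≡ 2 ^ (a + b + c)
2^-+₃ a b c = trans (cong (_* 2 ^ c) (sym (^-distribˡ-+-* 2 a b))) (sym (^-distribˡ-+-* 2 (a + b) c))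

cube-mono : ∀ {a b} → a ≤ b → a * a * a ≤ b * b * b
cube-mono a≤b = *-mono-≤ (*-mono-≤ a≤b a≤b) a≤b

2^-cube : ∀ a → 2 ^ a * 2 ^ a * 2 ^ a ≡ 2 ^ (3 * a)
2^-cube a = trans (2^-+₃ a a a) (cong (2 ^_) (lem a))
  where
  lem : ∀ a → a + a + a ≡ 3 * a
  lem = solve-∀


-- Cubing replaces 4 ^ t by a power of 2, after which 27 ≤ 32 allows e to grow to K.
range23-bits : ∀ K e G t → e ≤ K → 3 * t ≤ 2 * K + e → 4 ^ K * 3 ^ e ≤ 2 ^ G * 4 ^ t * 2 ^ e → 7 * K ≤ 12 * G
range23-bits K e G t e≤K 3t≤ le = cancel-≤ (12 * K) (27^-≤-2^ {K} {3 * G + 3 * K} 27^K≤) (lem₁ K) (lem₂ G K)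
  where
  open ≤-Reasoning
  lem₁ : ∀ K → 19 * K ≡ 12 * K + 7 * K
  lem₁ = solve-∀
  lem₂ : ∀ G K → 4 * (3 * G + 3 * K) ≡ 12 * K + 12 * G
  lem₂ = solve-∀
  lem₃ : ∀ a b → a * a * a * ((3 * b) * (3 * b) * (3 * b)) ≡ 27 * (a * b * (a * b) * (a * b))
  lem₃ = solve-∀
  lem₄ : ∀ a b → a * b * (a * b) * (a * b) ≡ a * a * a * (b * b * b)
  lem₄ = solve-∀
  lem₅ : ∀ G K e → 3 * G + (2 * (2 * K + e) + 3 * e) ≡ (3 * G + 4 * K) + 5 * e
  lem₅ = solve-∀
  lem₆ : ∀ G t e → 3 * (G + 2 * t + e) ≡ 3 * G + (2 * (3 * t) + 3 * e)
  lem₆ = solve-∀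
  lem₇ : ∀ G K → (3 * G + 4 * K) + 5 * K ≡ 3 * (2 * K) + (3 * G + 3 * K)
  lem₇ = solve-∀
  3^-cube : ∀ e → 3 ^ e * 3 ^ e * 3 ^ e ≡ 27 ^ e
  3^-cube zero = refl
  3^-cube (suc e) = trans (lem (3 ^ e)) (cong (27 *_) (3^-cube e))
    where
    lem : ∀ b → (3 * b) * (3 * b) * (3 * b) ≡ 27 * (b * b * b)
    lem = solve-∀
  cubed : 2 ^ (3 * (2 * K)) * 27 ^ e ≤ 2 ^ ((3 * G + 4 * K) + 5 * e)
  cubed = begin
    2 ^ (3 * (2 * K)) * 27 ^ e                         ≡⟨ cong₂ _*_ (trans (cong (λ z → z * z * z) (4^≡2^ K)) (2^-cube (2 * K))) (3^-cube e) ⟨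
    4 ^ K * 4 ^ K * 4 ^ K * (3 ^ e * 3 ^ e * 3 ^ e)    ≡⟨ lem₄ (4 ^ K) (3 ^ e) ⟨
    4 ^ K * 3 ^ e * (4 ^ K * 3 ^ e) * (4 ^ K * 3 ^ e)  ≤⟨ cube-mono le ⟩
    rhs * rhs * rhs                                    ≡⟨ cong (λ z → z * z * z) (trans (cong (λ z → 2 ^ G * z * 2 ^ e) (4^≡2^ t)) (2^-+₃ G (2 * t) e)) ⟩
    2 ^ f * 2 ^ f * 2 ^ f                              ≡⟨ 2^-cube f ⟩
    2 ^ (3 * f)                                        ≡⟨ cong (2 ^_) (lem₆ G t e) ⟩
    2 ^ (3 * G + (2 * (3 * t) + 3 * e))                ≤⟨ ^-monoʳ-≤ 2 (+-monoʳ-≤ (3 * G) (+-monoˡ-≤ (3 * e) (*-monoʳ-≤ 2 3t≤))) ⟩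
    2 ^ (3 * G + (2 * (2 * K + e) + 3 * e))            ≡⟨ cong (2 ^_) (lem₅ G K e) ⟩
    2 ^ ((3 * G + 4 * K) + 5 * e)                      ∎
    where
    rhs = 2 ^ G * 4 ^ t * 2 ^ e
    f = G + 2 * t + e
  27^K≤ : 27 ^ K ≤ 2 ^ (3 * G + 3 * K)
  27^K≤ = *-cancelˡ-≤ (2 ^ (3 * (2 * K))) {{m^n≢0 2 (3 * (2 * K))}} (begin
    2 ^ (3 * (2 * K)) * 27 ^ K                            ≡⟨ cong (λ z → 2 ^ (3 * (2 * K)) * 27 ^ z) (m+[n∸m]≡n e≤K) ⟨
    2 ^ (3 * (2 * K)) * 27 ^ (e + (K ∸ e))                ≡⟨ cong (2 ^ (3 * (2 * K)) *_) (^-distribˡ-+-* 27 e (K ∸ e)) ⟩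
    2 ^ (3 * (2 * K)) * (27 ^ e * 27 ^ (K ∸ e))           ≡⟨ *-assoc (2 ^ (3 * (2 * K))) (27 ^ e) (27 ^ (K ∸ e)) ⟨
    2 ^ (3 * (2 * K)) * 27 ^ e * 27 ^ (K ∸ e)             ≤⟨ *-mono-≤ cubed (^-≤-2^ {27} {5} (m≤m+n 27 5) (K ∸ e)) ⟩
    2 ^ ((3 * G + 4 * K) + 5 * e) * 2 ^ (5 * (K ∸ e))     ≡⟨ ^-distribˡ-+-* 2 ((3 * G + 4 * K) + 5 * e) (5 * (K ∸ e)) ⟨
    2 ^ ((3 * G + 4 * K) + 5 * e + 5 * (K ∸ e))           ≡⟨ cong (2 ^_) (trans (+-assoc (3 * G + 4 * K) (5 * e) (5 * (K ∸ e)))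
                                                               (cong ((3 * G + 4 * K) +_) (trans (sym (*-distribˡ-+ 5 e (K ∸ e))) (cong (5 *_) (m+[n∸m]≡n e≤K))))) ⟩
    2 ^ ((3 * G + 4 * K) + 5 * K)                         ≡⟨ cong (2 ^_) (lem₇ G K) ⟩
    2 ^ (3 * (2 * K) + (3 * G + 3 * K))                   ≡⟨ ^-distribˡ-+-* 2 (3 * (2 * K)) (3 * G + 3 * K) ⟩
    2 ^ (3 * (2 * K)) * 2 ^ (3 * G + 3 * K)               ∎)

-- The Sylvester-Schur theorem with a logarithmic margin

module _ (N k X l : ℕ) (1250≤K : 1250 ≤ suc k) (K≤N : suc k ≤ N)
         (2K≤2^X : 2 * suc k ≤ 2 ^ X) (2^X≤4K : 2 ^ X ≤ 4 * suc k) (l≤2X : l ≤ 2 * X)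
         (smooth : ∀ {p} → Prime p → p ∣ (N + suc k) C suc k → p ≤ suc k + l) where
  private
    K = suc k
    n = N + K
    s = K + l
    c = n C K
    r = proj₁ (isqrt n)
    r²≤n : r * r ≤ n
    r²≤n = proj₁ (proj₂ (isqrt n))
    n<r² : n < suc r * suc r
    n<r² = proj₂ (proj₂ (isqrt n))
    1≤r : 1 ≤ r
    1≤r = n≢0⇒n>0 λ r≡0 → <⇒≱ (subst (λ z → n < suc z * suc z) r≡0 n<r²) (≤-trans (≤-trans (s≤s z≤n) 1250≤K) (m≤n+m K N))
    h = proj₁ (log₂ r 1≤r)
    r<2^h : r < 2 ^ h
    r<2^h = proj₁ (proj₂ (log₂ r 1≤r))
    2^h≤2r : 2 ^ h ≤ 2 * r
    2^h≤2r = proj₂ (proj₂ (log₂ r 1≤r))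
    -- 2 ^ E bounds the contribution n ^ π r of the primes up to √n.
    E = 2 * h * π r
    Xlin : 512 * X ≤ K + 5120
    Xlin = bits-linear {K} {X} 2^X≤4K
    E-bound : 15 * E ≤ h * (8 * r + 300)
    E-bound = begin
      15 * (2 * h * π r)        ≡⟨ lem₁ h (π r) ⟩
      2 * h * (15 * π r)        ≤⟨ *-monoʳ-≤ (2 * h) (π-bound r) ⟩
      2 * h * (4 * r + 150)     ≡⟨ lem₂ h r ⟩
      h * (8 * r + 300)         ∎
      where
      open ≤-Reasoning
      lem₁ : ∀ h p → 15 * (2 * h * p) ≡ 2 * h * (15 * p)
      lem₁ = solve-∀
      lem₂ : ∀ h r → 2 * h * (4 * r + 150) ≡ h * (8 * r + 300)
      lem₂ = solve-∀
    E-bound′ : 480 * E ≤ 8 * (r * r) + 1580 * r + 48000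
    E-bound′ = prime-bits {E} {h} {r} E-bound (root-bits-linear {r} {h} 2^h≤2r)
    n^π≤ : n ^ π r ≤ 2 ^ E
    n^π≤ = ^-≤-2^ {n} {2 * h} (≤-trans (<⇒≤ n<r²) (≤-trans (*-mono-≤ r<2^h r<2^h)
             (≤-reflexive (trans (sym (^-distribˡ-+-* 2 h h)) (cong (λ z → 2 ^ (h + z)) (sym (+-identityʳ h))))))) (π r)
    c≤ : c ≤ 2 ^ (E + 2 * s)
    c≤ = ≤-trans (C≤-√ N k s smooth r n<r²) (≤-trans (*-mono-≤ n^π≤ (≤-reflexive (4^≡2^ s))) (≤-reflexive (sym (^-distribˡ-+-* 2 E (2 * s)))))

    -- Here (n / K) ^ 3 ≥ n, so the lower bound (n / K) ^ K is at least n ^ (K / 3). Against the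
    -- upper bound n ^ π s this forces K ≤ 3 π s, too many primes.
    cubic : K * K * K ≤ n * n → ⊥
    cubic K³≤n² = <⇒≱ (too-small₁ {K} {X} {P} K≤3P P≤ Xlin) 1250≤K
      where
      open ≤-Reasoning
      P = π s
      P≤ : 15 * P ≤ 4 * (K + 2 * X) + 150
      P≤ = ≤-trans (π-bound s) (+-monoˡ-≤ 150 (*-monoʳ-≤ 4 (+-monoʳ-≤ K l≤2X)))
      lem₁ : ∀ a b → a * b * (a * b) * (a * b) ≡ a * a * a * (b * b * b)
      lem₁ = solve-∀
      lem₂ : ∀ p → 3 * p ≡ p + p + p
      lem₂ = solve-∀
      A = n ^ P
      B = K ^ K
      D = n ^ K
      B³≤D² : B * B * B ≤ D * D
      B³≤D² = begin
        B * B * B            ≡⟨ cong (_* B) (^-distribʳ-* K K K) ⟨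
        (K * K) ^ K * B      ≡⟨ ^-distribʳ-* K (K * K) K ⟨
        (K * K * K) ^ K      ≤⟨ ^-monoˡ-≤ K K³≤n² ⟩
        (n * n) ^ K          ≡⟨ ^-distribʳ-* K n n ⟩
        D * D                ∎
      D≤A³ : D ≤ A * A * A
      D≤A³ = *-cancelʳ-≤ _ _ (D * D) {{m*n≢0 D D {{m^n≢0 n K {{n≢0}}}} {{m^n≢0 n K {{n≢0}}}}}} (begin
        D * (D * D)                  ≡⟨ *-assoc D D D ⟨
        D * D * D                    ≤⟨ cube-mono (≤-trans (^≤C N K) (*-monoˡ-≤ B (C≤n^π N k s smooth))) ⟩
        A * B * (A * B) * (A * B)    ≡⟨ lem₁ A B ⟩
        A * A * A * (B * B * B)      ≤⟨ *-monoʳ-≤ (A * A * A) B³≤D² ⟩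
        A * A * A * (D * D)          ∎)
        where
        n≢0 : NonZero n
        n≢0 = >-nonZero (≤-trans (s≤s z≤n) (m≤n+m K N))
      K≤3P : K ≤ 3 * P
      K≤3P = ^-cancelˡ-≤ n (≤-trans (≤-trans (toWitness {a? = 2 ≤? 1250} tt) 1250≤K) (m≤n+m K N)) (begin
        n ^ K                        ≤⟨ D≤A³ ⟩
        n ^ P * n ^ P * n ^ P        ≡⟨ cong (_* n ^ P) (^-distribˡ-+-* n P P) ⟨
        n ^ (P + P) * n ^ P          ≡⟨ ^-distribˡ-+-* n (P + P) P ⟨
        n ^ (P + P + P)              ≡⟨ cong (n ^_) (lem₂ P) ⟨
        n ^ (3 * P)                  ∎)

    -- The lower bound 8 ^ K beats the primorial part 4 ^ s by about 2 ^ K, which the primes up to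
    -- √n would have to make up.
    large : 8 * K ≤ n → n * n < K * K * K → ⊥
    large 8K≤n n²<K³ = <⇒≱ (too-small₂ {K} {E} {X} {r} {h} K≤ Xlin E-bound 2^h≤2r (≤-<-trans (*-mono-≤ r²≤n r²≤n) n²<K³)) 1250≤K
      where
      lem₁ : ∀ K → 3 * K ≡ 2 * K + K
      lem₁ = solve-∀
      lem₂ : ∀ E K X → E + 2 * (K + 2 * X) ≡ 2 * K + (E + 4 * X)
      lem₂ = solve-∀
      K≤ : K ≤ E + 4 * X
      K≤ = cancel-≤ (2 * K) (≤-trans (^-cancelˡ-≤ 2 ≤-refl (≤-trans (≤-reflexive (sym (^-*-assoc 2 3 K))) (≤-trans (c^≤C 8 N K 8K≤n) c≤)))
        (+-monoʳ-≤ E (*-monoʳ-≤ 2 (+-monoʳ-≤ K l≤2X)))) (lem₁ K) (lem₂ E K X)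

    -- Now only 6 ^ K, up to the factor 2 K, is available. It still beats 4 ^ s, by the exponent 31
    -- / 12 - 2 = 7 / 12 per unit of K.
    medium : 3 * K ≤ n → n < 8 * K → ⊥
    medium 3K≤n n<8K = <⇒≱ (too-small₃ {K} {E} {X} {r} 7K≤ Xlin E-bound′ (≤-trans r²≤n (<⇒≤ n<8K))) 1250≤K
      where
      lem₁ : ∀ K → 31 * K ≡ 24 * K + 7 * K
      lem₁ = solve-∀
      lem₂ : ∀ E K X → 12 * (X + (E + 2 * (K + 2 * X))) ≡ 24 * K + (12 * E + 60 * X)
      lem₂ = solve-∀
      lem₃ : ∀ K → 3 * K ≡ 2 * K + K
      lem₃ = solve-∀
      2K≤N : 2 * K ≤ N
      2K≤N = +-cancelʳ-≤ K (2 * K) N (≤-trans (≤-reflexive (sym (lem₃ K))) 3K≤n)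
      6^K≤ : 6 ^ K ≤ 2 ^ (X + (E + 2 * s))
      6^K≤ = ≤-trans (6^≤C k N 2K≤N) (≤-trans (*-mono-≤ 2K≤2^X c≤) (≤-reflexive (sym (^-distribˡ-+-* 2 X (E + 2 * s)))))
      7K≤ : 7 * K ≤ 12 * E + 60 * X
      7K≤ = cancel-≤ (24 * K) (≤-trans (6^-≤-2^ {K} {X + (E + 2 * s)} 6^K≤) (*-monoʳ-≤ 12 (+-monoʳ-≤ X (+-monoʳ-≤ E (*-monoʳ-≤ 2 (+-monoʳ-≤ K l≤2X))))))
        (lem₁ K) (lem₂ E K X)

    -- Near n = 2 K the coefficient itself is of size 4 ^ K, so the factor 4 ^ s is too large.
    -- Without the primes between n / 3 and K it becomes 4 ^ (n / 3), and the few primes above K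
    -- cost s ^ l.
    small : n < 3 * K → ⊥
    small n<3K = <⇒≱ (too-small₄ {K} {E} {X} {r} (range23-bits K e G t e≤K 3t≤ le) Xlin (bits-quadratic {K} {X} 2^X≤4K) E-bound′ (≤-trans r²≤n (<⇒≤ n<3K))) 1250≤K
      where
      open ≤-Reasoning
      e = N ∸ K
      t = n / 3
      -- The exponents of 2 that pay for the factor 2 K, for the primes up to √n, and for s ^ l with
      -- s ≤ 2 ^ X and l ≤ 2 X.
      G = X + E + 2 * (X * X)
      K+e≡N : K + e ≡ N
      K+e≡N = m+[n∸m]≡n K≤N
      lem₁ : ∀ K e → K + e + K ≡ 2 * K + e
      lem₁ = solve-∀
      lem₂ : ∀ K → 3 * K ≡ K + K + K
      lem₂ = solve-∀
      n≡ : n ≡ 2 * K + e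
      n≡ = trans (cong (_+ K) (sym K+e≡N)) (lem₁ K e)
      e≤K : e ≤ K
      e≤K = +-cancelˡ-≤ (K + K) e K (≤-trans (≤-reflexive (trans (cong (_+ e) (cong (K +_) (sym (+-identityʳ K)))) (sym n≡))) (≤-trans (<⇒≤ n<3K) (≤-reflexive (lem₂ K))))
      3t≤ : 3 * t ≤ 2 * K + e
      3t≤ = ≤-trans (≤-reflexive (*-comm 3 t)) (≤-trans (m/n*n≤m n 3) (≤-reflexive n≡))
      n<3t : n < 3 * suc t
      n<3t = begin-strict
        n                  ≡⟨ m≡m%n+[m/n]*n n 3 ⟩
        n % 3 + t * 3      <⟨ +-monoˡ-< (t * 3) (m%n<n n 3) ⟩
        3 + t * 3          ≡⟨ *-comm (suc t) 3 ⟩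
        3 * suc t          ∎
      2≤t : 2 ≤ t
      2≤t = ≤-trans (toWitness {a? = 2 ≤? 1250 / 3} tt) (/-monoˡ-≤ 3 (≤-trans 1250≤K (m≤n+m K N)))
      l≤K : l ≤ K
      l≤K = ≤-trans l≤2X (*-cancelˡ-≤ 256 (≤-trans (≤-reflexive (sym (*-assoc 256 2 X))) (≤-trans Xlin (≤-trans (+-monoʳ-≤ K 5120≤) (≤-reflexive (lem₃ K))))))
        where
        5120≤ : 5120 ≤ 255 * K
        5120≤ = ≤-trans (toWitness {a? = 5120 ≤? 255 * 1250} tt) (*-monoʳ-≤ 255 1250≤K)
        lem₃ : ∀ K → K + 255 * K ≡ 256 * K
        lem₃ = solve-∀
      s^l≤ : s ^ l ≤ 2 ^ (2 * (X * X))
      s^l≤ = begin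
        s ^ l                ≤⟨ ^-≤-2^ {s} {X} (≤-trans (+-monoʳ-≤ K l≤K) (≤-trans (≤-reflexive (cong (K +_) (sym (+-identityʳ K)))) 2K≤2^X)) l ⟩
        2 ^ (X * l)          ≤⟨ ^-monoʳ-≤ 2 (*-monoʳ-≤ X l≤2X) ⟩
        2 ^ (X * (2 * X))    ≡⟨ cong (2 ^_) (lem₄ X) ⟩
        2 ^ (2 * (X * X))    ∎
        where
        lem₄ : ∀ X → X * (2 * X) ≡ 2 * (X * X)
        lem₄ = solve-∀
      lem₅ : ∀ a b c d → a * (b * c * d) ≡ a * b * d * c
      lem₅ = solve-∀
      le : 4 ^ K * 3 ^ e ≤ 2 ^ G * 4 ^ t * 2 ^ e
      le = begin
        4 ^ K * 3 ^ e                                       ≤⟨ C-range23 k e e≤K ⟩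
        2 * K * ((K + e + K) C K) * 2 ^ e                   ≡⟨ cong (λ z → 2 * K * ((z + K) C K) * 2 ^ e) K+e≡N ⟩
        2 * K * c * 2 ^ e                                   ≤⟨ *-monoˡ-≤ (2 ^ e) (*-mono-≤ 2K≤2^X (≤-trans (C≤-√-third N k s smooth r t l n<r² n<3t 2≤t K≤N refl)
                                                                 (*-mono-≤ (*-monoˡ-≤ (4 ^ t) n^π≤) s^l≤))) ⟩
        2 ^ X * (2 ^ E * 4 ^ t * 2 ^ (2 * (X * X))) * 2 ^ e ≡⟨ cong (_* 2 ^ e) (lem₅ (2 ^ X) (2 ^ E) (4 ^ t) (2 ^ (2 * (X * X)))) ⟩
        2 ^ X * 2 ^ E * 2 ^ (2 * (X * X)) * 4 ^ t * 2 ^ e   ≡⟨ cong (λ z → z * 4 ^ t * 2 ^ e) (2^-+₃ X E (2 * (X * X))) ⟩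
        2 ^ G * 4 ^ t * 2 ^ e                               ∎

  -- Far out, charging every prime a full n is harmless because n / K is large. Closer in, the
  -- exponent 1 of primes above √n must be exploited, and the lower bound for the coefficient sinks
  -- from 8 ^ K through 6 ^ K towards 4 ^ K.
  C-not-smooth : ⊥
  C-not-smooth with <-≤-connex n (3 * K) | <-≤-connex n (8 * K) | <-≤-connex (n * n) (K * K * K)
  ... | inj₁ n<3K | _         | _          = small n<3K
  ... | inj₂ 3K≤n | inj₁ n<8K | _          = medium 3K≤n n<8K
  ... | inj₂ _    | inj₂ 8K≤n | inj₁ n²<K³ = large 8K≤n n²<K³
  ... | inj₂ _    | inj₂ _    | inj₂ K³≤n² = cubic K³≤n²

-- The two sides of the equation as ratios

odds-+ : ∀ n d → odds 0 (n + d) ≡ odds 0 n * odds n d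
odds-+ n d = trans (∏-+ n d (λ i → suc (2 * i))) (cong (odds 0 n *_) (∏-cong d (λ i → lem n i)))
  where
  lem : ∀ n i → suc (2 * (n + i)) ≡ 2 * n + suc (2 * i)
  lem = solve-∀

!-double : ∀ n → (n + n) ! ≡ 2 ^ n * n ! * odds 0 n
!-double zero = refl
!-double (suc n) = begin
  (suc n + suc n) !                                      ≡⟨ cong _! (cong suc (+-suc n n)) ⟩
  suc (suc (n + n)) * (suc (n + n) * (n + n) !)          ≡⟨ cong (λ z → suc (suc (n + n)) * (suc (n + n) * z)) (!-double n) ⟩
  suc (suc (n + n)) * (suc (n + n) * (2 ^ n * n ! * odds 0 n))  ≡⟨ lem n (2 ^ n) (n !) (odds 0 n) ⟩
  2 * 2 ^ n * (suc n * n !) * (suc (2 * n) * odds 0 n)   ∎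
  where
  open ≡-Reasoning
  lem : ∀ n a b c → suc (suc (n + n)) * (suc (n + n) * (a * b * c)) ≡ 2 * a * (suc n * b) * (suc (2 * n) * c)
  lem = solve-∀

2*≡+ : ∀ n → 2 * n ≡ n + n
2*≡+ n = cong (n +_) (+-identityʳ n)

C-central : ∀ n → ((2 * n) C n) * n ! ≡ 2 ^ n * odds 0 n
C-central n = *-cancelʳ-≡ _ _ (n !) {{n !≢0}} (begin
  ((2 * n) C n) * n ! * n !      ≡⟨ cong (λ z → (z C n) * n ! * n !) (2*≡+ n) ⟩
  ((n + n) C n) * n ! * n !      ≡⟨ *-assoc ((n + n) C n) (n !) (n !) ⟩
  ((n + n) C n) * (n ! * n !)    ≡⟨ C-! n n ⟩
  (n + n) !                      ≡⟨ !-double n ⟩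
  2 ^ n * n ! * odds 0 n         ≡⟨ lem (2 ^ n) (n !) (odds 0 n) ⟩
  2 ^ n * odds 0 n * n !         ∎)
  where
  open ≡-Reasoning
  lem : ∀ a b c → a * b * c ≡ a * c * b
  lem = solve-∀

-- Divided by `C-central b`, this is the product formula for F.
C-shifted : ∀ x b → ((x + 2 * b) C b) * b ! * rising b x ≡ 2 ^ b * odds 0 b * rising (2 * b) x
C-shifted x b = *-cancelʳ-≡ _ _ (b !) {{b !≢0}} (begin
  c * b ! * rising b x * b !                     ≡⟨ lem₁ c (b !) (rising b x) ⟩
  c * (b ! * (b ! * rising b x))                 ≡⟨ cong₂ (λ u v → (u C b) * (b ! * v)) (trans (cong (x +_) (2*≡+ b)) (lem₂ x b)) (sym (!-rising b x)) ⟩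
  ((b + x + b) C b) * (b ! * (b + x) !)          ≡⟨ C-! (b + x) b ⟩
  (b + x + b) !                                  ≡⟨ cong _! (lem₃ x b) ⟩
  (2 * b + x) !                                  ≡⟨ !-rising (2 * b) x ⟩
  (2 * b) ! * rising (2 * b) x                   ≡⟨ cong (λ z → z ! * rising (2 * b) x) (2*≡+ b) ⟩
  (b + b) ! * rising (2 * b) x                   ≡⟨ cong (_* rising (2 * b) x) (!-double b) ⟩
  2 ^ b * b ! * odds 0 b * rising (2 * b) x      ≡⟨ lem₄ (2 ^ b) (b !) (odds 0 b) (rising (2 * b) x) ⟩
  2 ^ b * odds 0 b * rising (2 * b) x * b !      ∎)
  where
  open ≡-Reasoning
  c = (x + 2 * b) C b
  lem₁ : ∀ c f r → c * f * r * f ≡ c * (f * (f * r))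
  lem₁ = solve-∀
  lem₂ : ∀ x b → x + (b + b) ≡ b + x + b
  lem₂ = solve-∀
  lem₃ : ∀ x b → b + x + b ≡ 2 * b + x
  lem₃ = solve-∀
  lem₄ : ∀ a b c d → a * b * c * d ≡ a * c * d * b
  lem₄ = solve-∀

-- Fractions stay unreduced: the prime argument reads `≈` as an equation between explicit products,
-- and the tables need comparisons that evaluate on natural numbers.
record Ratio : Set where
  constructor ratio
  field
    num den : ℕ
    den>0   : 0 < den
open Ratio

infix 4 _≼_ _≺_ _≈_ _≼ᵇ_ _≺ᵇ_
_≼_ _≺_ _≈_ : Ratio → Ratio → Set
p ≼ q = num p * den q ≤ num q * den p
p ≺ q = num p * den q < num q * den p
p ≈ q = num p * den q ≡ num q * den p

_≼ᵇ_ _≺ᵇ_ : Ratio → Ratio → Bool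
p ≼ᵇ q = num p * den q ≤ᵇ num q * den p
p ≺ᵇ q = num p * den q <ᵇ num q * den p

≼ᵇ⇒≼ : ∀ p q → (p ≼ᵇ q) ≡ true → p ≼ q
≼ᵇ⇒≼ p q eq = ≤ᵇ⇒≤ _ _ (subst T (sym eq) tt)

≺ᵇ⇒≺ : ∀ p q → (p ≺ᵇ q) ≡ true → p ≺ q
≺ᵇ⇒≺ p q eq = <ᵇ⇒< _ _ (subst T (sym eq) tt)

swap-last : ∀ a b c → a * b * c ≡ a * c * b
swap-last = solve-∀

≼-trans : ∀ p q r → p ≼ q → q ≼ r → p ≼ r
≼-trans p q r p≼q q≼r = *-cancelʳ-≤ _ _ (den q) {{>-nonZero (den>0 q)}} (begin
  num p * den r * den q    ≡⟨ swap-last (num p) (den r) (den q) ⟩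
  num p * den q * den r    ≤⟨ *-monoˡ-≤ (den r) p≼q ⟩
  num q * den p * den r    ≡⟨ swap-last (num q) (den p) (den r) ⟩
  num q * den r * den p    ≤⟨ *-monoˡ-≤ (den p) q≼r ⟩
  num r * den q * den p    ≡⟨ swap-last (num r) (den q) (den p) ⟩
  num r * den p * den q    ∎)
  where open ≤-Reasoning

≼-≺-trans : ∀ p q r → p ≼ q → q ≺ r → p ≺ r
≼-≺-trans p q r p≼q q≺r = *-cancelʳ-< (den q) _ _ (begin-strict
  num p * den r * den q    ≡⟨ swap-last (num p) (den r) (den q) ⟩
  num p * den q * den r    ≤⟨ *-monoˡ-≤ (den r) p≼q ⟩
  num q * den p * den r    ≡⟨ swap-last (num q) (den p) (den r) ⟩
  num q * den r * den p    <⟨ *-monoˡ-< (den p) {{>-nonZero (den>0 p)}} q≺r ⟩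
  num r * den q * den p    ≡⟨ swap-last (num r) (den q) (den p) ⟩
  num r * den p * den q    ∎)
  where open ≤-Reasoning

≺-≼-trans : ∀ p q r → p ≺ q → q ≼ r → p ≺ r
≺-≼-trans p q r p≺q q≼r = *-cancelʳ-< (den q) _ _ (begin-strict
  num p * den r * den q    ≡⟨ swap-last (num p) (den r) (den q) ⟩
  num p * den q * den r    <⟨ *-monoˡ-< (den r) {{>-nonZero (den>0 r)}} p≺q ⟩
  num q * den p * den r    ≡⟨ swap-last (num q) (den p) (den r) ⟩
  num q * den r * den p    ≤⟨ *-monoˡ-≤ (den p) q≼r ⟩
  num r * den q * den p    ≡⟨ swap-last (num r) (den q) (den p) ⟩
  num r * den p * den q    ∎)
  where open ≤-Reasoning

≺⇒≉ : ∀ p q → p ≺ q → ¬ p ≈ q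
≺⇒≉ p q p≺q p≈q = <-irrefl p≈q p≺q

-- F x b is C (x + 2 b , b) / C (2 b , b).
F : ℕ → ℕ → Ratio
F x b = ratio (rising (2 * b) x) (rising b x) (rising-pos b x)

-- The factors that do not depend on M are arguments, so that they are evaluated only once per m.
Rʷ : (m m! o : ℕ) → 0 < o → ℕ → Ratio
Rʷ m m! o 0<o M = ratio (odds M m * m!) (rising M m * o) (*-mono-≤ (rising-pos M m) 0<o)

-- R m M is C (2 (m + M) , m + M) / (C (2 m , m) C (2 M , M)), hence symmetric in m and M.
R : ℕ → ℕ → Ratio
R m = Rʷ m (m !) (odds 0 m) (odds-pos 0 m)

-- The limit of R m M as M grows, equal to 4 ^ m / C (2 m , m).
R∞ : ℕ → Ratio
R∞ m = ratio (2 ^ m * m !) (odds 0 m) (odds-pos 0 m)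

-- The limit of F x b as b grows.
F∞ : ℕ → Ratio
F∞ x = ratio (2 ^ x) 1 ≤-refl

-- Each factor (2 M + 2 i - 1) / (M + i) equals 2 - 1 / (M + i).
R-mono : ∀ m {M M′} → M ≤ M′ → R m M ≼ R m M′
R-mono m {M} {M′} M≤M′ = begin
  odds M m * m ! * (rising M′ m * odds 0 m)     ≡⟨ lem (odds M m) (m !) (rising M′ m) (odds 0 m) ⟩
  odds M m * rising M′ m * (m ! * odds 0 m)     ≤⟨ *-monoˡ-≤ (m ! * odds 0 m) (∏-cross m {g = λ i → M + suc i} (λ i _ → termwise i)) ⟩
  odds M′ m * rising M m * (m ! * odds 0 m)     ≡⟨ lem (odds M′ m) (m !) (rising M m) (odds 0 m) ⟨
  odds M′ m * m ! * (rising M m * odds 0 m)     ∎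
  where
  open ≤-Reasoning
  lem : ∀ a b c d → a * b * (c * d) ≡ a * c * (b * d)
  lem = solve-∀
  lem₁ : ∀ M M′ i → (2 * M + suc (2 * i)) * (M′ + suc i) ≡ (2 * (M * M′) + (M + M′) * suc (2 * i) + suc (2 * i) * suc i) + M
  lem₁ = solve-∀
  lem₂ : ∀ M M′ i → (2 * M′ + suc (2 * i)) * (M + suc i) ≡ (2 * (M * M′) + (M + M′) * suc (2 * i) + suc (2 * i) * suc i) + M′
  lem₂ = solve-∀
  termwise : ∀ i → (2 * M + suc (2 * i)) * (M′ + suc i) ≤ (2 * M′ + suc (2 * i)) * (M + suc i)
  termwise i = subst₂ _≤_ (sym (lem₁ M M′ i)) (sym (lem₂ M M′ i)) (+-monoʳ-≤ _ M≤M′)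

odds≤rising : ∀ M m → odds M m ≤ 2 ^ m * rising M m
odds≤rising M m = ≤-trans (∏-mono m (λ i _ → le i)) (≤-reflexive (trans (∏-* m (λ _ → 2) (λ i → M + suc i)) (cong (_* rising M m) (∏-const m 2))))
  where
  lem : ∀ M i → suc (2 * M + suc (2 * i)) ≡ 2 * (M + suc i)
  lem = solve-∀
  le : ∀ i → 2 * M + suc (2 * i) ≤ 2 * (M + suc i)
  le i = ≤-trans (n≤1+n _) (≤-reflexive (lem M i))

-- Strictness comes from the last factor; without any factor both sides would be 1, hence the
-- successor.
odds<rising : ∀ M m → odds M (suc m) < 2 ^ suc m * rising M (suc m)
odds<rising M m = begin-strict
  (2 * M + suc (2 * m)) * odds M m                <⟨ *-monoˡ-< (odds M m) {{>-nonZero (odds-pos M m)}} (n<1+n (2 * M + suc (2 * m))) ⟩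
  suc (2 * M + suc (2 * m)) * odds M m            ≤⟨ *-monoʳ-≤ (suc (2 * M + suc (2 * m))) (odds≤rising M m) ⟩
  suc (2 * M + suc (2 * m)) * (2 ^ m * rising M m)  ≡⟨ lem M m (2 ^ m) (rising M m) ⟩
  2 * 2 ^ m * ((M + suc m) * rising M m)          ∎
  where
  open ≤-Reasoning
  lem : ∀ M m a b → suc (2 * M + suc (2 * m)) * (a * b) ≡ 2 * a * ((M + suc m) * b)
  lem = solve-∀

R≺R∞ : ∀ m M → R (suc m) M ≺ R∞ (suc m)
R≺R∞ m M = begin-strict
  odds M k * k ! * odds 0 k               ≡⟨ *-assoc (odds M k) (k !) (odds 0 k) ⟩
  odds M k * (k ! * odds 0 k)             <⟨ *-monoˡ-< (k ! * odds 0 k) {{m*n≢0 (k !) (odds 0 k) {{k !≢0}} {{>-nonZero (odds-pos 0 k)}}}} (odds<rising M m) ⟩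
  2 ^ k * rising M k * (k ! * odds 0 k)   ≡⟨ lem (2 ^ k) (rising M k) (k !) (odds 0 k) ⟩
  2 ^ k * k ! * (rising M k * odds 0 k)   ∎
  where
  open ≤-Reasoning
  k = suc m
  lem : ∀ a b c d → a * b * (c * d) ≡ a * c * (b * d)
  lem = solve-∀

-- Each factor (2 b + i) / (b + i) equals 2 - i / (b + i).
F-mono : ∀ x {b c} → b ≤ c → F x b ≼ F x c
F-mono x {b} {c} b≤c = ∏-cross x (λ i _ → subst₂ _≤_ (sym (lem₁ b c i)) (sym (lem₂ b c i))
    (+-monoʳ-≤ (2 * (b * c) + (b + c) * suc i + suc i * suc i) (*-monoˡ-≤ (suc i) b≤c)))
  where
  lem₁ : ∀ b c i → (2 * b + suc i) * (c + suc i) ≡ (2 * (b * c) + (b + c) * suc i + suc i * suc i) + b * suc i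
  lem₁ = solve-∀
  lem₂ : ∀ b c i → (2 * c + suc i) * (b + suc i) ≡ (2 * (b * c) + (b + c) * suc i + suc i * suc i) + c * suc i
  lem₂ = solve-∀

F≼F∞ : ∀ x b → F x b ≼ F∞ x
F≼F∞ x b = ≤-trans (≤-reflexive (*-identityʳ _)) (≤-trans (∏-mono x (λ i _ → le i))
    (≤-reflexive (trans (∏-* x (λ _ → 2) (λ i → b + suc i)) (cong (_* rising b x) (∏-const x 2)))))
  where
  lem : ∀ b i → 2 * b + suc i + suc i ≡ 2 * (b + suc i)
  lem = solve-∀
  le : ∀ i → 2 * b + suc i ≤ 2 * (b + suc i)
  le i = ≤-trans (m≤m+n _ (suc i)) (≤-reflexive (lem b i))

F-step : ∀ x b → 0 < b → F x b ≺ F (suc x) b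
F-step x b 0<b = begin-strict
  u * ((b + suc x) * v)        ≡⟨ lem u v (b + suc x) ⟩
  (b + suc x) * (u * v)        <⟨ *-monoˡ-< (u * v) {{>-nonZero (*-mono-≤ (rising-pos (2 * b) x) (rising-pos b x))}} (+-monoˡ-< (suc x) (m<m+n b (≤-trans 0<b (m≤m+n b 0)))) ⟩
  (2 * b + suc x) * (u * v)    ≡⟨ *-assoc (2 * b + suc x) u v ⟨
  (2 * b + suc x) * u * v      ∎
  where
  open ≤-Reasoning
  u = rising (2 * b) x
  v = rising b x
  lem : ∀ u v w → u * (w * v) ≡ w * (u * v)
  lem = solve-∀

F-strict : ∀ x d b → 0 < b → F x b ≺ F (suc (d + x)) b
F-strict x zero b 0<b = F-step x b 0<b
F-strict x (suc d) b 0<b = ≼-≺-trans (F x b) (F (suc (d + x)) b) (F (suc (suc (d + x))) b) (<⇒≤ (F-strict x d b 0<b)) (F-step (suc (d + x)) b 0<b)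

F-< : ∀ {x y} b → 0 < b → x < y → F x b ≺ F y b
F-< {x} {y} b 0<b x<y = subst (λ y → F x b ≺ F y b) (trans (sym (+-suc (y ∸ suc x) x)) (m∸n+n≡m x<y)) (F-strict x (y ∸ suc x) b 0<b)

F-≤ : ∀ {x y} b → 0 < b → x ≤ y → F x b ≼ F y b
F-≤ b 0<b x≤y with m≤n⇒m<n∨m≡n x≤y
... | inj₁ x<y  = <⇒≤ (F-< b 0<b x<y)
... | inj₂ refl = ≤-refl

equation : ∀ a b x → ((2 * (a + b)) C (a + b)) ≡ ((2 * a) C a) * ((x + 2 * b) C b) →
           odds 0 (a + b) * (a ! * b !) * rising b x ≡ (a + b) ! * (odds 0 a * odds 0 b) * rising (2 * b) x
equation a b x eq = *-cancelˡ-≡ _ _ (2 ^ k) {{m^n≢0 2 k}} (begin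
  2 ^ k * (odds 0 k * (a ! * b !) * rising b x)               ≡⟨ lem₁ (2 ^ k) (odds 0 k) (a !) (b !) (rising b x) ⟩
  2 ^ k * odds 0 k * (a ! * b ! * rising b x)                 ≡⟨ cong (_* (a ! * b ! * rising b x)) (C-central k) ⟨
  ((2 * k) C k) * k ! * (a ! * b ! * rising b x)              ≡⟨ cong (λ z → z * k ! * (a ! * b ! * rising b x)) eq ⟩
  c₁ * c₂ * k ! * (a ! * b ! * rising b x)                    ≡⟨ lem₂ c₁ c₂ (k !) (a !) (b !) (rising b x) ⟩
  k ! * (c₁ * a !) * (c₂ * b ! * rising b x)                  ≡⟨ cong₂ (λ u v → k ! * u * v) (C-central a) (C-shifted x b) ⟩
  k ! * (2 ^ a * odds 0 a) * (2 ^ b * odds 0 b * rising (2 * b) x)  ≡⟨ lem₃ (k !) (2 ^ a) (odds 0 a) (2 ^ b) (odds 0 b) (rising (2 * b) x) ⟩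
  2 ^ a * 2 ^ b * (k ! * (odds 0 a * odds 0 b) * rising (2 * b) x)  ≡⟨ cong (_* (k ! * (odds 0 a * odds 0 b) * rising (2 * b) x)) (^-distribˡ-+-* 2 a b) ⟨
  2 ^ k * (k ! * (odds 0 a * odds 0 b) * rising (2 * b) x)    ∎)
  where
  open ≡-Reasoning
  k = a + b
  c₁ = (2 * a) C a
  c₂ = (x + 2 * b) C b
  lem₁ : ∀ p o f g r → p * (o * (f * g) * r) ≡ p * o * (f * g * r)
  lem₁ = solve-∀
  lem₂ : ∀ c d k f g r → c * d * k * (f * g * r) ≡ k * (c * f) * (d * g * r)
  lem₂ = solve-∀
  lem₃ : ∀ k p o q s r → k * (p * o) * (q * s * r) ≡ p * q * (k * (o * s) * r)
  lem₃ = solve-∀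

-- The index `b` of F is independent of `m` and `M`, so the equation can be read with either of a
-- and b in the role of the smaller number.
equation-R : ∀ m M b x → odds 0 (M + m) * (M ! * m !) * rising b x ≡ (M + m) ! * (odds 0 M * odds 0 m) * rising (2 * b) x →
             R m M ≈ F x b
equation-R m M b x eq = *-cancelˡ-≡ _ _ (odds 0 M * M !) {{m*n≢0 (odds 0 M) (M !) {{>-nonZero (odds-pos 0 M)}} {{M !≢0}}}} (begin
  odds 0 M * M ! * (odds M m * m ! * rising b x)                            ≡⟨ lem₁ (odds 0 M) (M !) (odds M m) (m !) (rising b x) ⟩
  odds 0 M * odds M m * (M ! * m !) * rising b x                            ≡⟨ cong (λ z → z * (M ! * m !) * rising b x) (odds-+ M m) ⟨
  odds 0 (M + m) * (M ! * m !) * rising b x                                 ≡⟨ eq ⟩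
  (M + m) ! * (odds 0 M * odds 0 m) * rising (2 * b) x                      ≡⟨ cong (λ z → z * (odds 0 M * odds 0 m) * rising (2 * b) x) (!-rising M m) ⟩
  M ! * rising M m * (odds 0 M * odds 0 m) * rising (2 * b) x               ≡⟨ lem₂ (M !) (rising M m) (odds 0 M) (odds 0 m) (rising (2 * b) x) ⟩
  odds 0 M * M ! * (rising (2 * b) x * (rising M m * odds 0 m))             ∎)
  where
  open ≡-Reasoning
  lem₁ : ∀ o f p g r → o * f * (p * g * r) ≡ o * p * (f * g) * r
  lem₁ = solve-∀
  lem₂ : ∀ f s o p r → f * s * (o * p) * r ≡ o * f * (r * (s * p))
  lem₂ = solve-∀

-- Small m

-- A certificate splits the range l ≤ M into intervals; on the interval from l to u (or from l on),
-- the ratio R m M lies strictly between the values of F at y and at y + 1.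
data Certificate : Set where
  stop : ℕ → Certificate
  step : ℕ → ℕ → Certificate → Certificate

-- R and F are nondecreasing in M, so an interval is settled at its ends: F for y at the right
-- against R at the left, and R at the right against F for y + 1 at the left. On an unbounded
-- interval limits replace the right end; equality is then allowed in the second test because R
-- stays below its limit. F is a parameter so that one checker serves b = m, where it is constant in
-- M, and b = M.
separates : (ℕ → Ratio) → Ratio → (ℕ → ℕ → Ratio) → (ℕ → Ratio) → ℕ → Certificate → Bool
separates R R∞ F F∞ l (stop y)     = (F∞ y ≺ᵇ R l) ∧ (R∞ ≼ᵇ F (suc y) l)
separates R R∞ F F∞ l (step u y c) = (F y u ≺ᵇ R l) ∧ (R u ≺ᵇ F (suc y) l) ∧ separates R R∞ F F∞ (suc u) c

∧-true : ∀ p {q} → p ∧ q ≡ true → p ≡ true × q ≡ true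
∧-true true {true} refl = refl , refl

module _ (R : ℕ → Ratio) (R∞ : Ratio) (F : ℕ → ℕ → Ratio) (F∞ : ℕ → Ratio)
         (R-mono : ∀ {M M′} → M ≤ M′ → R M ≼ R M′) (R≺R∞ : ∀ M → R M ≺ R∞)
         (F-monoˡ : ∀ {x y} M → 0 < M → x ≤ y → F x M ≼ F y M)
         (F-monoʳ : ∀ x {M M′} → M ≤ M′ → F x M ≼ F x M′) (F≼F∞ : ∀ x M → F x M ≼ F∞ x) where

  separates-sound : ∀ l c → separates R R∞ F F∞ l c ≡ true → 0 < l → ∀ M x → l ≤ M → ¬ R M ≈ F x M
  separates-sound l (stop y) ok 0<l M x l≤M with ∧-true (F∞ y ≺ᵇ R l) ok | ≤-<-connex x y
  ... | lower , _ | inj₁ x≤y = λ eq → ≺⇒≉ (F x M) (R M)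
    (≼-≺-trans (F x M) (F y M) (R M) (F-monoˡ M (≤-trans 0<l l≤M) x≤y)
      (≼-≺-trans (F y M) (F∞ y) (R M) (F≼F∞ y M)
        (≺-≼-trans (F∞ y) (R l) (R M) (≺ᵇ⇒≺ (F∞ y) (R l) lower) (R-mono l≤M)))) (sym eq)
  ... | _ , upper | inj₂ y<x = ≺⇒≉ (R M) (F x M)
    (≺-≼-trans (R M) R∞ (F x M) (R≺R∞ M)
      (≼-trans R∞ (F (suc y) l) (F x M) (≼ᵇ⇒≼ R∞ (F (suc y) l) upper)
        (≼-trans (F (suc y) l) (F (suc y) M) (F x M) (F-monoʳ (suc y) l≤M) (F-monoˡ M (≤-trans 0<l l≤M) y<x))))
  separates-sound l (step u y c) ok 0<l M x l≤M with ∧-true (F y u ≺ᵇ R l) ok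
  ... | lower , ok′ with ∧-true (R u ≺ᵇ F (suc y) l) ok′ | ≤-<-connex M u | ≤-<-connex x y
  ...   | _ , rest  | inj₂ u<M | _ = separates-sound (suc u) c rest (s≤s z≤n) M x u<M
  ...   | _ , _     | inj₁ M≤u | inj₁ x≤y = λ eq → ≺⇒≉ (F x M) (R M)
    (≼-≺-trans (F x M) (F y M) (R M) (F-monoˡ M (≤-trans 0<l l≤M) x≤y)
      (≼-≺-trans (F y M) (F y u) (R M) (F-monoʳ y M≤u)
        (≺-≼-trans (F y u) (R l) (R M) (≺ᵇ⇒≺ (F y u) (R l) lower) (R-mono l≤M)))) (sym eq)
  ...   | upper , _ | inj₁ M≤u | inj₂ y<x = ≺⇒≉ (R M) (F x M)
    (≼-≺-trans (R M) (R u) (F x M) (R-mono M≤u)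
      (≺-≼-trans (R u) (F (suc y) l) (F x M) (≺ᵇ⇒≺ (R u) (F (suc y) l) upper)
        (≼-trans (F (suc y) l) (F (suc y) M) (F x M) (F-monoʳ (suc y) l≤M) (F-monoˡ M (≤-trans 0<l l≤M) y<x))))

separates-b : ℕ → ℕ → Certificate → Bool
separates-b m l c = separates (R m) (R∞ m) (λ x _ → F x m) (λ x → F x m) l c

separates-a : ℕ → Certificate → Bool
separates-a m c = separates (R m) (R∞ m) F F∞ m c

separates-b-sound : ∀ m l c → separates-b (suc m) l c ≡ true → 0 < l → ∀ M x → l ≤ M → ¬ R (suc m) M ≈ F x (suc m)
separates-b-sound m l c = separates-sound (R (suc m)) (R∞ (suc m)) (λ x _ → F x (suc m)) (λ x → F x (suc m))
  (R-mono (suc m)) (R≺R∞ m) (λ _ _ → F-≤ (suc m) z<s) (λ _ _ → ≤-refl) (λ _ _ → ≤-refl) l c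

separates-a-sound : ∀ m c → separates-a (suc m) c ≡ true → ∀ M x → suc m ≤ M → ¬ R (suc m) M ≈ F x M
separates-a-sound m c ok = separates-sound (R (suc m)) (R∞ (suc m)) F F∞
  (R-mono (suc m)) (R≺R∞ m) F-≤ F-mono F≼F∞ (suc m) c ok z<s

-- An entry consists of the number of consecutive m it serves, the certificate for b = m and the
-- certificate for a = m.
Table : Set
Table = List (ℕ × Certificate × Certificate)

checkRun : ℕ → ℕ → Certificate → Certificate → Bool
checkRun zero    m cb ca = true
checkRun (suc n) m cb ca = separates-b m m cb ∧ separates-a m ca ∧ checkRun n (suc m) cb ca

check : ℕ → Table → Bool
check m []                   = true
check m ((n , cb , ca) ∷ t) = checkRun n m cb ca ∧ check (n + m) t

end : ℕ → Table → ℕ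
end m []                 = m
end m ((n , _ , _) ∷ t) = end (n + m) t

NoSolution : ℕ → Set
NoSolution m = (∀ M x → m ≤ M → ¬ R m M ≈ F x m) × (∀ M x → m ≤ M → ¬ R m M ≈ F x M)

checkRun-sound : ∀ n s cb ca → 0 < s → checkRun n s cb ca ≡ true → ∀ {m} → s ≤ m → m < n + s → NoSolution m
checkRun-sound zero s cb ca 0<s ok s≤m m<s = ⊥-elim (<⇒≱ m<s s≤m)
checkRun-sound (suc n) (suc s) cb ca 0<s ok {m} s≤m m< with ∧-true (separates-b (suc s) (suc s) cb) ok
... | okb , ok′ with ∧-true (separates-a (suc s) ca) ok′ | m≤n⇒m<n∨m≡n s≤m
...   | oka , _    | inj₂ refl = separates-b-sound s (suc s) cb okb z<s , separates-a-sound s ca oka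
...   | _   , rest | inj₁ s<m  = checkRun-sound n (suc (suc s)) cb ca z<s rest s<m (≤-trans m< (≤-reflexive (sym (+-suc n (suc s)))))

check-sound : ∀ s t → 0 < s → check s t ≡ true → ∀ {m} → s ≤ m → m < end s t → NoSolution m
check-sound s [] 0<s ok s≤m m< = ⊥-elim (<⇒≱ m< s≤m)
check-sound s ((n , cb , ca) ∷ t) 0<s ok {m} s≤m m< with ∧-true (checkRun n s cb ca) ok | <-≤-connex m (n + s)
... | okrun , _ | inj₁ m<n+s = checkRun-sound n s cb ca 0<s okrun s≤m m<n+s
... | _ , rest  | inj₂ n+s≤m = check-sound (n + s) t (≤-trans 0<s (m≤n+m s n)) rest n+s≤m m<

-- As M runs from m to infinity, R rises from about √(pi m / 2) to about √(pi m). The long runs with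
-- `stop` alone belong to those m for which this range stays clear of powers of 2; the long
-- certificates trace how R crosses a value of F near such a power.
table : Table
table =
  (1 , (step 14 1 (stop 2)) , (step 14 1 (stop 1))) ∷
  (1 , (step 9 1 (stop 2)) , (step 9 1 (stop 1))) ∷
  (1 , (step 7 1 (stop 2)) , (step 7 1 (step 25 1 (stop 1)))) ∷
  (1 , (step 7 1 (stop 2)) , (step 7 1 (step 11 1 (step 16 1 (step 22 1 (step 29 1 (step 36 1 (step 42 1 (step 47 1 (step 51 1 (step 54 1 (step 56 1 (step 57 1 (step 58 1 (step 59 2 (step 60 2 (step 62 2 (step 66 2 (step 73 2 (step 87 2 (step 125 2 (step 407 2 (stop 2))))))))))))))))))))))) ∷
  (1 , (step 6 1 (stop 2)) , (step 6 1 (step 7 1 (step 8 1 (step 9 1 (step 10 2 (step 12 2 (step 16 2 (step 31 2 (stop 2)))))))))) ∷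
  (2 , (stop 2) , (step 8 2 (step 13 2 (step 64 2 (stop 2))))) ∷
  (5 , (stop 2) , (step 35 2 (stop 2))) ∷
  (1 , (step 566 2 (stop 3)) , (step 35 2 (stop 2))) ∷
  (1 , (step 208 2 (stop 3)) , (step 35 2 (stop 2))) ∷
  (1 , (step 134 2 (stop 3)) , (step 35 2 (stop 2))) ∷
  (1 , (step 101 2 (stop 3)) , (step 35 2 (stop 2))) ∷
  (1 , (step 83 2 (stop 3)) , (step 83 2 (stop 2))) ∷
  (1 , (step 72 2 (stop 3)) , (step 72 2 (step 791 2 (stop 2)))) ∷
  (1 , (step 64 2 (stop 3)) , (step 64 2 (step 228 2 (step 985 2 (step 131405 2 (stop 2)))))) ∷
  (1 , (step 58 2 (stop 3)) , (step 58 2 (step 138 2 (step 236 2 (step 300 2 (step 327 2 (step 336 2 (step 339 2 (step 340 2 (step 342 3 (step 348 3 (step 370 3 (step 468 3 (step 3979 3 (stop 3))))))))))))))) ∷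
  (1 , (step 53 2 (stop 3)) , (step 53 2 (step 101 2 (step 139 2 (step 157 2 (step 163 2 (step 165 2 (step 166 2 (step 168 3 (step 174 3 (step 198 3 (step 362 3 (stop 3))))))))))))) ∷
  (1 , (step 50 2 (stop 3)) , (step 50 2 (step 82 2 (step 101 2 (step 109 2 (step 112 2 (step 113 2 (step 115 3 (step 122 3 (step 152 3 (step 785 3 (stop 3)))))))))))) ∷
  (1 , (step 47 2 (stop 3)) , (step 47 2 (step 69 2 (step 81 2 (step 85 2 (step 87 2 (step 88 3 (step 92 3 (step 107 3 (step 229 3 (stop 3))))))))))) ∷
  (1 , (step 45 2 (stop 3)) , (step 45 2 (step 61 2 (step 68 2 (step 71 2 (step 72 2 (step 74 3 (step 81 3 (step 116 3 (stop 3)))))))))) ∷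
  (1 , (step 43 2 (stop 3)) , (step 43 2 (step 55 2 (step 60 2 (step 61 2 (step 62 2 (step 64 3 (step 71 3 (step 109 3 (stop 3)))))))))) ∷
  (1 , (step 41 2 (stop 3)) , (step 41 2 (step 50 2 (step 53 2 (step 54 2 (step 55 2 (step 57 3 (step 64 3 (step 106 3 (stop 3)))))))))) ∷
  (1 , (step 39 2 (stop 3)) , (step 39 2 (step 46 2 (step 49 2 (step 50 3 (step 53 3 (step 65 3 (step 233 3 (stop 3))))))))) ∷
  (1 , (step 38 2 (stop 3)) , (step 38 2 (step 43 2 (step 45 2 (step 46 3 (step 49 3 (step 62 3 (step 381 3 (stop 3))))))))) ∷
  (1 , (step 37 2 (stop 3)) , (step 37 2 (step 41 2 (step 42 2 (step 43 3 (step 47 3 (step 66 3 (stop 3)))))))) ∷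
  (1 , (step 36 2 (stop 3)) , (step 36 2 (step 38 2 (step 39 2 (step 40 3 (step 43 3 (step 56 3 (step 1237 3 (stop 3))))))))) ∷
  (1 , (step 35 2 (stop 3)) , (step 35 2 (step 37 2 (step 38 3 (step 42 3 (step 61 3 (stop 3))))))) ∷
  (1 , (step 34 2 (stop 3)) , (step 34 2 (step 35 2 (step 36 3 (step 39 3 (step 53 3 (stop 3))))))) ∷
  (1 , (step 34 2 (stop 3)) , (step 34 2 (step 36 3 (step 44 3 (step 145 3 (stop 3)))))) ∷
  (6 , (stop 3) , (step 40 3 (step 89 3 (stop 3)))) ∷
  (30 , (stop 3) , (stop 3)) ∷
  (1 , (step 30944 3 (stop 4)) , (step 30944 3 (stop 3))) ∷
  (1 , (step 4967 3 (stop 4)) , (step 4967 3 (stop 3))) ∷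
  (1 , (step 2734 3 (stop 4)) , (step 2734 3 (stop 3))) ∷
  (1 , (step 1902 3 (stop 4)) , (step 1902 3 (stop 3))) ∷
  (1 , (step 1467 3 (stop 4)) , (step 1467 3 (stop 3))) ∷
  (1 , (step 1200 3 (stop 4)) , (step 1200 3 (stop 3))) ∷
  (1 , (step 1019 3 (stop 4)) , (step 1019 3 (stop 3))) ∷
  (1 , (step 888 3 (stop 4)) , (step 888 3 (stop 3))) ∷
  (1 , (step 790 3 (stop 4)) , (step 790 3 (stop 3))) ∷
  (1 , (step 713 3 (stop 4)) , (step 713 3 (stop 3))) ∷
  (1 , (step 651 3 (stop 4)) , (step 651 3 (step 6506 3 (stop 3)))) ∷
  (1 , (step 600 3 (stop 4)) , (step 600 3 (step 3125 3 (step 6509 3 (step 7512 3 (step 7657 3 (step 7675 3 (step 7678 3 (step 7683 4 (step 7724 4 (step 8074 4 (step 12772 4 (stop 4))))))))))))) ∷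
  (1 , (step 557 3 (stop 4)) , (step 557 3 (step 2072 3 (step 3123 3 (step 3331 3 (step 3359 3 (step 3362 3 (step 3363 3 (step 3368 4 (step 3409 4 (step 3782 4 (step 33720 4 (stop 4))))))))))))) ∷
  (1 , (step 521 3 (stop 4)) , (step 521 3 (step 1560 3 (step 2071 3 (step 2158 3 (step 2170 3 (step 2171 3 (step 2173 4 (step 2190 4 (step 2338 4 (step 5168 4 (stop 4)))))))))))) ∷
  (1 , (step 490 3 (stop 4)) , (step 490 3 (step 1257 3 (step 1558 3 (step 1606 3 (step 1612 3 (step 1613 3 (step 1618 4 (step 1659 4 (step 2087 4 (stop 4))))))))))) ∷
  (1 , (step 463 3 (stop 4)) , (step 463 3 (step 1056 3 (step 1255 3 (step 1285 3 (step 1289 3 (step 1293 4 (step 1326 4 (step 1671 4 (stop 4)))))))))) ∷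
  (1 , (step 439 3 (stop 4)) , (step 439 3 (step 913 3 (step 1054 3 (step 1075 3 (step 1077 3 (step 1078 3 (step 1085 4 (step 1145 4 (step 2071 4 (stop 4))))))))))) ∷
  (1 , (step 418 3 (stop 4)) , (step 418 3 (step 807 3 (step 912 3 (step 927 3 (step 929 3 (step 936 4 (step 996 4 (step 2066 4 (stop 4)))))))))) ∷
  (1 , (step 400 3 (stop 4)) , (step 400 3 (step 724 3 (step 805 3 (step 816 3 (step 818 3 (step 821 4 (step 847 4 (step 1137 4 (stop 4)))))))))) ∷
  (1 , (step 383 3 (stop 4)) , (step 383 3 (step 658 3 (step 723 3 (step 732 3 (step 733 3 (step 739 4 (step 791 4 (step 1829 4 (stop 4)))))))))) ∷
  (1 , (step 368 3 (stop 4)) , (step 368 3 (step 604 3 (step 657 3 (step 664 3 (step 665 3 (step 670 4 (step 713 4 (step 1476 4 (stop 4)))))))))) ∷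
  (1 , (step 355 3 (stop 4)) , (step 355 3 (step 560 3 (step 603 3 (step 609 3 (step 610 3 (step 617 4 (step 679 4 (step 3582 4 (stop 4)))))))))) ∷
  (1 , (step 342 3 (stop 4)) , (step 342 3 (step 522 3 (step 558 3 (step 563 3 (step 564 3 (step 569 4 (step 613 4 (step 1625 4 (stop 4)))))))))) ∷
  (1 , (step 331 3 (stop 4)) , (step 331 3 (step 489 3 (step 520 3 (step 525 3 (step 528 4 (step 553 4 (step 894 4 (stop 4))))))))) ∷
  (1 , (step 321 3 (stop 4)) , (step 321 3 (step 462 3 (step 488 3 (step 492 3 (step 495 4 (step 521 4 (step 901 4 (stop 4))))))))) ∷
  (1 , (step 311 3 (stop 4)) , (step 311 3 (step 437 3 (step 460 3 (step 463 3 (step 464 3 (step 471 4 (step 536 4 (stop 4))))))))) ∷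
  (1 , (step 302 3 (stop 4)) , (step 302 3 (step 415 3 (step 436 3 (step 438 3 (step 439 3 (step 446 4 (step 511 4 (stop 4))))))))) ∷
  (1 , (step 294 3 (stop 4)) , (step 294 3 (step 396 3 (step 414 3 (step 416 3 (step 417 3 (step 424 4 (step 490 4 (stop 4))))))))) ∷
  (1 , (step 287 3 (stop 4)) , (step 287 3 (step 379 3 (step 395 3 (step 397 3 (step 400 4 (step 426 4 (step 889 4 (stop 4))))))))) ∷
  (1 , (step 280 3 (stop 4)) , (step 280 3 (step 364 3 (step 378 3 (step 380 3 (step 386 4 (step 442 4 (stop 4)))))))) ∷
  (1 , (step 273 3 (stop 4)) , (step 273 3 (step 350 3 (step 362 3 (step 364 3 (step 368 4 (step 403 4 (step 1700 4 (stop 4))))))))) ∷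
  (1 , (step 267 3 (stop 4)) , (step 267 3 (step 337 3 (step 348 3 (step 350 3 (step 355 4 (step 400 4 (stop 4)))))))) ∷
  (1 , (step 261 3 (stop 4)) , (step 261 3 (step 325 3 (step 336 3 (step 337 3 (step 341 4 (step 376 4 (step 2129 4 (stop 4))))))))) ∷
  (1 , (step 256 3 (stop 4)) , (step 256 3 (step 315 3 (step 324 3 (step 325 3 (step 327 4 (step 343 4 (step 564 4 (stop 4))))))))) ∷
  (1 , (step 251 3 (stop 4)) , (step 251 3 (step 305 3 (step 313 3 (step 314 3 (step 315 3 (step 322 4 (step 391 4 (stop 4))))))))) ∷
  (1 , (step 246 3 (stop 4)) , (step 246 3 (step 296 3 (step 304 3 (step 305 3 (step 311 4 (step 369 4 (stop 4)))))))) ∷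
  (1 , (step 241 3 (stop 4)) , (step 241 3 (step 288 3 (step 295 3 (step 296 3 (step 303 4 (step 373 4 (stop 4)))))))) ∷
  (1 , (step 237 3 (stop 4)) , (step 237 3 (step 280 3 (step 286 3 (step 287 3 (step 289 4 (step 306 4 (step 578 4 (stop 4))))))))) ∷
  (1 , (step 233 3 (stop 4)) , (step 233 3 (step 273 3 (step 279 3 (step 280 4 (step 288 4 (step 373 4 (stop 4)))))))) ∷
  (1 , (step 229 3 (stop 4)) , (step 229 3 (step 266 3 (step 271 3 (step 272 3 (step 275 4 (step 301 4 (step 1236 4 (stop 4))))))))) ∷
  (1 , (step 225 3 (stop 4)) , (step 225 3 (step 260 3 (step 265 3 (step 267 4 (step 283 4 (step 543 4 (stop 4)))))))) ∷
  (1 , (step 222 3 (stop 4)) , (step 222 3 (step 254 3 (step 258 3 (step 259 3 (step 263 4 (step 300 4 (stop 4)))))))) ∷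
  (1 , (step 218 3 (stop 4)) , (step 218 3 (step 248 3 (step 252 3 (step 253 3 (step 257 4 (step 293 4 (stop 4)))))))) ∷
  (1 , (step 215 3 (stop 4)) , (step 215 3 (step 243 3 (step 247 3 (step 248 4 (step 256 4 (step 343 4 (stop 4)))))))) ∷
  (1 , (step 212 3 (stop 4)) , (step 212 3 (step 238 3 (step 242 3 (step 244 4 (step 261 4 (step 587 4 (stop 4)))))))) ∷
  (1 , (step 209 3 (stop 4)) , (step 209 3 (step 233 3 (step 237 3 (step 239 4 (step 256 4 (step 589 4 (stop 4)))))))) ∷
  (1 , (step 206 3 (stop 4)) , (step 206 3 (step 229 3 (step 232 3 (step 233 3 (step 240 4 (step 314 4 (stop 4)))))))) ∷
  (1 , (step 204 3 (stop 4)) , (step 204 3 (step 225 3 (step 228 3 (step 230 4 (step 248 4 (step 654 4 (stop 4)))))))) ∷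
  (1 , (step 201 3 (stop 4)) , (step 201 3 (step 221 3 (step 224 3 (step 228 4 (step 265 4 (stop 4))))))) ∷
  (1 , (step 199 3 (stop 4)) , (step 199 3 (step 217 3 (step 220 3 (step 224 4 (step 261 4 (stop 4))))))) ∷
  (1 , (step 196 3 (stop 4)) , (step 196 3 (step 214 3 (step 216 3 (step 218 4 (step 235 4 (step 617 4 (stop 4)))))))) ∷
  (1 , (step 194 3 (stop 4)) , (step 194 3 (step 210 3 (step 212 3 (step 213 3 (step 219 4 (step 282 4 (stop 4)))))))) ∷
  (1 , (step 192 3 (stop 4)) , (step 192 3 (step 207 3 (step 209 3 (step 211 4 (step 228 4 (step 632 4 (stop 4)))))))) ∷
  (1 , (step 190 3 (stop 4)) , (step 190 3 (step 204 3 (step 206 3 (step 210 4 (step 247 4 (stop 4))))))) ∷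
  (1 , (step 188 3 (stop 4)) , (step 188 3 (step 201 3 (step 203 3 (step 207 4 (step 245 4 (stop 4))))))) ∷
  (1 , (step 186 3 (stop 4)) , (step 186 3 (step 198 3 (step 200 3 (step 204 4 (step 242 4 (stop 4))))))) ∷
  (1 , (step 184 3 (stop 4)) , (step 184 3 (step 195 3 (step 197 3 (step 200 4 (step 227 4 (stop 4))))))) ∷
  (1 , (step 182 3 (stop 4)) , (step 182 3 (step 193 3 (step 194 3 (step 195 4 (step 203 4 (step 300 4 (stop 4)))))))) ∷
  (1 , (step 181 3 (stop 4)) , (step 181 3 (step 190 3 (step 192 3 (step 197 4 (step 248 4 (stop 4))))))) ∷
  (1 , (step 179 3 (stop 4)) , (step 179 3 (step 188 3 (step 189 3 (step 190 4 (step 199 4 (step 317 4 (stop 4)))))))) ∷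
  (1 , (step 177 3 (stop 4)) , (step 177 3 (step 186 3 (step 187 3 (step 191 4 (step 230 4 (stop 4))))))) ∷
  (1 , (step 176 3 (stop 4)) , (step 176 3 (step 184 3 (step 185 3 (step 191 4 (step 257 4 (stop 4))))))) ∷
  (1 , (step 174 3 (stop 4)) , (step 174 3 (step 181 3 (step 182 3 (step 183 4 (step 191 4 (step 291 4 (stop 4)))))))) ∷
  (1 , (step 173 3 (stop 4)) , (step 173 3 (step 179 3 (step 180 3 (step 182 4 (step 199 4 (step 763 4 (stop 4)))))))) ∷
  (1 , (step 171 3 (stop 4)) , (step 171 3 (step 177 3 (step 178 3 (step 180 4 (step 197 4 (step 786 4 (stop 4)))))))) ∷
  (1 , (step 170 3 (stop 4)) , (step 170 3 (step 176 3 (step 178 4 (step 195 4 (step 800 4 (stop 4))))))) ∷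
  (1 , (step 168 3 (stop 4)) , (step 168 3 (step 174 3 (step 175 4 (step 183 4 (step 287 4 (stop 4))))))) ∷
  (1 , (step 167 3 (stop 4)) , (step 167 3 (step 172 3 (step 173 3 (step 180 4 (step 264 4 (stop 4))))))) ∷
  (1 , (step 166 3 (stop 4)) , (step 166 3 (step 170 3 (step 171 3 (step 176 4 (step 229 4 (stop 4))))))) ∷
  (1 , (step 165 3 (stop 4)) , (step 165 3 (step 169 3 (step 172 4 (step 200 4 (stop 4)))))) ∷
  (1 , (step 163 3 (stop 4)) , (step 163 3 (step 167 3 (step 168 4 (step 176 4 (step 281 4 (stop 4))))))) ∷
  (1 , (step 162 3 (stop 4)) , (step 162 3 (step 165 3 (step 166 3 (step 171 4 (step 224 4 (stop 4))))))) ∷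
  (1 , (step 161 3 (stop 4)) , (step 161 3 (step 164 3 (step 166 4 (step 183 4 (step 970 4 (stop 4))))))) ∷
  (1 , (step 160 3 (stop 4)) , (step 160 3 (step 163 3 (step 168 4 (step 222 4 (stop 4)))))) ∷
  (1 , (step 159 3 (stop 4)) , (step 159 3 (step 161 3 (step 163 4 (step 180 4 (step 1020 4 (stop 4))))))) ∷
  (1 , (step 158 3 (stop 4)) , (step 158 3 (step 160 3 (step 164 4 (step 204 4 (stop 4)))))) ∷
  (1 , (step 157 3 (stop 4)) , (step 157 3 (step 158 3 (step 159 3 (step 166 4 (step 254 4 (stop 4))))))) ∷
  (1 , (step 156 3 (stop 4)) , (step 156 3 (step 157 3 (step 159 4 (step 177 4 (step 1658 4 (stop 4))))))) ∷
  (1 , (step 155 3 (stop 4)) , (step 155 3 (step 156 3 (step 160 4 (step 200 4 (stop 4)))))) ∷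
  (1 , (step 154 3 (stop 4)) , (step 154 3 (step 155 3 (step 161 4 (step 231 4 (stop 4)))))) ∷
  (1 , (step 153 3 (stop 4)) , (step 153 3 (step 154 3 (step 162 4 (step 272 4 (stop 4)))))) ∷
  (1 , (step 152 3 (stop 4)) , (step 152 3 (step 154 4 (step 171 4 (step 1332 4 (stop 4)))))) ∷
  (10 , (stop 4) , (step 162 4 (step 335 4 (stop 4)))) ∷
  (148 , (stop 4) , (stop 4)) ∷
  (1 , (step 186721 4 (stop 5)) , (step 186721 4 (stop 4))) ∷
  (1 , (step 65945 4 (stop 5)) , (step 65945 4 (stop 4))) ∷
  (1 , (step 40144 4 (stop 5)) , (step 40144 4 (stop 4))) ∷
  (1 , (step 28906 4 (stop 5)) , (step 28906 4 (stop 4))) ∷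
  (1 , (step 22616 4 (stop 5)) , (step 22616 4 (stop 4))) ∷
  (1 , (step 18595 4 (stop 5)) , (step 18595 4 (stop 4))) ∷
  (1 , (step 15802 4 (stop 5)) , (step 15802 4 (stop 4))) ∷
  (1 , (step 13751 4 (stop 5)) , (step 13751 4 (stop 4))) ∷
  (1 , (step 12179 4 (stop 5)) , (step 12179 4 (stop 4))) ∷
  (1 , (step 10937 4 (stop 5)) , (step 10937 4 (stop 4))) ∷
  (1 , (step 9931 4 (stop 5)) , (step 9931 4 (stop 4))) ∷
  (1 , (step 9098 4 (stop 5)) , (step 9098 4 (stop 4))) ∷
  (1 , (step 8399 4 (stop 5)) , (step 8399 4 (stop 4))) ∷
  (1 , (step 7803 4 (stop 5)) , (step 7803 4 (stop 4))) ∷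
  (1 , (step 7289 4 (stop 5)) , (step 7289 4 (stop 4))) ∷
  (1 , (step 6841 4 (stop 5)) , (step 6841 4 (step 104532 4 (step 305703 4 (step 335435 4 (step 336944 4 (step 337014 4 (step 337017 4 (step 337025 5 (step 337199 5 (step 341022 5 (step 452384 5 (stop 5))))))))))))) ∷
  (1 , (step 6447 4 (stop 5)) , (step 6447 4 (step 51674 4 (step 76362 4 (step 78081 4 (step 78162 4 (step 78165 4 (step 78167 5 (step 78211 5 (step 79178 5 (step 108231 5 (stop 5)))))))))))) ∷
  (1 , (step 6098 4 (stop 5)) , (step 6098 4 (step 34390 4 (step 43744 4 (step 44299 4 (step 44325 4 (step 44327 4 (step 44347 5 (step 44785 5 (step 57008 5 (stop 5))))))))))) ∷
  (1 , (step 5787 4 (stop 5)) , (step 5787 4 (step 25810 4 (step 30707 4 (step 30978 4 (step 30991 4 (step 30995 5 (step 31082 5 (step 33099 5 (stop 5)))))))))) ∷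
  (1 , (step 5507 4 (stop 5)) , (step 5507 4 (step 20681 4 (step 23690 4 (step 23850 4 (step 23857 4 (step 23859 5 (step 23903 5 (step 24899 5 (step 260786 5 (stop 5))))))))))) ∷
  (1 , (step 5255 4 (stop 5)) , (step 5255 4 (step 17270 4 (step 19305 4 (step 19410 4 (step 19415 4 (step 19423 5 (step 19598 5 (step 24362 5 (stop 5)))))))))) ∷
  (1 , (step 5026 4 (stop 5)) , (step 5026 4 (step 14837 4 (step 16305 4 (step 16379 4 (step 16383 4 (step 16395 5 (step 16660 5 (step 25661 5 (stop 5)))))))))) ∷
  (1 , (step 4818 4 (stop 5)) , (step 4818 4 (step 13015 4 (step 14123 4 (step 14179 4 (step 14181 4 (step 14184 5 (step 14249 5 (step 15822 5 (stop 5)))))))))) ∷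
  (1 , (step 4627 4 (stop 5)) , (step 4627 4 (step 11599 4 (step 12465 4 (step 12508 4 (step 12510 4 (step 12515 5 (step 12624 5 (step 15566 5 (stop 5)))))))))) ∷
  (1 , (step 4451 4 (stop 5)) , (step 4451 4 (step 10467 4 (step 11163 4 (step 11197 4 (step 11198 4 (step 11199 4 (step 11219 5 (step 11672 5 (step 94257 5 (stop 5))))))))))) ∷
  (1 , (step 4290 4 (stop 5)) , (step 4290 4 (step 9541 4 (step 10112 4 (step 10140 4 (step 10141 4 (step 10142 5 (step 10164 5 (step 10666 5 (stop 5)))))))))) ∷
  (1 , (step 4141 4 (stop 5)) , (step 4141 4 (step 8770 4 (step 9247 4 (step 9270 4 (step 9271 4 (step 9272 5 (step 9293 5 (step 9774 5 (stop 5)))))))))) ∷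
  (1 , (step 4002 4 (stop 5)) , (step 4002 4 (step 8118 4 (step 8522 4 (step 8542 4 (step 8543 4 (step 8555 5 (step 8824 5 (step 27756 5 (stop 5)))))))))) ∷
  (1 , (step 3873 4 (stop 5)) , (step 3873 4 (step 7559 4 (step 7906 4 (step 7923 4 (step 7924 4 (step 7935 5 (step 8182 5 (step 25192 5 (stop 5)))))))))) ∷
  (1 , (step 3753 4 (stop 5)) , (step 3753 4 (step 7075 4 (step 7376 4 (step 7391 4 (step 7392 4 (step 7412 5 (step 7874 5 (stop 5))))))))) ∷
  (1 , (step 3641 4 (stop 5)) , (step 3641 4 (step 6652 4 (step 6915 4 (step 6928 4 (step 6929 4 (step 6946 5 (step 7336 5 (stop 5))))))))) ∷
  (1 , (step 3536 4 (stop 5)) , (step 3536 4 (step 6278 4 (step 6511 4 (step 6522 4 (step 6523 4 (step 6540 5 (step 6932 5 (stop 5))))))))) ∷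
  (1 , (step 3437 4 (stop 5)) , (step 3437 4 (step 5946 4 (step 6153 4 (step 6163 4 (step 6164 4 (step 6184 5 (step 6651 5 (stop 5))))))))) ∷
  (1 , (step 3344 4 (stop 5)) , (step 3344 4 (step 5649 4 (step 5834 4 (step 5843 4 (step 5844 4 (step 5861 5 (step 6255 5 (stop 5))))))))) ∷
  (1 , (step 3257 4 (stop 5)) , (step 3257 4 (step 5382 4 (step 5549 4 (step 5557 4 (step 5568 5 (step 5817 5 (step 193366 5 (stop 5))))))))) ∷
  (1 , (step 3174 4 (stop 5)) , (step 3174 4 (step 5140 4 (step 5291 4 (step 5298 4 (step 5299 4 (step 5319 5 (step 5793 5 (stop 5))))))))) ∷
  (1 , (step 3097 4 (stop 5)) , (step 3097 4 (step 4920 4 (step 5058 4 (step 5064 4 (step 5068 5 (step 5156 5 (step 8267 5 (stop 5))))))))) ∷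
  (1 , (step 3023 4 (stop 5)) , (step 3023 4 (step 4719 4 (step 4845 4 (step 4851 4 (step 4859 5 (step 5039 5 (step 25593 5 (stop 5))))))))) ∷
  (1 , (step 2953 4 (stop 5)) , (step 2953 4 (step 4536 4 (step 4651 4 (step 4656 4 (step 4661 5 (step 4772 5 (step 9865 5 (stop 5))))))))) ∷
  (1 , (step 2886 4 (stop 5)) , (step 2886 4 (step 4366 4 (step 4472 4 (step 4477 4 (step 4479 5 (step 4523 5 (step 5746 5 (stop 5))))))))) ∷
  (1 , (step 2823 4 (stop 5)) , (step 2823 4 (step 4210 4 (step 4308 4 (step 4312 4 (step 4313 4 (step 4330 5 (step 4735 5 (stop 5))))))))) ∷
  (1 , (step 2763 4 (stop 5)) , (step 2763 4 (step 4066 4 (step 4156 4 (step 4160 4 (step 4161 5 (step 4182 5 (step 4696 5 (stop 5))))))))) ∷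
  (1 , (step 2706 4 (stop 5)) , (step 2706 4 (step 3931 4 (step 4015 4 (step 4019 4 (step 4020 5 (step 4042 5 (step 4586 5 (stop 5))))))))) ∷
  (1 , (step 2651 4 (stop 5)) , (step 2651 4 (step 3806 4 (step 3885 4 (step 3888 4 (step 3891 5 (step 3957 5 (step 6256 5 (stop 5))))))))) ∷
  (1 , (step 2599 4 (stop 5)) , (step 2599 4 (step 3690 4 (step 3763 4 (step 3766 4 (step 3772 5 (step 3906 5 (step 16979 5 (stop 5))))))))) ∷
  (1 , (step 2549 4 (stop 5)) , (step 2549 4 (step 3581 4 (step 3649 4 (step 3652 4 (step 3659 5 (step 3817 5 (step 59653 5 (stop 5))))))))) ∷
  (1 , (step 2501 4 (stop 5)) , (step 2501 4 (step 3478 4 (step 3542 4 (step 3545 4 (step 3547 5 (step 3591 5 (step 4910 5 (stop 5))))))))) ∷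
  (1 , (step 2455 4 (stop 5)) , (step 2455 4 (step 3382 4 (step 3442 4 (step 3445 4 (step 3451 5 (step 3586 5 (step 23543 5 (stop 5))))))))) ∷
  (1 , (step 2411 4 (stop 5)) , (step 2411 4 (step 3292 4 (step 3348 4 (step 3351 4 (step 3360 5 (step 3567 5 (stop 5)))))))) ∷
  (1 , (step 2369 4 (stop 5)) , (step 2369 4 (step 3207 4 (step 3260 4 (step 3262 4 (step 3264 5 (step 3308 5 (step 4671 5 (stop 5))))))))) ∷
  (1 , (step 2329 4 (stop 5)) , (step 2329 4 (step 3126 4 (step 3176 4 (step 3179 4 (step 3194 5 (step 3557 5 (stop 5)))))))) ∷
  (1 , (step 2290 4 (stop 5)) , (step 2290 4 (step 3050 4 (step 3097 4 (step 3100 4 (step 3116 5 (step 3507 5 (stop 5)))))))) ∷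
  (1 , (step 2253 4 (stop 5)) , (step 2253 4 (step 2978 4 (step 3023 4 (step 3025 4 (step 3036 5 (step 3296 5 (stop 5)))))))) ∷
  (1 , (step 2217 4 (stop 5)) , (step 2217 4 (step 2909 4 (step 2952 4 (step 2954 4 (step 2963 5 (step 3172 5 (stop 5)))))))) ∷
  (1 , (step 2182 4 (stop 5)) , (step 2182 4 (step 2844 4 (step 2885 4 (step 2887 4 (step 2902 5 (step 3269 5 (stop 5)))))))) ∷
  (1 , (step 2149 4 (stop 5)) , (step 2149 4 (step 2783 4 (step 2821 4 (step 2823 4 (step 2837 5 (step 3177 5 (stop 5)))))))) ∷
  (1 , (step 2116 4 (stop 5)) , (step 2116 4 (step 2724 4 (step 2760 4 (step 2762 4 (step 2772 5 (step 3008 5 (stop 5)))))))) ∷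
  (1 , (step 2085 4 (stop 5)) , (step 2085 4 (step 2667 4 (step 2702 4 (step 2704 4 (step 2714 5 (step 2950 5 (stop 5)))))))) ∷
  (1 , (step 2055 4 (stop 5)) , (step 2055 4 (step 2614 4 (step 2647 4 (step 2649 4 (step 2665 5 (step 3065 5 (stop 5)))))))) ∷
  (1 , (step 2026 4 (stop 5)) , (step 2026 4 (step 2563 4 (step 2594 4 (step 2596 4 (step 2607 5 (step 2871 5 (stop 5)))))))) ∷
  (1 , (step 1998 4 (stop 5)) , (step 1998 4 (step 2514 4 (step 2544 4 (step 2545 4 (step 2546 4 (step 2567 5 (step 3125 5 (stop 5))))))))) ∷
  (1 , (step 1971 4 (stop 5)) , (step 1971 4 (step 2467 4 (step 2496 4 (step 2497 4 (step 2503 5 (step 2640 5 (stop 5)))))))) ∷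
  (1 , (step 1944 4 (stop 5)) , (step 1944 4 (step 2422 4 (step 2450 4 (step 2451 4 (step 2462 5 (step 2727 5 (stop 5)))))))) ∷
  (1 , (step 1919 4 (stop 5)) , (step 1919 4 (step 2379 4 (step 2405 4 (step 2407 4 (step 2425 5 (step 2893 5 (stop 5)))))))) ∷
  (1 , (step 1894 4 (stop 5)) , (step 1894 4 (step 2337 4 (step 2363 4 (step 2364 4 (step 2372 5 (step 2559 5 (stop 5)))))))) ∷
  (1 , (step 1870 4 (stop 5)) , (step 1870 4 (step 2298 4 (step 2322 4 (step 2323 4 (step 2328 5 (step 2441 5 (stop 5)))))))) ∷
  (1 , (step 1847 4 (stop 5)) , (step 1847 4 (step 2259 4 (step 2283 4 (step 2284 4 (step 2294 5 (step 2534 5 (stop 5)))))))) ∷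
  (1 , (step 1825 4 (stop 5)) , (step 1825 4 (step 2223 4 (step 2245 4 (step 2246 4 (step 2251 5 (step 2364 5 (stop 5)))))))) ∷
  (1 , (step 1803 4 (stop 5)) , (step 1803 4 (step 2187 4 (step 2209 4 (step 2210 4 (step 2221 5 (step 2489 5 (stop 5)))))))) ∷
  (1 , (step 1781 4 (stop 5)) , (step 1781 4 (step 2153 4 (step 2174 4 (step 2175 4 (step 2186 5 (step 2455 5 (stop 5)))))))) ∷
  (1 , (step 1761 4 (stop 5)) , (step 1761 4 (step 2120 4 (step 2140 4 (step 2141 4 (step 2147 5 (step 2285 5 (stop 5)))))))) ∷
  (1 , (step 1741 4 (stop 5)) , (step 1741 4 (step 2088 4 (step 2108 4 (step 2109 4 (step 2126 5 (step 2574 5 (stop 5)))))))) ∷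
  (1 , (step 1721 4 (stop 5)) , (step 1721 4 (step 2058 4 (step 2076 4 (step 2077 4 (step 2081 5 (step 2171 5 (step 34029 5 (stop 5))))))))) ∷
  (1 , (step 1702 4 (stop 5)) , (step 1702 4 (step 2028 4 (step 2046 4 (step 2047 4 (step 2057 5 (step 2300 5 (stop 5)))))))) ∷
  (1 , (step 1684 4 (stop 5)) , (step 1684 4 (step 1999 4 (step 2017 4 (step 2018 4 (step 2034 5 (step 2455 5 (stop 5)))))))) ∷
  (1 , (step 1666 4 (stop 5)) , (step 1666 4 (step 1972 4 (step 1989 4 (step 1991 5 (step 2036 5 (step 3980 5 (stop 5)))))))) ∷
  (1 , (step 1648 4 (stop 5)) , (step 1648 4 (step 1945 4 (step 1961 4 (step 1962 4 (step 1973 5 (step 2244 5 (stop 5)))))))) ∷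
  (1 , (step 1631 4 (stop 5)) , (step 1631 4 (step 1919 4 (step 1935 4 (step 1936 5 (step 1957 5 (step 2557 5 (stop 5)))))))) ∷
  (1 , (step 1615 4 (stop 5)) , (step 1615 4 (step 1894 4 (step 1909 4 (step 1910 4 (step 1925 5 (step 2318 5 (stop 5)))))))) ∷
  (1 , (step 1598 4 (stop 5)) , (step 1598 4 (step 1869 4 (step 1884 4 (step 1885 4 (step 1897 5 (step 2200 5 (stop 5)))))))) ∷
  (1 , (step 1583 4 (stop 5)) , (step 1583 4 (step 1846 4 (step 1860 4 (step 1861 4 (step 1876 5 (step 2271 5 (stop 5)))))))) ∷
  (1 , (step 1567 4 (stop 5)) , (step 1567 4 (step 1823 4 (step 1837 4 (step 1839 5 (step 1883 5 (step 3901 5 (stop 5)))))))) ∷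
  (1 , (step 1552 4 (stop 5)) , (step 1552 4 (step 1801 4 (step 1814 4 (step 1815 4 (step 1832 5 (step 2296 5 (stop 5)))))))) ∷
  (1 , (step 1537 4 (stop 5)) , (step 1537 4 (step 1779 4 (step 1792 4 (step 1793 4 (step 1810 5 (step 2276 5 (stop 5)))))))) ∷
  (1 , (step 1523 4 (stop 5)) , (step 1523 4 (step 1758 4 (step 1771 4 (step 1776 5 (step 1891 5 (stop 5))))))) ∷
  (1 , (step 1509 4 (stop 5)) , (step 1509 4 (step 1738 4 (step 1750 4 (step 1751 4 (step 1772 5 (step 2391 5 (stop 5)))))))) ∷
  (1 , (step 1495 4 (stop 5)) , (step 1495 4 (step 1718 4 (step 1730 4 (step 1734 5 (step 1826 5 (stop 5))))))) ∷
  (1 , (step 1482 4 (stop 5)) , (step 1482 4 (step 1699 4 (step 1710 4 (step 1711 4 (step 1729 5 (step 2237 5 (stop 5)))))))) ∷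
  (1 , (step 1469 4 (stop 5)) , (step 1469 4 (step 1680 4 (step 1691 4 (step 1692 4 (step 1712 5 (step 2299 5 (stop 5)))))))) ∷
  (1 , (step 1456 4 (stop 5)) , (step 1456 4 (step 1662 4 (step 1672 4 (step 1673 4 (step 1685 5 (step 1993 5 (stop 5)))))))) ∷
  (1 , (step 1444 4 (stop 5)) , (step 1444 4 (step 1644 4 (step 1654 4 (step 1655 4 (step 1669 5 (step 2041 5 (stop 5)))))))) ∷
  (1 , (step 1431 4 (stop 5)) , (step 1431 4 (step 1626 4 (step 1637 4 (step 1643 5 (step 1784 5 (stop 5))))))) ∷
  (1 , (step 1420 4 (stop 5)) , (step 1420 4 (step 1610 4 (step 1620 4 (step 1630 5 (step 1880 5 (stop 5))))))) ∷
  (1 , (step 1408 4 (stop 5)) , (step 1408 4 (step 1593 4 (step 1603 4 (step 1607 5 (step 1698 5 (stop 5))))))) ∷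
  (1 , (step 1396 4 (stop 5)) , (step 1396 4 (step 1577 4 (step 1587 4 (step 1597 5 (step 1849 5 (stop 5))))))) ∷
  (1 , (step 1385 4 (stop 5)) , (step 1385 4 (step 1561 4 (step 1571 4 (step 1579 5 (step 1774 5 (stop 5))))))) ∷
  (1 , (step 1374 4 (stop 5)) , (step 1374 4 (step 1546 4 (step 1555 4 (step 1556 4 (step 1575 5 (step 2139 5 (stop 5)))))))) ∷
  (1 , (step 1363 4 (stop 5)) , (step 1363 4 (step 1531 4 (step 1540 4 (step 1541 5 (step 1563 5 (step 2259 5 (stop 5)))))))) ∷
  (1 , (step 1353 4 (stop 5)) , (step 1353 4 (step 1517 4 (step 1525 4 (step 1526 4 (step 1543 5 (step 2032 5 (stop 5)))))))) ∷
  (1 , (step 1343 4 (stop 5)) , (step 1343 4 (step 1503 4 (step 1511 4 (step 1516 5 (step 1633 5 (stop 5))))))) ∷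
  (1 , (step 1332 4 (stop 5)) , (step 1332 4 (step 1489 4 (step 1497 4 (step 1504 5 (step 1672 5 (stop 5))))))) ∷
  (1 , (step 1323 4 (stop 5)) , (step 1323 4 (step 1475 4 (step 1483 4 (step 1485 5 (step 1529 5 (step 4249 5 (stop 5)))))))) ∷
  (1 , (step 1313 4 (stop 5)) , (step 1313 4 (step 1462 4 (step 1470 4 (step 1481 5 (step 1766 5 (stop 5))))))) ∷
  (1 , (step 1303 4 (stop 5)) , (step 1303 4 (step 1449 4 (step 1457 4 (step 1471 5 (step 1855 5 (stop 5))))))) ∷
  (1 , (step 1294 4 (stop 5)) , (step 1294 4 (step 1436 4 (step 1444 4 (step 1455 5 (step 1740 5 (stop 5))))))) ∷
  (1 , (step 1285 4 (stop 5)) , (step 1285 4 (step 1424 4 (step 1431 4 (step 1432 5 (step 1454 5 (step 2176 5 (stop 5)))))))) ∷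
  (1 , (step 1276 4 (stop 5)) , (step 1276 4 (step 1412 4 (step 1419 4 (step 1426 5 (step 1596 5 (stop 5))))))) ∷
  (1 , (step 1267 4 (stop 5)) , (step 1267 4 (step 1400 4 (step 1407 4 (step 1415 5 (step 1612 5 (stop 5))))))) ∷
  (1 , (step 1258 4 (stop 5)) , (step 1258 4 (step 1388 4 (step 1395 4 (step 1398 5 (step 1466 5 (stop 5))))))) ∷
  (1 , (step 1250 4 (stop 5)) , (step 1250 4 (step 1377 4 (step 1384 4 (step 1397 5 (step 1752 5 (stop 5))))))) ∷
  (1 , (step 1241 4 (stop 5)) , (step 1241 4 (step 1366 4 (step 1372 4 (step 1373 4 (step 1392 5 (step 1984 5 (stop 5)))))))) ∷
  (1 , (step 1233 4 (stop 5)) , (step 1233 4 (step 1355 4 (step 1361 4 (step 1362 4 (step 1382 5 (step 2022 5 (stop 5)))))))) ∷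
  (1 , (step 1225 4 (stop 5)) , (step 1225 4 (step 1344 4 (step 1350 4 (step 1351 4 (step 1367 5 (step 1835 5 (stop 5)))))))) ∷
  (1 , (step 1217 4 (stop 5)) , (step 1217 4 (step 1334 4 (step 1340 4 (step 1347 5 (step 1518 5 (stop 5))))))) ∷
  (1 , (step 1209 4 (stop 5)) , (step 1209 4 (step 1324 4 (step 1330 4 (step 1345 5 (step 1777 5 (stop 5))))))) ∷
  (1 , (step 1202 4 (stop 5)) , (step 1202 4 (step 1314 4 (step 1319 4 (step 1320 4 (step 1338 5 (step 1896 5 (stop 5)))))))) ∷
  (1 , (step 1194 4 (stop 5)) , (step 1194 4 (step 1304 4 (step 1309 4 (step 1310 4 (step 1328 5 (step 1886 5 (stop 5)))))))) ∷
  (1 , (step 1187 4 (stop 5)) , (step 1187 4 (step 1294 4 (step 1300 4 (step 1313 5 (step 1674 5 (stop 5))))))) ∷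
  (1 , (step 1180 4 (stop 5)) , (step 1180 4 (step 1285 4 (step 1290 4 (step 1294 5 (step 1387 5 (stop 5))))))) ∷
  (1 , (step 1172 4 (stop 5)) , (step 1172 4 (step 1275 4 (step 1281 4 (step 1294 5 (step 1655 5 (stop 5))))))) ∷
  (1 , (step 1165 4 (stop 5)) , (step 1165 4 (step 1266 4 (step 1271 4 (step 1272 4 (step 1289 5 (step 1811 5 (stop 5)))))))) ∷
  (1 , (step 1158 4 (stop 5)) , (step 1158 4 (step 1257 4 (step 1262 4 (step 1263 4 (step 1281 5 (step 1849 5 (stop 5)))))))) ∷
  (1 , (step 1152 4 (stop 5)) , (step 1152 4 (step 1249 4 (step 1254 4 (step 1270 5 (step 1751 5 (stop 5))))))) ∷
  (1 , (step 1145 4 (stop 5)) , (step 1145 4 (step 1240 4 (step 1245 4 (step 1255 5 (step 1517 5 (stop 5))))))) ∷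
  (1 , (step 1138 4 (stop 5)) , (step 1138 4 (step 1232 4 (step 1236 4 (step 1237 4 (step 1258 5 (step 1985 5 (stop 5)))))))) ∷
  (1 , (step 1132 4 (stop 5)) , (step 1132 4 (step 1223 4 (step 1228 4 (step 1237 5 (step 1468 5 (stop 5))))))) ∷
  (1 , (step 1125 4 (stop 5)) , (step 1125 4 (step 1215 4 (step 1220 4 (step 1234 5 (step 1639 5 (stop 5))))))) ∷
  (1 , (step 1119 4 (stop 5)) , (step 1119 4 (step 1207 4 (step 1212 4 (step 1228 5 (step 1716 5 (stop 5))))))) ∷
  (1 , (step 1113 4 (stop 5)) , (step 1113 4 (step 1199 4 (step 1204 4 (step 1219 5 (step 1667 5 (stop 5))))))) ∷
  (1 , (step 1107 4 (stop 5)) , (step 1107 4 (step 1192 4 (step 1196 4 (step 1207 5 (step 1506 5 (stop 5))))))) ∷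
  (1 , (step 1101 4 (stop 5)) , (step 1101 4 (step 1184 4 (step 1188 4 (step 1193 5 (step 1312 5 (stop 5))))))) ∷
  (1 , (step 1095 4 (stop 5)) , (step 1095 4 (step 1176 4 (step 1181 4 (step 1197 5 (step 1691 5 (stop 5))))))) ∷
  (1 , (step 1089 4 (stop 5)) , (step 1089 4 (step 1169 4 (step 1173 4 (step 1177 5 (step 1271 5 (stop 5))))))) ∷
  (1 , (step 1084 4 (stop 5)) , (step 1084 4 (step 1162 4 (step 1166 4 (step 1177 5 (step 1476 5 (stop 5))))))) ∷
  (1 , (step 1078 4 (stop 5)) , (step 1078 4 (step 1155 4 (step 1159 4 (step 1173 5 (step 1586 5 (stop 5))))))) ∷
  (1 , (step 1072 4 (stop 5)) , (step 1072 4 (step 1148 4 (step 1152 4 (step 1167 5 (step 1623 5 (stop 5))))))) ∷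
  (1 , (step 1067 4 (stop 5)) , (step 1067 4 (step 1141 4 (step 1145 4 (step 1159 5 (step 1574 5 (stop 5))))))) ∷
  (1 , (step 1061 4 (stop 5)) , (step 1061 4 (step 1134 4 (step 1138 4 (step 1149 5 (step 1450 5 (stop 5))))))) ∷
  (1 , (step 1056 4 (stop 5)) , (step 1056 4 (step 1128 4 (step 1131 4 (step 1136 5 (step 1255 5 (stop 5))))))) ∷
  (1 , (step 1051 4 (stop 5)) , (step 1051 4 (step 1121 4 (step 1125 4 (step 1142 5 (step 1694 5 (stop 5))))))) ∷
  (1 , (step 1046 4 (stop 5)) , (step 1046 4 (step 1115 4 (step 1118 4 (step 1125 5 (step 1300 5 (stop 5))))))) ∷
  (1 , (step 1041 4 (stop 5)) , (step 1041 4 (step 1108 4 (step 1112 4 (step 1127 5 (step 1589 5 (stop 5))))))) ∷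
  (1 , (step 1036 4 (stop 5)) , (step 1036 4 (step 1102 4 (step 1105 4 (step 1106 5 (step 1128 5 (step 1972 5 (stop 5)))))))) ∷
  (1 , (step 1031 4 (stop 5)) , (step 1031 4 (step 1096 4 (step 1099 4 (step 1104 5 (step 1224 5 (stop 5))))))) ∷
  (1 , (step 1026 4 (stop 5)) , (step 1026 4 (step 1090 4 (step 1093 4 (step 1100 5 (step 1276 5 (stop 5))))))) ∷
  (1 , (step 1021 4 (stop 5)) , (step 1021 4 (step 1084 4 (step 1087 4 (step 1094 5 (step 1270 5 (stop 5))))))) ∷
  (1 , (step 1016 4 (stop 5)) , (step 1016 4 (step 1078 4 (step 1081 4 (step 1087 5 (step 1234 5 (stop 5))))))) ∷
  (1 , (step 1012 4 (stop 5)) , (step 1012 4 (step 1072 4 (step 1075 4 (step 1077 5 (step 1122 5 (step 11393 5 (stop 5)))))))) ∷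
  (1 , (step 1007 4 (stop 5)) , (step 1007 4 (step 1067 4 (step 1070 4 (step 1088 5 (step 1705 5 (stop 5))))))) ∷
  (1 , (step 1002 4 (stop 5)) , (step 1002 4 (step 1061 4 (step 1064 4 (step 1074 5 (step 1347 5 (stop 5))))))) ∷
  (1 , (step 998 4 (stop 5)) , (step 998 4 (step 1056 4 (step 1058 4 (step 1059 5 (step 1081 5 (step 1958 5 (stop 5)))))))) ∷
  (1 , (step 993 4 (stop 5)) , (step 993 4 (step 1050 4 (step 1053 4 (step 1065 5 (step 1410 5 (stop 5))))))) ∷
  (1 , (step 989 4 (stop 5)) , (step 989 4 (step 1045 4 (step 1047 4 (step 1048 4 (step 1068 5 (step 1814 5 (stop 5)))))))) ∷
  (1 , (step 985 4 (stop 5)) , (step 985 4 (step 1039 4 (step 1042 4 (step 1048 5 (step 1197 5 (stop 5))))))) ∷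
  (1 , (step 981 4 (stop 5)) , (step 981 4 (step 1034 4 (step 1037 4 (step 1049 5 (step 1396 5 (stop 5))))))) ∷
  (1 , (step 976 4 (stop 5)) , (step 976 4 (step 1029 4 (step 1032 4 (step 1047 5 (step 1525 5 (stop 5))))))) ∷
  (1 , (step 972 4 (stop 5)) , (step 972 4 (step 1024 4 (step 1027 4 (step 1045 5 (step 1677 5 (stop 5))))))) ∷
  (1 , (step 968 4 (stop 5)) , (step 968 4 (step 1019 4 (step 1022 4 (step 1041 5 (step 1734 5 (stop 5))))))) ∷
  (1 , (step 964 4 (stop 5)) , (step 964 4 (step 1014 4 (step 1017 4 (step 1035 5 (step 1671 5 (stop 5))))))) ∷
  (1 , (step 960 4 (stop 5)) , (step 960 4 (step 1009 4 (step 1012 4 (step 1028 5 (step 1557 5 (stop 5))))))) ∷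
  (1 , (step 956 4 (stop 5)) , (step 956 4 (step 1004 4 (step 1007 4 (step 1019 5 (step 1370 5 (stop 5))))))) ∷
  (1 , (step 952 4 (stop 5)) , (step 952 4 (step 1000 4 (step 1002 4 (step 1009 5 (step 1188 5 (stop 5))))))) ∷
  (1 , (step 948 4 (stop 5)) , (step 948 4 (step 995 4 (step 997 4 (step 998 5 (step 1020 5 (step 1941 5 (stop 5)))))))) ∷
  (1 , (step 944 4 (stop 5)) , (step 944 4 (step 990 4 (step 993 4 (step 1007 5 (step 1446 5 (stop 5))))))) ∷
  (1 , (step 941 4 (stop 5)) , (step 941 4 (step 986 4 (step 988 4 (step 993 5 (step 1115 5 (stop 5))))))) ∷
  (1 , (step 937 4 (stop 5)) , (step 937 4 (step 982 4 (step 984 4 (step 1000 5 (step 1538 5 (stop 5))))))) ∷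
  (1 , (step 933 4 (stop 5)) , (step 933 4 (step 977 4 (step 979 4 (step 984 5 (step 1105 5 (stop 5))))))) ∷
  (1 , (step 930 4 (stop 5)) , (step 930 4 (step 973 4 (step 975 4 (step 988 5 (step 1385 5 (stop 5))))))) ∷
  (1 , (step 926 4 (stop 5)) , (step 926 4 (step 968 4 (step 970 4 (step 971 4 (step 991 5 (step 1780 5 (stop 5)))))))) ∷
  (1 , (step 923 4 (stop 5)) , (step 923 4 (step 964 4 (step 966 4 (step 971 5 (step 1092 5 (stop 5))))))) ∷
  (1 , (step 919 4 (stop 5)) , (step 919 4 (step 960 4 (step 962 4 (step 972 5 (step 1251 5 (stop 5))))))) ∷
  (1 , (step 916 4 (stop 5)) , (step 916 4 (step 956 4 (step 958 4 (step 971 5 (step 1371 5 (stop 5))))))) ∷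
  (1 , (step 912 4 (stop 5)) , (step 912 4 (step 952 4 (step 954 4 (step 970 5 (step 1517 5 (stop 5))))))) ∷
  (1 , (step 909 4 (stop 5)) , (step 909 4 (step 948 4 (step 950 4 (step 967 5 (step 1572 5 (stop 5))))))) ∷
  (1 , (step 905 4 (stop 5)) , (step 905 4 (step 944 4 (step 946 4 (step 963 5 (step 1571 5 (stop 5))))))) ∷
  (1 , (step 902 4 (stop 5)) , (step 902 4 (step 940 4 (step 942 4 (step 959 5 (step 1567 5 (stop 5))))))) ∷
  (1 , (step 899 4 (stop 5)) , (step 899 4 (step 936 4 (step 938 4 (step 953 5 (step 1452 5 (stop 5))))))) ∷
  (1 , (step 896 4 (stop 5)) , (step 896 4 (step 932 4 (step 934 4 (step 946 5 (step 1307 5 (stop 5))))))) ∷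
  (1 , (step 892 4 (stop 5)) , (step 892 4 (step 928 4 (step 930 4 (step 938 5 (step 1151 5 (stop 5))))))) ∷
  (1 , (step 889 4 (stop 5)) , (step 889 4 (step 925 4 (step 926 4 (step 930 5 (step 1025 5 (stop 5))))))) ∷
  (1 , (step 886 4 (stop 5)) , (step 886 4 (step 921 4 (step 923 4 (step 942 5 (step 1691 5 (stop 5))))))) ∷
  (1 , (step 883 4 (stop 5)) , (step 883 4 (step 917 4 (step 919 4 (step 931 5 (step 1295 5 (stop 5))))))) ∷
  (1 , (step 880 4 (stop 5)) , (step 880 4 (step 914 4 (step 915 4 (step 920 5 (step 1042 5 (stop 5))))))) ∷
  (1 , (step 877 4 (stop 5)) , (step 877 4 (step 910 4 (step 912 4 (step 929 5 (step 1552 5 (stop 5))))))) ∷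
  (1 , (step 874 4 (stop 5)) , (step 874 4 (step 907 4 (step 908 4 (step 916 5 (step 1130 5 (stop 5))))))) ∷
  (1 , (step 871 4 (stop 5)) , (step 871 4 (step 903 4 (step 905 4 (step 924 5 (step 1684 5 (stop 5))))))) ∷
  (1 , (step 868 4 (stop 5)) , (step 868 4 (step 900 4 (step 901 4 (step 909 5 (step 1123 5 (stop 5))))))) ∷
  (1 , (step 865 4 (stop 5)) , (step 865 4 (step 896 4 (step 898 4 (step 915 5 (step 1542 5 (stop 5))))))) ∷
  (1 , (step 862 4 (stop 5)) , (step 862 4 (step 893 4 (step 894 4 (step 898 5 (step 993 5 (stop 5))))))) ∷
  (1 , (step 859 4 (stop 5)) , (step 859 4 (step 889 4 (step 891 4 (step 902 5 (step 1228 5 (stop 5))))))) ∷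
  (1 , (step 857 4 (stop 5)) , (step 857 4 (step 886 4 (step 888 4 (step 906 5 (step 1606 5 (stop 5))))))) ∷
  (1 , (step 854 4 (stop 5)) , (step 854 4 (step 883 4 (step 884 4 (step 887 5 (step 956 5 (stop 5))))))) ∷
  (1 , (step 851 4 (stop 5)) , (step 851 4 (step 880 4 (step 881 4 (step 889 5 (step 1104 5 (stop 5))))))) ∷
  (1 , (step 848 4 (stop 5)) , (step 848 4 (step 877 4 (step 878 4 (step 890 5 (step 1260 5 (stop 5))))))) ∷
  (1 , (step 846 4 (stop 5)) , (step 846 4 (step 873 4 (step 875 4 (step 891 5 (step 1467 5 (stop 5))))))) ∷
  (1 , (step 843 4 (stop 5)) , (step 843 4 (step 870 4 (step 872 4 (step 890 5 (step 1601 5 (stop 5))))))) ∷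
  (1 , (step 840 4 (stop 5)) , (step 840 4 (step 867 4 (step 868 4 (step 869 4 (step 890 5 (step 1851 5 (stop 5)))))))) ∷
  (1 , (step 838 4 (stop 5)) , (step 838 4 (step 864 4 (step 865 4 (step 866 5 (step 888 5 (step 1957 5 (stop 5)))))))) ∷
  (1 , (step 835 4 (stop 5)) , (step 835 4 (step 861 4 (step 862 4 (step 864 5 (step 909 5 (stop 5))))))) ∷
  (1 , (step 833 4 (stop 5)) , (step 833 4 (step 858 4 (step 859 4 (step 860 5 (step 883 5 (step 2076 5 (stop 5)))))))) ∷
  (1 , (step 830 4 (stop 5)) , (step 830 4 (step 855 4 (step 856 4 (step 857 5 (step 879 5 (step 1961 5 (stop 5)))))))) ∷
  (1 , (step 828 4 (stop 5)) , (step 828 4 (step 852 4 (step 854 4 (step 874 5 (step 1762 5 (stop 5))))))) ∷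
  (1 , (step 825 4 (stop 5)) , (step 825 4 (step 849 4 (step 851 4 (step 869 5 (step 1594 5 (stop 5))))))) ∷
  (1 , (step 823 4 (stop 5)) , (step 823 4 (step 847 4 (step 848 4 (step 864 5 (step 1452 5 (stop 5))))))) ∷
  (1 , (step 820 4 (stop 5)) , (step 820 4 (step 844 4 (step 845 4 (step 857 5 (step 1233 5 (stop 5))))))) ∷
  (1 , (step 818 4 (stop 5)) , (step 818 4 (step 841 4 (step 842 4 (step 850 5 (step 1068 5 (stop 5))))))) ∷
  (1 , (step 816 4 (stop 5)) , (step 816 4 (step 838 4 (step 839 4 (step 843 5 (step 939 5 (stop 5))))))) ∷
  (1 , (step 813 4 (stop 5)) , (step 813 4 (step 835 4 (step 837 4 (step 857 5 (step 1760 5 (stop 5))))))) ∷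
  (1 , (step 811 4 (stop 5)) , (step 811 4 (step 833 4 (step 834 4 (step 848 5 (step 1325 5 (stop 5))))))) ∷
  (1 , (step 809 4 (stop 5)) , (step 809 4 (step 830 4 (step 831 4 (step 838 5 (step 1023 5 (stop 5))))))) ∷
  (1 , (step 806 4 (stop 5)) , (step 806 4 (step 827 4 (step 828 4 (step 829 4 (step 850 5 (step 1869 5 (stop 5)))))))) ∷
  (1 , (step 804 4 (stop 5)) , (step 804 4 (step 825 4 (step 826 4 (step 840 5 (step 1320 5 (stop 5))))))) ∷
  (1 , (step 802 4 (stop 5)) , (step 802 4 (step 822 4 (step 823 4 (step 829 5 (step 982 5 (stop 5))))))) ∷
  (1 , (step 799 4 (stop 5)) , (step 799 4 (step 820 4 (step 821 4 (step 839 5 (step 1587 5 (stop 5))))))) ∷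
  (1 , (step 797 4 (stop 5)) , (step 797 4 (step 817 4 (step 818 4 (step 827 5 (step 1082 5 (stop 5))))))) ∷
  (1 , (step 795 4 (stop 5)) , (step 795 4 (step 815 4 (step 816 4 (step 836 5 (step 1768 5 (stop 5))))))) ∷
  (1 , (step 793 4 (stop 5)) , (step 793 4 (step 812 4 (step 813 4 (step 823 5 (step 1118 5 (stop 5))))))) ∷
  (1 , (step 791 4 (stop 5)) , (step 791 4 (step 810 4 (step 811 4 (step 831 5 (step 1769 5 (stop 5))))))) ∷
  (1 , (step 789 4 (stop 5)) , (step 789 4 (step 807 4 (step 808 4 (step 817 5 (step 1073 5 (stop 5))))))) ∷
  (1 , (step 786 4 (stop 5)) , (step 786 4 (step 805 4 (step 806 4 (step 824 5 (step 1584 5 (stop 5))))))) ∷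
  (1 , (step 784 4 (stop 5)) , (step 784 4 (step 802 4 (step 803 4 (step 809 5 (step 963 5 (stop 5))))))) ∷
  (1 , (step 782 4 (stop 5)) , (step 782 4 (step 800 4 (step 801 4 (step 815 5 (step 1304 5 (stop 5))))))) ∷
  (1 , (step 780 4 (stop 5)) , (step 780 4 (step 798 4 (step 799 5 (step 821 5 (step 2011 5 (stop 5))))))) ∷
  (1 , (step 778 4 (stop 5)) , (step 778 4 (step 795 4 (step 796 4 (step 804 5 (step 1025 5 (stop 5))))))) ∷
  (1 , (step 776 4 (stop 5)) , (step 776 4 (step 793 4 (step 794 4 (step 809 5 (step 1360 5 (stop 5))))))) ∷
  (1 , (step 774 4 (stop 5)) , (step 774 4 (step 791 4 (step 792 4 (step 813 5 (step 1891 5 (stop 5))))))) ∷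
  (1 , (step 772 4 (stop 5)) , (step 772 4 (step 788 4 (step 789 4 (step 795 5 (step 950 5 (stop 5))))))) ∷
  (1 , (step 770 4 (stop 5)) , (step 770 4 (step 786 4 (step 787 4 (step 798 5 (step 1140 5 (stop 5))))))) ∷
  (1 , (step 768 4 (stop 5)) , (step 768 4 (step 784 4 (step 785 4 (step 801 5 (step 1425 5 (stop 5))))))) ∷
  (1 , (step 766 4 (stop 5)) , (step 766 4 (step 782 4 (step 783 4 (step 804 5 (step 1897 5 (stop 5))))))) ∷
  (1 , (step 764 4 (stop 5)) , (step 764 4 (step 780 4 (step 784 5 (step 881 5 (stop 5)))))) ∷
  (1 , (step 763 4 (stop 5)) , (step 763 4 (step 777 4 (step 778 4 (step 786 5 (step 1008 5 (stop 5))))))) ∷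
  (1 , (step 761 4 (stop 5)) , (step 761 4 (step 775 4 (step 776 4 (step 787 5 (step 1130 5 (stop 5))))))) ∷
  (1 , (step 759 4 (stop 5)) , (step 759 4 (step 773 4 (step 774 4 (step 788 5 (step 1287 5 (stop 5))))))) ∷
  (1 , (step 757 4 (stop 5)) , (step 757 4 (step 771 4 (step 772 4 (step 788 5 (step 1420 5 (stop 5))))))) ∷
  (1 , (step 755 4 (stop 5)) , (step 755 4 (step 769 4 (step 770 4 (step 788 5 (step 1583 5 (stop 5))))))) ∷
  (1 , (step 753 4 (stop 5)) , (step 753 4 (step 767 4 (step 768 4 (step 788 5 (step 1788 5 (stop 5))))))) ∷
  (1 , (step 752 4 (stop 5)) , (step 752 4 (step 765 4 (step 766 4 (step 787 5 (step 1916 5 (stop 5))))))) ∷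
  (1 , (step 750 4 (stop 5)) , (step 750 4 (step 763 4 (step 764 5 (step 786 5 (step 2062 5 (stop 5))))))) ∷
  (1 , (step 748 4 (stop 5)) , (step 748 4 (step 761 4 (step 762 5 (step 784 5 (step 2068 5 (stop 5))))))) ∷
  (1 , (step 746 4 (stop 5)) , (step 746 4 (step 759 4 (step 760 5 (step 783 5 (step 2236 5 (stop 5))))))) ∷
  (1 , (step 744 4 (stop 5)) , (step 744 4 (step 757 4 (step 758 5 (step 780 5 (step 2074 5 (stop 5))))))) ∷
  (1 , (step 743 4 (stop 5)) , (step 743 4 (step 755 4 (step 756 4 (step 778 5 (step 2073 5 (stop 5))))))) ∷
  (1 , (step 741 4 (stop 5)) , (step 741 4 (step 753 4 (step 754 4 (step 774 5 (step 1802 5 (stop 5))))))) ∷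
  (1 , (step 739 4 (stop 5)) , (step 739 4 (step 751 4 (step 752 4 (step 771 5 (step 1686 5 (stop 5))))))) ∷
  (1 , (step 738 4 (stop 5)) , (step 738 4 (step 749 4 (step 750 4 (step 767 5 (step 1495 5 (stop 5))))))) ∷
  (1 , (step 736 4 (stop 5)) , (step 736 4 (step 747 4 (step 748 4 (step 763 5 (step 1340 5 (stop 5))))))) ∷
  (1 , (step 734 4 (stop 5)) , (step 734 4 (step 745 4 (step 746 4 (step 759 5 (step 1212 5 (stop 5))))))) ∷
  (1 , (step 733 4 (stop 5)) , (step 733 4 (step 744 4 (step 754 5 (step 1059 5 (stop 5)))))) ∷
  (1 , (step 731 4 (stop 5)) , (step 731 4 (step 742 4 (step 749 5 (step 939 5 (stop 5)))))) ∷
  (1 , (step 729 4 (stop 5)) , (step 729 4 (step 740 4 (step 744 5 (step 841 5 (stop 5)))))) ∷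
  (1 , (step 728 4 (stop 5)) , (step 728 4 (step 738 4 (step 739 4 (step 760 5 (step 1950 5 (stop 5))))))) ∷
  (1 , (step 726 4 (stop 5)) , (step 726 4 (step 736 4 (step 737 4 (step 754 5 (step 1492 5 (stop 5))))))) ∷
  (1 , (step 725 4 (stop 5)) , (step 725 4 (step 734 4 (step 735 4 (step 747 5 (step 1150 5 (stop 5))))))) ∷
  (1 , (step 723 4 (stop 5)) , (step 723 4 (step 733 4 (step 741 5 (step 966 5 (stop 5)))))) ∷
  (1 , (step 722 4 (stop 5)) , (step 722 4 (step 731 4 (step 734 5 (step 804 5 (stop 5)))))) ∷
  (1 , (step 720 4 (stop 5)) , (step 720 4 (step 729 4 (step 730 4 (step 748 5 (step 1591 5 (stop 5))))))) ∷
  (1 , (step 718 4 (stop 5)) , (step 718 4 (step 727 4 (step 728 4 (step 741 5 (step 1200 5 (stop 5))))))) ∷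
  (1 , (step 717 4 (stop 5)) , (step 717 4 (step 726 4 (step 733 5 (step 923 5 (stop 5)))))) ∷
  (1 , (step 715 4 (stop 5)) , (step 715 4 (step 724 4 (step 725 5 (step 747 5 (step 2143 5 (stop 5))))))) ∷
  (1 , (step 714 4 (stop 5)) , (step 714 4 (step 722 4 (step 723 4 (step 738 5 (step 1330 5 (stop 5))))))) ∷
  (1 , (step 712 4 (stop 5)) , (step 712 4 (step 721 4 (step 729 5 (step 957 5 (stop 5)))))) ∷
  (1 , (step 711 4 (stop 5)) , (step 711 4 (step 719 4 (step 720 5 (step 742 5 (step 2161 5 (stop 5))))))) ∷
  (1 , (step 709 4 (stop 5)) , (step 709 4 (step 717 4 (step 718 4 (step 733 5 (step 1327 5 (stop 5))))))) ∷
  (1 , (step 708 4 (stop 5)) , (step 708 4 (step 716 4 (step 723 5 (step 915 5 (stop 5)))))) ∷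
  (1 , (step 707 4 (stop 5)) , (step 707 4 (step 714 4 (step 715 4 (step 735 5 (step 1842 5 (stop 5))))))) ∷
  (1 , (step 705 4 (stop 5)) , (step 705 4 (step 713 4 (step 725 5 (step 1134 5 (stop 5)))))) ∷
  (1 , (step 704 4 (stop 5)) , (step 704 4 (step 711 4 (step 715 5 (step 812 5 (stop 5)))))) ∷
  (1 , (step 702 4 (stop 5)) , (step 702 4 (step 709 4 (step 710 4 (step 726 5 (step 1405 5 (stop 5))))))) ∷
  (1 , (step 701 4 (stop 5)) , (step 701 4 (step 708 4 (step 715 5 (step 907 5 (stop 5)))))) ∷
  (1 , (step 700 4 (stop 5)) , (step 700 4 (step 706 4 (step 707 4 (step 726 5 (step 1714 5 (stop 5))))))) ∷
  (1 , (step 698 4 (stop 5)) , (step 698 4 (step 705 4 (step 714 5 (step 983 5 (stop 5)))))) ∷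
  (1 , (step 697 4 (stop 5)) , (step 697 4 (step 703 4 (step 704 4 (step 724 5 (step 1859 5 (stop 5))))))) ∷
  (1 , (step 695 4 (stop 5)) , (step 695 4 (step 702 4 (step 712 5 (step 1025 5 (stop 5)))))) ∷
  (1 , (step 694 4 (stop 5)) , (step 694 4 (step 700 4 (step 701 4 (step 722 5 (step 2026 5 (stop 5))))))) ∷
  (1 , (step 693 4 (stop 5)) , (step 693 4 (step 699 4 (step 710 5 (step 1070 5 (stop 5)))))) ∷
  (1 , (step 691 4 (stop 5)) , (step 691 4 (step 697 4 (step 698 4 (step 719 5 (step 2031 5 (stop 5))))))) ∷
  (1 , (step 690 4 (stop 5)) , (step 690 4 (step 696 4 (step 706 5 (step 1020 5 (stop 5)))))) ∷
  (1 , (step 689 4 (stop 5)) , (step 689 4 (step 694 4 (step 695 4 (step 715 5 (step 1869 5 (stop 5))))))) ∷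
  (1 , (step 687 4 (stop 5)) , (step 687 4 (step 693 4 (step 701 5 (step 932 5 (stop 5)))))) ∷
  (1 , (step 686 4 (stop 5)) , (step 686 4 (step 691 4 (step 692 4 (step 710 5 (step 1605 5 (stop 5))))))) ∷
  (1 , (step 685 4 (stop 5)) , (step 685 4 (step 690 4 (step 696 5 (step 855 5 (stop 5)))))) ∷
  (1 , (step 684 4 (stop 5)) , (step 684 4 (step 689 4 (step 704 5 (step 1319 5 (stop 5)))))) ∷
  (1 , (step 682 4 (stop 5)) , (step 682 4 (step 687 4 (step 689 5 (step 735 5 (stop 5)))))) ∷
  (1 , (step 681 4 (stop 5)) , (step 681 4 (step 686 4 (step 697 5 (step 1061 5 (stop 5)))))) ∷
  (1 , (step 680 4 (stop 5)) , (step 680 4 (step 684 4 (step 685 4 (step 704 5 (step 1739 5 (stop 5))))))) ∷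
  (1 , (step 679 4 (stop 5)) , (step 679 4 (step 683 4 (step 689 5 (step 848 5 (stop 5)))))) ∷
  (1 , (step 677 4 (stop 5)) , (step 677 4 (step 682 4 (step 696 5 (step 1242 5 (stop 5)))))) ∷
  (1 , (step 676 4 (stop 5)) , (step 676 4 (step 680 4 (step 681 4 (step 702 5 (step 2080 5 (stop 5))))))) ∷
  (1 , (step 675 4 (stop 5)) , (step 675 4 (step 679 4 (step 687 5 (step 918 5 (stop 5)))))) ∷
  (1 , (step 674 4 (stop 5)) , (step 674 4 (step 678 4 (step 693 5 (step 1317 5 (stop 5)))))) ∷
  (1 , (step 673 4 (stop 5)) , (step 673 4 (step 676 4 (step 677 5 (step 699 5 (step 2311 5 (stop 5))))))) ∷
  (1 , (step 671 4 (stop 5)) , (step 671 4 (step 675 4 (step 682 5 (step 877 5 (stop 5)))))) ∷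
  (1 , (step 670 4 (stop 5)) , (step 670 4 (step 674 4 (step 688 5 (step 1240 5 (stop 5)))))) ∷
  (1 , (step 669 4 (stop 5)) , (step 669 4 (step 672 4 (step 673 4 (step 694 5 (step 2097 5 (stop 5))))))) ∷
  (1 , (step 668 4 (stop 5)) , (step 668 4 (step 671 4 (step 677 5 (step 836 5 (stop 5)))))) ∷
  (1 , (step 667 4 (stop 5)) , (step 667 4 (step 670 4 (step 681 5 (step 1052 5 (stop 5)))))) ∷
  (1 , (step 666 4 (stop 5)) , (step 666 4 (step 669 4 (step 686 5 (step 1509 5 (stop 5)))))) ∷
  (1 , (step 664 4 (stop 5)) , (step 664 4 (step 667 4 (step 669 5 (step 715 5 (stop 5)))))) ∷
  (1 , (step 663 4 (stop 5)) , (step 663 4 (step 666 4 (step 673 5 (step 869 5 (stop 5)))))) ∷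
  (1 , (step 662 4 (stop 5)) , (step 662 4 (step 665 4 (step 677 5 (step 1105 5 (stop 5)))))) ∷
  (1 , (step 661 4 (stop 5)) , (step 661 4 (step 664 4 (step 682 5 (step 1627 5 (stop 5)))))) ∷
  (1 , (step 660 4 (stop 5)) , (step 660 4 (step 662 4 (step 663 5 (step 686 5 (step 2684 5 (stop 5))))))) ∷
  (1 , (step 659 4 (stop 5)) , (step 659 4 (step 661 4 (step 667 5 (step 828 5 (stop 5)))))) ∷
  (1 , (step 658 4 (stop 5)) , (step 658 4 (step 660 4 (step 671 5 (step 1042 5 (stop 5)))))) ∷
  (1 , (step 657 4 (stop 5)) , (step 657 4 (step 659 4 (step 674 5 (step 1316 5 (stop 5)))))) ∷
  (1 , (step 656 4 (stop 5)) , (step 656 4 (step 658 4 (step 677 5 (step 1780 5 (stop 5)))))) ∷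
  (1 , (step 654 4 (stop 5)) , (step 654 4 (step 656 4 (step 658 5 (step 704 5 (stop 5)))))) ∷
  (1 , (step 653 4 (stop 5)) , (step 653 4 (step 655 4 (step 661 5 (step 822 5 (stop 5)))))) ∷
  (1 , (step 652 4 (stop 5)) , (step 652 4 (step 654 4 (step 663 5 (step 941 5 (stop 5)))))) ∷
  (1 , (step 651 4 (stop 5)) , (step 651 4 (step 653 4 (step 666 5 (step 1161 5 (stop 5)))))) ∷
  (1 , (step 650 4 (stop 5)) , (step 650 4 (step 652 4 (step 668 5 (step 1411 5 (stop 5)))))) ∷
  (1 , (step 649 4 (stop 5)) , (step 649 4 (step 651 4 (step 670 5 (step 1796 5 (stop 5)))))) ∷
  (1 , (step 648 4 (stop 5)) , (step 648 4 (step 649 4 (step 650 5 (step 673 5 (step 2794 5 (stop 5))))))) ∷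
  (1 , (step 647 4 (stop 5)) , (step 647 4 (step 648 4 (step 652 5 (step 751 5 (stop 5)))))) ∷
  (1 , (step 646 4 (stop 5)) , (step 646 4 (step 647 4 (step 654 5 (step 851 5 (stop 5)))))) ∷
  (1 , (step 645 4 (stop 5)) , (step 645 4 (step 646 4 (step 655 5 (step 934 5 (stop 5)))))) ∷
  (1 , (step 644 4 (stop 5)) , (step 644 4 (step 645 4 (step 657 5 (step 1091 5 (stop 5)))))) ∷
  (1 , (step 643 4 (stop 5)) , (step 643 4 (step 644 4 (step 658 5 (step 1231 5 (stop 5)))))) ∷
  (1 , (step 642 4 (stop 5)) , (step 642 4 (step 643 4 (step 659 5 (step 1412 5 (stop 5)))))) ∷
  (1 , (step 641 4 (stop 5)) , (step 641 4 (step 642 4 (step 660 5 (step 1655 5 (stop 5)))))) ∷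
  (1 , (step 640 4 (stop 5)) , (step 640 4 (step 641 4 (step 661 5 (step 1997 5 (stop 5)))))) ∷
  (1 , (step 639 4 (stop 5)) , (step 639 4 (step 640 4 (step 661 5 (step 2238 5 (stop 5)))))) ∷
  (1 , (step 638 4 (stop 5)) , (step 638 4 (step 640 5 (step 686 5 (stop 5))))) ∷
  (1 , (step 637 4 (stop 5)) , (step 637 4 (step 640 5 (step 712 5 (stop 5))))) ∷
  (1 , (step 636 4 (stop 5)) , (step 636 4 (step 640 5 (step 739 5 (stop 5))))) ∷
  (13 , (stop 5) , (step 663 5 (step 7490 5 (stop 5)))) ∷
  []

no-small-solution : ∀ {m} → 2 ≤ m → m < 650 → NoSolution m
-- The `refl` runs the whole table, and `end 2 table` evaluates to 650.
no-small-solution = check-sound 2 table z<s refl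

-- Large m

open Ratio

-- The square of `R∞` is at most 4 m. With k = m + 1 here, the square grows by (2 k + 2) ^ 2 / (2 k
-- + 1) ^ 2, which is at most (k + 1) / k because 4 k (k + 1) ≤ (2 k + 1) ^ 2.
wallis : ∀ m → 2 ^ suc m * suc m ! * (2 ^ suc m * suc m !) ≤ 4 * suc m * (odds 0 (suc m) * odds 0 (suc m))
wallis zero = ≤-refl
wallis (suc m) = begin
  2 * a * (suc k * f) * (2 * a * (suc k * f))             ≡⟨ lem₁ k a f ⟩
  4 * (suc k * suc k) * (a * f * (a * f))                 ≤⟨ *-monoʳ-≤ (4 * (suc k * suc k)) (wallis m) ⟩
  4 * (suc k * suc k) * (4 * k * (o * o))                 ≤⟨ m≤m+n _ (4 * suc k * (o * o)) ⟩
  4 * (suc k * suc k) * (4 * k * (o * o)) + 4 * suc k * (o * o)   ≡⟨ lem₂ k o ⟩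
  4 * suc k * (suc (2 * k) * o * (suc (2 * k) * o))       ∎
  where
  open ≤-Reasoning
  k = suc m
  a = 2 ^ k
  f = k !
  o = odds 0 k
  lem₁ : ∀ k a f → 2 * a * (suc k * f) * (2 * a * (suc k * f)) ≡ 4 * (suc k * suc k) * (a * f * (a * f))
  lem₁ = solve-∀
  lem₂ : ∀ k o → 4 * (suc k * suc k) * (4 * k * (o * o)) + 4 * suc k * (o * o) ≡ 4 * suc k * (suc (2 * k) * o * (suc (2 * k) * o))
  lem₂ = solve-∀

-- For i ≤ b each factor (2 b + i) / (b + i) is at least 3 / 2.
3^≤F : ∀ y b → y ≤ b → 3 ^ y * rising b y ≤ 2 ^ y * rising (2 * b) y
3^≤F y b y≤b = subst₂ _≤_ (cong (_* rising b y) (∏-const y 3)) (trans (*-comm (rising (2 * b) y) (∏ y (λ _ → 2))) (cong (_* rising (2 * b) y) (∏-const y 2)))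
  (∏-cross y {g = λ _ → 2} (λ i i<y → termwise i (≤-trans i<y y≤b)))
  where
  lem₁ : ∀ b i → 3 * (b + suc i) ≡ 3 * b + 2 * suc i + suc i
  lem₁ = solve-∀
  lem₂ : ∀ b i → 3 * b + 2 * suc i + b ≡ (2 * b + suc i) * 2
  lem₂ = solve-∀
  termwise : ∀ i → i < b → 3 * (b + suc i) ≤ (2 * b + suc i) * 2
  termwise i i<b = ≤-trans (≤-reflexive (lem₁ b i)) (≤-trans (+-monoʳ-≤ (3 * b + 2 * suc i) i<b) (≤-reflexive (lem₂ b i)))

-- Squaring (3 / 2) ^ y ≤ F ≤ `R∞` gives (9 / 4) ^ y ≤ 4 m, and 9 / 4 ≥ 2. The exponent `y` may be
-- smaller than `x`, since only the first b factors of F are known to reach 3 / 2.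
2^≤4m : ∀ m M x b y → R (suc m) M ≈ F x b → 0 < b → y ≤ b → y ≤ x → 2 ^ y ≤ 4 * suc m
2^≤4m m-1 M x b y R≈F 0<b y≤b y≤x = *-cancelˡ-≤ (4 ^ y) {{m^n≢0 4 y}} (begin
  4 ^ y * 2 ^ y          ≡⟨ cong (_* 2 ^ y) (4^≡2^ y) ⟩
  2 ^ (2 * y) * 2 ^ y    ≡⟨ ^-distribˡ-+-* 2 (2 * y) y ⟨
  2 ^ (2 * y + y)        ≡⟨ cong (2 ^_) (lem₁ y) ⟩
  2 ^ (3 * y)            ≡⟨ ^-*-assoc 2 3 y ⟨
  8 ^ y                  ≤⟨ ^-monoˡ-≤ y (n≤1+n 8) ⟩
  9 ^ y                  ≤⟨ squares ⟩
  4 ^ y * (4 * m)        ∎)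
  where
  open ≤-Reasoning
  m = suc m-1
  o = odds 0 m
  lem₁ : ∀ y → 2 * y + y ≡ 3 * y
  lem₁ = solve-∀
  q = ratio (3 ^ y) (2 ^ y) (m^n>0 2 y)
  q≼F : q ≼ F y b
  q≼F = ≤-trans (3^≤F y b y≤b) (≤-reflexive (*-comm (2 ^ y) (rising (2 * b) y)))
  q≼R∞ : 3 ^ y * o ≤ 2 ^ m * m ! * 2 ^ y
  q≼R∞ = ≼-trans q (F y b) (R∞ m) q≼F (≼-trans (F y b) (F x b) (R∞ m) (F-≤ b 0<b y≤x)
           (≼-trans (F x b) (R m M) (R∞ m) (≤-reflexive (sym R≈F)) (<⇒≤ (R≺R∞ m-1 M))))
  lem₂ : ∀ a o → a * o * (a * o) ≡ a * a * (o * o)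
  lem₂ = solve-∀
  lem₃ : ∀ m a o → a * a * (4 * m * (o * o)) ≡ a * a * (4 * m) * (o * o)
  lem₃ = solve-∀
  lem₄ : ∀ a b → a * b * (a * b) ≡ b * b * (a * a)
  lem₄ = solve-∀
  squares : 9 ^ y ≤ 4 ^ y * (4 * m)
  squares = *-cancelʳ-≤ _ _ (o * o) {{>-nonZero (*-mono-≤ (odds-pos 0 m) (odds-pos 0 m))}} (begin
    9 ^ y * (o * o)                                 ≡⟨ cong (_* (o * o)) (^-distribʳ-* y 3 3) ⟩
    3 ^ y * 3 ^ y * (o * o)                         ≡⟨ lem₂ (3 ^ y) o ⟨
    3 ^ y * o * (3 ^ y * o)                         ≤⟨ *-mono-≤ q≼R∞ q≼R∞ ⟩
    2 ^ m * m ! * 2 ^ y * (2 ^ m * m ! * 2 ^ y)     ≡⟨ lem₄ (2 ^ m * m !) (2 ^ y) ⟩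
    2 ^ y * 2 ^ y * (2 ^ m * m ! * (2 ^ m * m !))   ≤⟨ *-monoʳ-≤ (2 ^ y * 2 ^ y) (wallis m-1) ⟩
    2 ^ y * 2 ^ y * (4 * m * (o * o))               ≡⟨ lem₃ m (2 ^ y) o ⟩
    2 ^ y * 2 ^ y * (4 * m) * (o * o)               ≡⟨ cong (λ z → z * (4 * m) * (o * o)) (sym (^-distribʳ-* y 2 2)) ⟩
    4 ^ y * (4 * m) * (o * o)                       ∎)

x-bound : ∀ m M x b → R (suc m) M ≈ F x b → 650 ≤ suc m → suc m ≤ b → 2 ^ x ≤ 4 * suc m
x-bound m M x b R≈F 650≤m m≤b with ≤-<-connex x b
... | inj₁ x≤b = 2^≤4m m M x b x R≈F (≤-trans (s≤s z≤n) m≤b) x≤b ≤-refl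
-- With x > b ≥ m the choice y = m gives 2 ^ m ≤ 4 m, hence 60 m ≤ 320.
... | inj₂ b<x = ⊥-elim (<⇒≱ (toWitness {a? = 320 <? 60 * 650} tt) (≤-trans (*-monoʳ-≤ 60 650≤m)
    (cancel-≤ (4 * suc m) (≤-trans (2^-linear (suc m)) (+-monoˡ-≤ 320 2^m≤4m)) (*-distribʳ-+ (suc m) 4 60) refl)))
  where
  2^m≤4m : 2 ^ suc m ≤ 4 * suc m
  2^m≤4m = 2^≤4m m M x b (suc m) R≈F (≤-trans (s≤s z≤n) m≤b) m≤b (≤-trans m≤b (<⇒≤ b<x))

∣-double : ∀ {p} M j → p ∣ M + suc j → p ∣ 2 * M + 2 * suc j
∣-double {p} M j p∣ = subst (p ∣_) (*-distribˡ-+ 2 M (suc j)) (∣n⇒∣m*n 2 p∣)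

prime∤rising-shift : ∀ {p} → Prime p → ∀ x {d} → x + d < p → ¬ p ∣ rising x d
prime∤rising-shift {p} pr x {d} x+d<p p∣ with prime∣∏ pr d p∣
... | i , i<d , p∣x+1+i = >⇒∤ {{>-nonZero (≤-trans z<s (m≤n+m (suc i) x))}} (≤-<-trans (+-monoʳ-≤ x i<d) x+d<p) p∣x+1+i

-- Members of the window differ by less than p, so p divides one only. As `t` counts from 0, even
-- `t` is an odd member: it occurs in the numerator of R, and p is forced into the numerator of F.
-- Odd `t` is an even member, occurring halved in the denominator, and p is forced into the
-- denominator of F.
no-large-prime : ∀ {p m M x b t} → Prime p → 2 * m < p → t < 2 * m → p ∣ 2 * M + suc t → R m M ≈ F x b →
                 (∀ i → t ≡ 2 * i → ¬ p ∣ rising (2 * b) x) →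
                 (∀ i → suc t ≡ 2 * suc i → ¬ p ∣ rising b x) → ⊥
no-large-prime {p} {m} {M} {x} {b} {t} pr 2m<p t<2m p∣ R≈F odd even with even-or-odd t
... | inj₁ (i , t≡2i) =
  prime∤* pr (odd i t≡2i) (prime∤* pr ∤rising ∤odds)
    (subst (p ∣_) R≈F (∣m⇒∣m*n (rising b x) (∣m⇒∣m*n (m !) (∣-trans p∣f (∣-∏ (λ i → 2 * M + suc (2 * i)) i<m)))))
  where
  p∣f : p ∣ 2 * M + suc (2 * i)
  p∣f = subst (λ t → p ∣ 2 * M + suc t) t≡2i p∣
  i<m : i < m
  i<m = *-cancelˡ-< 2 i m (subst (_< 2 * m) t≡2i t<2m)
  ∤rising : ¬ p ∣ rising M m
  ∤rising p∣r with prime∣∏ pr m p∣r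
  ... | j , j<m , p∣j = even≢odd (suc j) i (sym (residue-unique {x = 2 * M}
    (≤-<-trans (subst (_≤ 2 * m) (cong suc t≡2i) t<2m) 2m<p) (≤-<-trans (*-monoʳ-≤ 2 j<m) 2m<p) p∣f (∣-double M j p∣j)))
  ∤odds : ¬ p ∣ odds 0 m
  ∤odds p∣o with prime∣∏ pr m p∣o
  ... | j , j<m , p∣j = >⇒∤ (≤-<-trans (*-monoʳ-< 2 j<m) 2m<p) p∣j
... | inj₂ (i , t≡) =
  prime∤* pr (prime∤* pr ∤odds (prime∤! pr (≤-<-trans (m≤m+n m (m + 0)) 2m<p))) (even i 1+t≡)
    (subst (p ∣_) (sym R≈F) (∣n⇒∣m*n (rising (2 * b) x) (∣m⇒∣m*n (odds 0 m) (∣-trans p∣M+1+i (∣-∏ (λ i → M + suc i) i<m)))))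
  where
  lem : ∀ i → suc (suc (2 * i)) ≡ 2 * suc i
  lem = solve-∀
  1+t≡ : suc t ≡ 2 * suc i
  1+t≡ = trans (cong suc t≡) (lem i)
  i<m : i < m
  i<m = *-cancelˡ-≤ 2 (subst (_≤ 2 * m) 1+t≡ t<2m)
  p∣f : p ∣ 2 * M + 2 * suc i
  p∣f = subst (λ t → p ∣ 2 * M + t) 1+t≡ p∣
  2<p : 2 < p
  2<p = ≤-<-trans (*-monoʳ-≤ 2 (≤-trans (s≤s z≤n) i<m)) 2m<p
  p∣M+1+i : p ∣ M + suc i
  p∣M+1+i with euclidsLemma 2 (M + suc i) pr (subst (p ∣_) (sym (*-distribˡ-+ 2 M (suc i))) p∣f)
  ... | inj₁ p∣2 = ⊥-elim (>⇒∤ 2<p p∣2)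
  ... | inj₂ p∣M = p∣M
  ∤odds : ¬ p ∣ odds M m
  ∤odds p∣o with prime∣∏ pr m p∣o
  ... | j , j<m , p∣j = even≢odd (suc i) j (residue-unique {x = 2 * M}
    (≤-<-trans (*-monoʳ-≤ 2 i<m) 2m<p) (≤-<-trans (*-monoʳ-< 2 j<m) 2m<p) p∣f p∣j)

prime∣C⇒term : ∀ {p} → Prime p → ∀ N K → p ∣ (N + K) C K → ∃[ t ] t < K × p ∣ N + suc t
prime∣C⇒term {p} pr N K p∣C = prime∣∏ pr K (subst (p ∣_) (C-rising N K) (∣m⇒∣m*n (K !) p∣C))

smooth-b : ∀ {m M x} → R m M ≈ F x m → ∀ {p} → Prime p → p ∣ (2 * M + 2 * m) C (2 * m) → p ≤ 2 * m + x
smooth-b {m} {M} {x} R≈F {p} pr p∣C with prime∣C⇒term pr (2 * M) (2 * m) p∣C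
... | t , t<2m , p∣t = ≮⇒≥ λ 2m+x<p → no-large-prime {m = m} {M} {x} {m} pr (≤-<-trans (m≤m+n (2 * m) x) 2m+x<p) t<2m p∣t R≈F
  (λ _ _ → prime∤rising-shift pr (2 * m) 2m+x<p)
  (λ _ _ → prime∤rising-shift pr m (≤-<-trans (+-monoˡ-≤ x (m≤m+n m (m + 0))) 2m+x<p))

-- The factors M + j of F, doubled, and the factors 2 M + j lie among the first 2 x members of the
-- window. A prime p > 2 m dividing a later member therefore divides none of them. The later members
-- are the 2 m′ integers above 2 (M + x).
smooth-a : ∀ {m′ M x} → R (x + m′) M ≈ F x M → ∀ {p} → Prime p →
           p ∣ (2 * (M + x) + 2 * m′) C (2 * m′) → p ≤ 2 * m′ + 2 * x
smooth-a {m′} {M} {x} R≈F {p} pr p∣C with prime∣C⇒term pr (2 * (M + x)) (2 * m′) p∣C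
... | t , t<2m′ , p∣t = ≮⇒≥ λ 2m<p → no-large-prime {m = x + m′} {M} {x} {M} pr (2m<p′ 2m<p) s<2m p∣s R≈F
      (λ i _ → odd (2m<p′ 2m<p)) (λ i → even (2m<p′ 2m<p) i)
  where
  open ≤-Reasoning
  m = x + m′
  s = 2 * x + t
  lem₁ : ∀ M x t → 2 * (M + x) + suc t ≡ 2 * M + suc (2 * x + t)
  lem₁ = solve-∀
  lem₂ : ∀ m x → 2 * m + 2 * x ≡ 2 * (x + m)
  lem₂ = solve-∀
  2m<p′ : 2 * m′ + 2 * x < p → 2 * m < p
  2m<p′ = subst (_< p) (lem₂ m′ x)
  p∣s : p ∣ 2 * M + suc s
  p∣s = subst (p ∣_) (lem₁ M x t) p∣t
  s<2m : s < 2 * m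
  s<2m = ≤-trans (+-monoʳ-< (2 * x) t<2m′) (≤-reflexive (sym (*-distribˡ-+ 2 x m′)))
  x≤2m : 2 * x ≤ 2 * m
  x≤2m = *-monoʳ-≤ 2 (m≤m+n x m′)
  odd : 2 * m < p → ¬ p ∣ rising (2 * M) x
  odd 2m<p p∣r with prime∣∏ pr x p∣r
  ... | j , j<x , p∣j = <⇒≢ (s≤s (≤-trans j<x (≤-trans (m≤m+n x (x + 0)) (m≤m+n (2 * x) t))))
    (residue-unique {x = 2 * M} (≤-<-trans (≤-trans j<x (≤-trans (m≤m+n x (x + 0)) x≤2m)) 2m<p) (≤-<-trans s<2m 2m<p) p∣j p∣s)
  even : 2 * m < p → ∀ i → suc s ≡ 2 * suc i → ¬ p ∣ rising M x
  even 2m<p i _ p∣r with prime∣∏ pr x p∣r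
  ... | j , j<x , p∣j = <⇒≢ (s≤s (≤-trans (*-monoʳ-≤ 2 j<x) (m≤m+n (2 * x) t)))
    (residue-unique {x = 2 * M} (≤-<-trans (≤-trans (*-monoʳ-≤ 2 j<x) x≤2m) 2m<p) (≤-<-trans s<2m 2m<p) (∣-double M j p∣j) p∣s)

no-large-solution-b : ∀ m M x → 650 ≤ suc m → suc m ≤ M → ¬ R (suc m) M ≈ F x (suc m)
-- The argument `m-1 + (m + 0)` is what remains of `2 * m` after one successor, so that K = 2 m.
no-large-solution-b m-1 M x 650≤m m≤M R≈F = C-not-smooth (2 * M) (m-1 + (m + 0)) X x
  (*-monoʳ-≤ 2 (≤-trans (m≤m+n 625 25) 650≤m)) (*-monoʳ-≤ 2 m≤M) (<⇒≤ 2K<2^X)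
  (≤-trans 2^X≤ (≤-reflexive (sym (*-assoc 2 2 (2 * m)))))
  (≤-trans (^-cancelˡ-≤ 2 ≤-refl (≤-trans (x-bound m-1 M x m R≈F 650≤m ≤-refl) (≤-trans (≤-reflexive (*-assoc 2 2 m)) (<⇒≤ 2K<2^X)))) (m≤m+n X (X + 0)))
  (smooth-b {m} {M} {x} R≈F)
  where
  m = suc m-1
  bits = log₂ (2 * (2 * m)) (s≤s z≤n)
  X = proj₁ bits
  2K<2^X : 2 * (2 * m) < 2 ^ X
  2K<2^X = proj₁ (proj₂ bits)
  2^X≤ : 2 ^ X ≤ 2 * (2 * (2 * m))
  2^X≤ = proj₂ (proj₂ bits)

no-large-solution-a : ∀ m M x → 650 ≤ suc m → suc m ≤ M → ¬ R (suc m) M ≈ F x M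
no-large-solution-a m-1 M x 650≤m m≤M R≈F = contra (m ∸ x) (m+[n∸m]≡n x≤m)
  where
  m = suc m-1
  2^x≤4m : 2 ^ x ≤ 4 * m
  2^x≤4m = x-bound m-1 M x M R≈F 650≤m m≤M
  512x≤ : 512 * x ≤ m + 5120
  512x≤ = bits-linear {m} {x} 2^x≤4m
  x≤m : x ≤ m
  x≤m = *-cancelˡ-≤ 512 (≤-trans 512x≤ (+-monoʳ-≤ m (≤-trans (toWitness {a? = 5120 ≤? 511 * 650} tt) (*-monoʳ-≤ 511 650≤m))))
  contra : ∀ m′ → x + m′ ≡ m → ⊥
  contra m′ x+m′≡m = finish m′ refl
    where
    lem₂ : ∀ x → 512 * x ≡ x + 511 * x
    lem₂ = solve-∀
    lem₃ : ∀ x m′ → x + m′ + 5120 ≡ x + (m′ + 5120)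
    lem₃ = solve-∀
    lem₄ : ∀ x m′ → 511 * (x + m′) ≡ 511 * x + 511 * m′
    lem₄ = solve-∀
    lem₅ : ∀ m′ → m′ + 5120 + 511 * m′ ≡ 512 * m′ + 5120
    lem₅ = solve-∀
    511x≤ : 511 * x ≤ m′ + 5120
    511x≤ = cancel-≤ x 512x≤ (lem₂ x) (trans (cong (_+ 5120) (sym x+m′≡m)) (lem₃ x m′))
    -- The number x is logarithmic in m, so at most 25 of the 650 are lost: 511 * 650 exceeds 512 *
    -- 625 + 5120.
    625≤m′ : 625 ≤ m′
    625≤m′ = *-cancelˡ-≤ 512 (+-cancelʳ-≤ 5120 _ _ (begin
      512 * 625 + 5120            ≤⟨ toWitness {a? = 512 * 625 + 5120 ≤? 511 * 650} tt ⟩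
      511 * 650                   ≤⟨ *-monoʳ-≤ 511 650≤m ⟩
      511 * m                     ≡⟨ cong (511 *_) x+m′≡m ⟨
      511 * (x + m′)              ≡⟨ lem₄ x m′ ⟩
      511 * x + 511 * m′          ≤⟨ +-monoˡ-≤ (511 * m′) 511x≤ ⟩
      m′ + 5120 + 511 * m′        ≡⟨ lem₅ m′ ⟩
      512 * m′ + 5120             ∎))
      where open ≤-Reasoning
    finish : ∀ k → k ≡ m′ → ⊥
    finish zero eq = <⇒≱ (s≤s z≤n) (≤-trans 625≤m′ (≤-reflexive (sym eq)))
    finish k@(suc k-1) refl = C-not-smooth (2 * (M + x)) (k-1 + (k + 0)) X (2 * x)
      (*-monoʳ-≤ 2 625≤m′) (*-monoʳ-≤ 2 (≤-trans (≤-trans (m≤n+m k x) (≤-reflexive x+m′≡m)) (≤-trans m≤M (m≤m+n M x))))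
      (<⇒≤ 2K<2^X) (≤-trans 2^X≤ (≤-reflexive (sym (*-assoc 2 2 (2 * k)))))
      (*-monoʳ-≤ 2 x≤X) (smooth-a {k} {M} {x} (subst (λ m → R m M ≈ F x M) (sym x+m′≡m) R≈F))
      where
      open ≤-Reasoning
      bits = log₂ (2 * (2 * k)) (s≤s z≤n)
      X = proj₁ bits
      2K<2^X : 2 * (2 * k) < 2 ^ X
      2K<2^X = proj₁ (proj₂ bits)
      2^X≤ : 2 ^ X ≤ 2 * (2 * (2 * k))
      2^X≤ = proj₂ (proj₂ bits)
      lem₆ : ∀ k → 4 * k + 4 * k ≡ 2 * (2 * (2 * k))
      lem₆ = solve-∀
      lem₇ : ∀ x k → 4 * (x + k) ≡ 4 * k + 4 * x
      lem₇ = solve-∀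
      -- From X < x follows 8 k ≤ 2 ^ (X + 1) ≤ 2 ^ x ≤ 4 (x + k). But x is far smaller than k.
      k≤x : X < x → k ≤ x
      k≤x X<x = *-cancelˡ-≤ 4 (+-cancelˡ-≤ (4 * k) _ _ (begin
        4 * k + 4 * k              ≡⟨ lem₆ k ⟩
        2 * (2 * (2 * k))          ≤⟨ *-monoʳ-≤ 2 (<⇒≤ 2K<2^X) ⟩
        2 ^ suc X                  ≤⟨ ^-monoʳ-≤ 2 X<x ⟩
        2 ^ x                      ≤⟨ 2^x≤4m ⟩
        4 * m                      ≡⟨ cong (4 *_) x+m′≡m ⟨
        4 * (x + k)                ≡⟨ lem₇ x k ⟩
        4 * k + 4 * x              ∎))
      x≤X : x ≤ X
      x≤X = ≮⇒≥ λ X<x → <⇒≱ (toWitness {a? = 5120 <? 510 * 625} tt) (≤-trans (*-monoʳ-≤ 510 625≤m′)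
             (+-cancelˡ-≤ k (510 * k) 5120 (≤-trans (*-monoʳ-≤ 511 (k≤x X<x)) 511x≤)))

no-solution : ∀ {m} → 2 ≤ m → NoSolution m
no-solution {m@(suc m-1)} 2≤m with <-≤-connex m 650
... | inj₁ m<650 = no-small-solution 2≤m m<650
... | inj₂ 650≤m = (λ M x → no-large-solution-b m-1 M x 650≤m) , (λ M x → no-large-solution-a m-1 M x 650≤m)

-- The solution x = a = 1 and the cases a ≤ 1 and b = 1

C-odd : ∀ b → ((2 * (1 + b)) C (1 + b)) ≡ 2 * ((1 + 2 * b) C b)
C-odd b = *-cancelʳ-≡ _ _ (suc b ! * suc b !) {{suc b !* suc b !≢0}} (begin
  ((2 * suc b) C suc b) * (suc b ! * suc b !)      ≡⟨ cong (λ z → (z C suc b) * (suc b ! * suc b !)) (2*≡+ (suc b)) ⟩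
  ((suc b + suc b) C suc b) * (suc b ! * suc b !)  ≡⟨ C-! (suc b) (suc b) ⟩
  (suc b + suc b) !                                ≡⟨ cong _! (cong suc (+-suc b b)) ⟩
  suc (suc (b + b)) * (suc b + b) !                ≡⟨ cong (suc (suc (b + b)) *_) (C-! (suc b) b) ⟨
  suc (suc (b + b)) * (c * (b ! * suc b !))        ≡⟨ lem b c (b !) (suc b !) ⟩
  2 * c * (suc b ! * suc b !)                      ≡⟨ cong (λ z → 2 * (z C b) * (suc b ! * suc b !)) (cong suc (2*≡+ b)) ⟨
  2 * ((1 + 2 * b) C b) * (suc b ! * suc b !)      ∎)
  where
  open ≡-Reasoning
  c = (suc b + b) C b
  lem : ∀ b c f g → suc (suc (b + b)) * (c * (f * g)) ≡ 2 * c * (suc b * f * g)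
  lem = solve-∀

-- For a = 0 and a = 1, R coincides with F at x = 0 and x = 1, and F is strictly increasing in x:
-- the former contradicts x > 0, the latter leaves x = 1. All other cases are impossible.
uniqueness : ∀ a b x → 0 < x → 0 < b → ((2 * (a + b)) C (a + b)) ≡ ((2 * a) C a) * ((x + 2 * b) C b) → x ≡ 1 × a ≡ 1
uniqueness a b x 0<x 0<b eq = cases a b 0<b R[a,b] R[b,a]
  where
  R[b,a] : R b a ≈ F x b
  R[b,a] = equation-R b a b x (equation a b x eq)
  R[a,b] : R a b ≈ F x b
  R[a,b] = equation-R a b b x (begin
    odds 0 (b + a) * (b ! * a !) * rising b x                    ≡⟨ cong₂ (λ u v → odds 0 u * v * rising b x) (+-comm b a) (*-comm (b !) (a !)) ⟩
    odds 0 (a + b) * (a ! * b !) * rising b x                    ≡⟨ equation a b x eq ⟩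
    (a + b) ! * (odds 0 a * odds 0 b) * rising (2 * b) x         ≡⟨ cong₂ (λ u v → u ! * v * rising (2 * b) x) (+-comm a b) (*-comm (odds 0 a) (odds 0 b)) ⟩
    (b + a) ! * (odds 0 b * odds 0 a) * rising (2 * b) x         ∎)
    where open ≡-Reasoning
  cases : ∀ a b → 0 < b → R a b ≈ F x b → R b a ≈ F x b → x ≡ 1 × a ≡ 1
  cases zero b 0<b R≈F _ = ⊥-elim (≺⇒≉ (F 0 b) (F x b) (F-< b 0<b 0<x) R≈F)
  cases (suc zero) b 0<b R≈F _ with m≤n⇒m<n∨m≡n 0<x
  ... | inj₂ refl = refl , refl
  ... | inj₁ 1<x  = ⊥-elim (≺⇒≉ (F 1 b) (F x b) (F-< b 0<b 1<x)
    (trans (cong (_* rising b x) (sym (*-identityʳ (rising (2 * b) 1)))) (trans R≈F (cong (rising (2 * b) x *_) (*-identityʳ (rising b 1))))))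
  cases a@(suc (suc _)) b 0<b R[a,b] R[b,a] with ≤-total a b
  ... | inj₁ a≤b = ⊥-elim (proj₂ (no-solution (s≤s (s≤s z≤n))) b x a≤b R[a,b])
  cases a@(suc (suc _)) (suc zero) 0<b R[a,b] R[b,a] | inj₂ b≤a =
    -- For b = 1, R = (2 a + 1) / (a + 1) lies strictly between F 1 1 = 3 / 2 and F 2 1 = 2. The
    -- range starts at 2 because a = 1 gives 3 / 2 itself.
    ⊥-elim (separates-b-sound 0 2 (stop 1) refl z<s a x (s≤s (s≤s z≤n)) R[b,a])
  cases a@(suc (suc _)) b@(suc (suc _)) 0<b R[a,b] R[b,a] | inj₂ b≤a =
    ⊥-elim (proj₁ (no-solution (s≤s (s≤s z≤n))) a x b≤a R[b,a])

theorem1p1 : (k x a b : ℕ) → 0 < k → 0 < x → 0 < b → k ≡ a + b →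
    ((2 * k) C k ≡ ((2 * a) C a) * ((x + 2 * b) C b)) ⇔ (x ≡ 1 × a ≡ 1)
theorem1p1 k x a b 0<k 0<x 0<b refl = mk⇔ (uniqueness a b x 0<x 0<b) λ { (refl , refl) → C-odd b }
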